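{- Let $d\ge 2$ be an integer. For every $\eta>0$ there exists a (deterministic) dense forest in $\mathbb{R}^{d}$ with a visibility function $W$ satisfying $$W(\epsilon)=O\left(\epsilon^{ -(d-1)}\cdot\ln(\epsilon^{ -1})\cdot\left(\ln\ln(\epsilon^{ -1})\right)^{1+\eta}\right)\qquad\text{as }\epsilon\to0^{+}.$$
   Context: $\mathbb{R}^{+}$ denotes the positive reals; "decreasing" means non-increasing. $B_2(0,T)$ is the Euclidean ball of radius $T$ centred at the origin of $\mathbb{R}^d$, and $\mathrm{dist}$ is the Euclidean distance. A subset $Y\subseteq\mathbb{R}^{d}$ has finite density if there is $C>0$ with $\#(B_2(0,T)\cap Y)\le C\,T^d$ for every $T>0$. A set $\mathfrak{F}\subseteq\mathbb{R}^{d}$ is a dense forest with visibility function $W$ if $\mathfrak{F}$ has finite density and $W:(0,1)\to\mathbb{R}^{+}$ is a decreasing function tending to $+\infty$ as $\epsilon\to0^{+}$ such that for any $\epsilon\in(0,1)$ and any line segment $L\subseteq\mathbb{R}^{d}$ of length $W(\epsilon)$, there is a point $x\in\mathfrak{F}$ with $\mathrm{dist}(x,L)\le\epsilon$. The $O$-bound means: there exist $C>0$ and $\epsilon_0\in(0,e^{ -1})$ such that $W(\epsilon)\le C\,\epsilon^{ -(d-1)}\ln(\epsilon^{ -1})(\ln\ln(\epsilon^{ -1}))^{1+\eta}$ for all $\epsilon\in(0,\epsilon_0]$. "Deterministic" means that the set is specified without any random choice. -}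

module Defs where

open import Level using (0ℓ)
open import Algebra.Bundles using (module CommutativeRing)
open import Algebra.Bundles.Raw using (RawRing)
open import Algebra.Definitions.RawSemiring as RawSemiringDefs using ()
import Algebra.Properties.Semiring.Exp as Exp
open import Data.Nat.Base as ℕ using (ℕ; zero; suc)
import Data.Nat.Properties as ℕP
import Data.Nat.Coprimality as Coprimality
open import Data.Fin.Base using (Fin)
open import Data.Integer.Base as ℤ using (+_; -[1+_])
import Data.Integer.Properties as ℤP
open import Data.Rational.Base as ℚ using (ℚ; 0ℚ; 1ℚ; ½)
import Data.Rational.Properties as ℚP
open import Data.Sum.Base using (inj₁; inj₂)
open import Data.Product using (Σ; ∃; ∃-syntax; Σ-syntax; _×_; _,_; proj₁; proj₂)
open import Data.Vec.Functional using (Vector)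
open import Function.Definitions using (Injective)
open import Relation.Binary.Core using (Rel)
open import Relation.Binary.Definitions using (_Respects_)
open import Relation.Binary.PropositionalEquality
  using (_≡_; refl; sym; trans; cong; cong₂; subst; subst₂)
open import Relation.Nullary using (yes; no; contradiction)
open import Relation.Unary using (Pred; _∈_; _∩_)

module RationalLemmas where

  open import Data.Rational.Base using (_+_; _*_; _-_; -_; ∣_∣; _≤_; _<_; _⊔_; 1/_; Positive; NonNegative; positive; nonNegative)
  open import Data.Rational.Properties
  open import Data.Rational.Solver using (module +-*-Solver)
  open +-*-Solver
  open Exp (CommutativeRing.semiring +-*-commutativeRing) public using (_^_; ^-assocʳ; ^-homo-*)

  2ℚ : ℚ
  2ℚ = 1ℚ + 1ℚ

  0≤½ : 0ℚ ≤ ½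
  0≤½ = <⇒≤ (positive⁻¹ ½)

  0≤1 : 0ℚ ≤ 1ℚ
  0≤1 = <⇒≤ (positive⁻¹ 1ℚ)

  0<1 : 0ℚ < 1ℚ
  0<1 = positive⁻¹ 1ℚ

  +-nonneg : ∀ {p q} → 0ℚ ≤ p → 0ℚ ≤ q → 0ℚ ≤ p + q
  +-nonneg {p} {q} a b = subst (_≤ p + q) (+-identityˡ 0ℚ) (+-mono-≤ a b)

  +-pos : ∀ {p q} → 0ℚ < p → 0ℚ ≤ q → 0ℚ < p + q
  +-pos {p} {q} a b = subst (_< p + q) (+-identityˡ 0ℚ) (+-mono-<-≤ a b)

  *-mono : ∀ {p q r s} → 0ℚ ≤ p → 0ℚ ≤ s → p ≤ q → r ≤ s → p * r ≤ q * s
  *-mono {p} {q} {r} {s} 0≤p 0≤s p≤q r≤s = ≤-trans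
    (*-monoˡ-≤-nonNeg p {{nonNegative 0≤p}} r≤s)
    (*-monoʳ-≤-nonNeg s {{nonNegative 0≤s}} p≤q)

  *-nonneg : ∀ {p q} → 0ℚ ≤ p → 0ℚ ≤ q → 0ℚ ≤ p * q
  *-nonneg {p} {q} a b = subst (_≤ p * q) (*-zeroʳ p) (*-monoˡ-≤-nonNeg p {{nonNegative a}} b)

  *-pos : ∀ {p q} → 0ℚ < p → 0ℚ < q → 0ℚ < p * q
  *-pos {p} {q} a b =
    positive⁻¹ (p * q) {{pos*pos⇒pos p {{positive a}} q {{positive b}}}}

  x-y+y : ∀ x y → (x - y) + y ≡ x
  x-y+y = solve 2 (λ x y → (x :- y) :+ y := x) refl

  y+x-y : ∀ x y → (y + x) - y ≡ x
  y+x-y = solve 2 (λ x y → (y :+ x) :- y := x) refl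

  p≤∣p∣ : ∀ p → p ≤ ∣ p ∣
  p≤∣p∣ p with ≤-total 0ℚ p
  ... | inj₁ a = ≤-reflexive (sym (0≤p⇒∣p∣≡p a))
  ... | inj₂ a = ≤-trans a (0≤∣p∣ p)

  ∣p-q∣≡∣q-p∣ : ∀ p q → ∣ p - q ∣ ≡ ∣ q - p ∣
  ∣p-q∣≡∣q-p∣ p q = trans (sym (∣-p∣≡∣p∣ (p - q)))
    (cong ∣_∣ (solve 2 (λ p q → :- (p :- q) := q :- p) refl p q))

  -- ∣ x - y ∣ ≤ δ, split into two inequalities
  abs-≤ : ∀ {x y δ} → x ≤ y + δ → y ≤ x + δ → ∣ x - y ∣ ≤ δ
  abs-≤ {x} {y} {δ} a b with ∣p∣≡p∨∣p∣≡-p (x - y)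
  ... | inj₁ e = subst₂ _≤_ (sym e) (y+x-y δ y) (+-monoˡ-≤ (- y) a)
  ... | inj₂ e = subst₂ _≤_
    (trans (solve 2 (λ x y → y :- x := :- (x :- y)) refl x y) (sym e))
    (y+x-y δ x) (+-monoˡ-≤ (- x) b)

  abs-≤⁻ : ∀ x y {δ} → ∣ x - y ∣ ≤ δ → x ≤ y + δ
  abs-≤⁻ x y {δ} a = subst₂ _≤_ (x-y+y x y) (+-comm δ y)
    (+-monoˡ-≤ y (≤-trans (p≤∣p∣ (x - y)) a))

  triangle : ∀ x y z {a b} → ∣ x - y ∣ ≤ a → ∣ y - z ∣ ≤ b → ∣ x - z ∣ ≤ a + b
  triangle x y z a b = subst (λ t → ∣ t ∣ ≤ _)
    (solve 3 (λ x y z → (x :- y) :+ (y :- z) := x :- z) refl x y z)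
    (≤-trans (∣p+q∣≤∣p∣+∣q∣ (x - y) (y - z)) (+-mono-≤ a b))

  quotient : ∀ {b δ} → 0ℚ < b → 0ℚ < δ → Σ[ κ ∈ ℚ ] (0ℚ < κ × b * κ ≡ δ)
  quotient {b} {δ} 0<b 0<δ = 1/ b * δ , *-pos (positive⁻¹ (1/ b) {{1/pos⇒pos b}}) 0<δ ,
    trans (sym (*-assoc b (1/ b) δ)) (trans (cong (_* δ) (*-inverseʳ b)) (*-identityˡ δ))
    where instance
      _ : Positive b
      _ = positive 0<b
      _ : ℚ.NonZero b
      _ = pos⇒nonZero b

  half-sum : ∀ δ → ½ * δ + ½ * δ ≡ δ
  half-sum = solve 1 (λ δ → con ½ :* δ :+ con ½ :* δ := δ) refl

  half-pos : ∀ {δ} → 0ℚ < δ → 0ℚ < ½ * δ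
  half-pos = *-pos (positive⁻¹ ½)

  ^-nonneg : ∀ {p} n → 0ℚ ≤ p → 0ℚ ≤ p ^ n
  ^-nonneg zero    a = 0≤1
  ^-nonneg (suc n) a = *-nonneg a (^-nonneg n a)

  ^-mono : ∀ {p q} n → 0ℚ ≤ p → p ≤ q → p ^ n ≤ q ^ n
  ^-mono zero    a b = ≤-refl
  ^-mono (suc n) a b = *-mono a (^-nonneg n (≤-trans a b)) b (^-mono n a b)

  1≤^ : ∀ {p} n → 1ℚ ≤ p → 1ℚ ≤ p ^ n
  1≤^ zero    a = ≤-refl
  1≤^ (suc n) a = *-mono 0≤1 (≤-trans 0≤1 (1≤^ n a)) a (1≤^ n a)

  ½^-step : ∀ n → ½ ^ suc n ≤ ½ ^ n
  ½^-step n = subst (½ * ½ ^ n ≤_) (*-identityˡ (½ ^ n))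
    (*-monoʳ-≤-nonNeg (½ ^ n) {{nonNegative (^-nonneg n 0≤½)}} (toWitness {a? = ½ ≤? 1ℚ} _))
    where open import Relation.Nullary.Decidable using (toWitness)

  ½^-anti : ∀ {m n} → m ℕ.≤ n → ½ ^ n ≤ ½ ^ m
  ½^-anti {m} m≤n = go (ℕP.≤⇒≤′ m≤n)
    where
    go : ∀ {n} → m ℕ.≤′ n → ½ ^ n ≤ ½ ^ m
    go ℕ.≤′-refl         = ≤-refl
    go (ℕ.≤′-step {n} p) = ≤-trans (½^-step n) (go p)

  fromℕ : ℕ → ℚ
  fromℕ n = ℚ.mkℚ (+ n) 0 (Coprimality.sym (Coprimality.1-coprimeTo n))

  fromℕ-suc : ∀ n → fromℕ (suc n) ≡ 1ℚ + fromℕ n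
  fromℕ-suc n = sym (trans
    (cong (λ i → (+ 1 ℤ.+ i) ℚ./ 1) (ℤP.*-identityʳ (+ n)))
    (normalize-coprime _))

  ≤fromℕ : ∀ p → ∃ λ n → p ≤ fromℕ n
  ≤fromℕ (ℚ.mkℚ (+ n) d _)      = n , ℚ.*≤* (ℤP.*-monoˡ-≤-nonNeg (+ n) (ℤ.+≤+ (ℕ.s≤s ℕ.z≤n)))
  ≤fromℕ (ℚ.mkℚ (-[1+ n ]) d _) = 0 , ℚ.*≤* ℤ.-≤+

  fromℕ*½^ : ∀ n → fromℕ n * ½ ^ n ≤ 1ℚ
  fromℕ*½^ zero    = 0≤1
  fromℕ*½^ (suc n) = subst₂ _≤_
    (trans (eq (fromℕ n) (½ ^ n)) (cong (_* ½ ^ suc n) (sym (fromℕ-suc n))))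
    (half-sum 1ℚ)
    (+-mono-≤ (*-monoˡ-≤-nonNeg ½ (½^-anti {0} {n} ℕ.z≤n))
              (*-monoˡ-≤-nonNeg ½ (fromℕ*½^ n)))
    where
    eq : ∀ p q → ½ * q + ½ * (p * q) ≡ (1ℚ + p) * (½ * q)
    eq = solve 2 (λ p q → con ½ :* q :+ con ½ :* (p :* q) := (con 1ℚ :+ p) :* (con ½ :* q)) refl

  -- q / 2ⁿ is eventually at most δ
  vanishes : ∀ q {δ} → 0ℚ ≤ q → 0ℚ < δ → ∃ λ N → ∀ n → N ℕ.≤ n → q * ½ ^ n ≤ δ
  vanishes q {δ} 0≤q 0<δ with quotient 0<δ 0<1
  ... | κ , 0<κ , δκ≡1 with ≤fromℕ (q * κ)
  ... | N , h = N , λ n N≤n → ≤-trans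
    (*-monoˡ-≤-nonNeg q {{nonNegative 0≤q}} (½^-anti N≤n))
    (subst₂ _≤_ (eq q κ δ (½ ^ N) δκ≡1) (*-identityʳ δ)
      (*-monoˡ-≤-nonNeg δ {{nonNegative (<⇒≤ 0<δ)}}
        (≤-trans (*-monoʳ-≤-nonNeg (½ ^ N) {{nonNegative (^-nonneg N 0≤½)}} h) (fromℕ*½^ N))))
    where
    eq : ∀ q κ δ h → δ * κ ≡ 1ℚ → δ * ((q * κ) * h) ≡ q * h
    eq q κ δ h e = trans
      (solve 4 (λ q κ δ h → δ :* ((q :* κ) :* h) := (δ :* κ) :* (q :* h)) refl q κ δ h)
      (trans (cong (_* (q * h)) e) (*-identityˡ (q * h)))

  ∣∣-bound : ∀ {x b} → x ≤ b → - x ≤ b → ∣ x ∣ ≤ b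
  ∣∣-bound {x} a b with ∣p∣≡p∨∣p∣≡-p x
  ... | inj₁ e = subst (_≤ _) (sym e) a
  ... | inj₂ e = subst (_≤ _) (sym e) b

  *-diff : ∀ x x' y y' {a b α β} → ∣ x ∣ ≤ a → ∣ y' ∣ ≤ b → ∣ x - x' ∣ ≤ α → ∣ y - y' ∣ ≤ β →
           ∣ x * y - x' * y' ∣ ≤ a * β + b * α
  *-diff x x' y y' {a} {b} {α} {β} ha hb hα hβ = subst (λ t → ∣ t ∣ ≤ a * β + b * α)
    (solve 4 (λ x x' y y' → x :* (y :- y') :+ y' :* (x :- x') := x :* y :- x' :* y') refl x x' y y')
    (≤-trans (∣p+q∣≤∣p∣+∣q∣ (x * (y - y')) (y' * (x - x')))
      (+-mono-≤ (mul ha hβ) (mul hb hα)))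
    where
    mul : ∀ {p q r s} → ∣ p ∣ ≤ r → ∣ q ∣ ≤ s → ∣ p * q ∣ ≤ r * s
    mul {p} {q} h k = subst (_≤ _) (sym (∣p*q∣≡∣p∣*∣q∣ p q))
      (*-mono (0≤∣p∣ p) (≤-trans (0≤∣p∣ q) k) h k)

  ∣^∣ : ∀ x n → ∣ x ^ n ∣ ≡ ∣ x ∣ ^ n
  ∣^∣ x zero    = refl
  ∣^∣ x (suc n) = trans (∣p*q∣≡∣p∣*∣q∣ x (x ^ n)) (cong (∣ x ∣ *_) (∣^∣ x n))

  ^-diff : ∀ x y k {M δ} → 1ℚ ≤ M → ∣ x ∣ ≤ M → ∣ y ∣ ≤ M → ∣ x - y ∣ ≤ δ →
           ∣ x ^ k - y ^ k ∣ ≤ (fromℕ k * M ^ k) * δ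
  ^-diff x y zero    {M} {δ} 1≤M hx hy h = ≤-reflexive (sym (trans (cong (_* δ) (*-zeroˡ 1ℚ)) (*-zeroˡ δ)))
  ^-diff x y (suc k) {M} {δ} 1≤M hx hy h = ≤-trans
    (*-diff x y (x ^ k) (y ^ k) hx
       (subst (_≤ M ^ k) (sym (∣^∣ y k)) (^-mono k (0≤∣p∣ y) hy)) h (^-diff x y k 1≤M hx hy h))
    (subst (M * ((fromℕ k * M ^ k) * δ) + M ^ k * δ ≤_)
      (trans (eq M (fromℕ k) (M ^ k) δ) (cong (λ t → (t * (M * M ^ k)) * δ) (sym (fromℕ-suc k))))
      (+-monoʳ-≤ (M * ((fromℕ k * M ^ k) * δ))
        (*-monoʳ-≤-nonNeg δ {{nonNegative 0≤δ}}
          (subst (_≤ M * M ^ k) (*-identityˡ (M ^ k))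
            (*-monoʳ-≤-nonNeg (M ^ k) {{nonNegative (^-nonneg k (≤-trans 0≤1 1≤M))}} 1≤M)))))
    where
    0≤δ : 0ℚ ≤ δ
    0≤δ = ≤-trans (0≤∣p∣ (x - y)) h
    eq : ∀ M n P δ → M * ((n * P) * δ) + (M * P) * δ ≡ ((1ℚ + n) * (M * P)) * δ
    eq = solve 4 (λ M n P δ → M :* ((n :* P) :* δ) :+ (M :* P) :* δ := ((con 1ℚ :+ n) :* (M :* P)) :* δ) refl

  0≤fromℕ : ∀ n → 0ℚ ≤ fromℕ n
  0≤fromℕ n = nonNegative⁻¹ (fromℕ n)

  fromℕ-+ : ∀ m n → fromℕ (m ℕ.+ n) ≡ fromℕ m + fromℕ n
  fromℕ-+ zero    n = sym (+-identityˡ (fromℕ n))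
  fromℕ-+ (suc m) n = trans (fromℕ-suc (m ℕ.+ n)) (trans (cong (λ t → 1ℚ + t) (fromℕ-+ m n))
    (trans (sym (+-assoc 1ℚ (fromℕ m) (fromℕ n))) (cong (_+ fromℕ n) (sym (fromℕ-suc m)))))

  2^*½^ : ∀ n → fromℕ (2 ℕ.^ n) * ½ ^ n ≡ 1ℚ
  2^*½^ zero    = refl
  2^*½^ (suc n) = trans
    (cong (_* ½ ^ suc n) (trans (fromℕ-+ k (k ℕ.+ 0)) (cong (λ j → fromℕ k + fromℕ j) (ℕP.+-identityʳ k))))
    (trans (solve 2 (λ k h → (k :+ k) :* (con ½ :* h) := k :* h) refl (fromℕ k) (½ ^ n)) (2^*½^ n))
    where
    k : ℕ
    k = 2 ℕ.^ n

  bernoulli : ∀ t k → 0ℚ ≤ t → (1ℚ + t) ^ k * (1ℚ - fromℕ k * t) ≤ 1ℚ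
  bernoulli t zero    0≤t = ≤-reflexive
    (solve 1 (λ t → con 1ℚ :* (con 1ℚ :- con 0ℚ :* t) := con 1ℚ) refl t)
  bernoulli t (suc k) 0≤t = ≤-trans
    (subst₂ _≤_
      (trans (eq t ((1ℚ + t) ^ k) (fromℕ k))
             (cong (λ n → (1ℚ + t) ^ suc k * (1ℚ - n * t)) (sym (fromℕ-suc k))))
      (+-identityʳ _)
      (+-monoʳ-≤ ((1ℚ + t) ^ k * (1ℚ - fromℕ k * t))
        (neg-antimono-≤ (*-nonneg (^-nonneg k 0≤1+t)
          (*-nonneg (+-nonneg 0≤1 (0≤fromℕ k)) (*-nonneg 0≤t 0≤t))))))
    (bernoulli t k 0≤t)
    where
    0≤1+t : 0ℚ ≤ 1ℚ + t
    0≤1+t = +-nonneg 0≤1 0≤t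
    eq : ∀ t P n → P * (1ℚ - n * t) + - (P * ((1ℚ + n) * (t * t))) ≡ ((1ℚ + t) * P) * (1ℚ - (1ℚ + n) * t)
    eq = solve 3 (λ t P n → P :* (con 1ℚ :- n :* t) :+ :- (P :* ((con 1ℚ :+ n) :* (t :* t)))
                   := ((con 1ℚ :+ t) :* P) :* (con 1ℚ :- (con 1ℚ :+ n) :* t)) refl

  -- Euler's (1 + x/N)ᴺ along N = 2ⁿ
  euler : ℕ → ℚ → ℚ
  euler n x = (1ℚ + x * ½ ^ n) ^ (2 ℕ.^ n)

  1≤2 : 1ℚ ≤ 2ℚ
  1≤2 = subst (_≤ 2ℚ) (+-identityʳ 1ℚ) (+-monoʳ-≤ 1ℚ 0≤1)

  doubling : ∀ m → (1ℚ + ½ * ½ ^ m) ^ (2 ℕ.^ m) ≤ 2ℚ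
  doubling m = subst (_≤ 2ℚ) (cancel P) (*-monoˡ-≤-nonNeg 2ℚ P*½≤1)
    where
    t P : ℚ
    t = ½ * ½ ^ m
    P = (1ℚ + t) ^ (2 ℕ.^ m)
    cancel : ∀ p → 2ℚ * (p * ½) ≡ p
    cancel = solve 1 (λ p → con 2ℚ :* (p :* con ½) := p) refl
    half : 1ℚ - fromℕ (2 ℕ.^ m) * t ≡ ½
    half = trans (solve 2 (λ k h → con 1ℚ :- k :* (con ½ :* h) := con 1ℚ :- con ½ :* (k :* h)) refl
                    (fromℕ (2 ℕ.^ m)) (½ ^ m))
                 (cong (λ s → 1ℚ - ½ * s) (2^*½^ m))
    P*½≤1 : P * ½ ≤ 1ℚ
    P*½≤1 = subst (λ s → P * s ≤ 1ℚ) half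
      (bernoulli t (2 ℕ.^ m) (*-nonneg 0≤½ (^-nonneg m 0≤½)))

  euler-bound-at : ∀ {b} → 0ℚ ≤ b → ∀ c → b * ½ ^ c ≤ ½ → ∀ m →
                   euler (m ℕ.+ c) b ≤ 2ℚ ^ (2 ℕ.^ c)
  euler-bound-at {b} 0≤b c small m = subst (_≤ 2ℚ ^ (2 ℕ.^ c)) split
    (^-mono (2 ℕ.^ c) (^-nonneg (2 ℕ.^ m) 0≤1+u)
      (≤-trans (^-mono (2 ℕ.^ m) 0≤1+u (+-monoʳ-≤ 1ℚ u≤t)) (doubling m)))
    where
    u t : ℚ
    u = b * ½ ^ (m ℕ.+ c)
    t = ½ * ½ ^ m
    0≤1+u : 0ℚ ≤ 1ℚ + u
    0≤1+u = +-nonneg 0≤1 (*-nonneg 0≤b (^-nonneg (m ℕ.+ c) 0≤½))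
    rearrange : ∀ b p q → (b * q) * p ≡ b * (p * q)
    rearrange = solve 3 (λ b p q → (b :* q) :* p := b :* (p :* q)) refl
    u≤t : u ≤ t
    u≤t = subst (_≤ t)
      (trans (rearrange b (½ ^ m) (½ ^ c)) (cong (b *_) (sym (^-homo-* ½ m c))))
      (*-monoʳ-≤-nonNeg (½ ^ m) {{nonNegative (^-nonneg m 0≤½)}} small)
    split : ((1ℚ + u) ^ (2 ℕ.^ m)) ^ (2 ℕ.^ c) ≡ euler (m ℕ.+ c) b
    split = trans (^-assocʳ (1ℚ + u) (2 ℕ.^ m) (2 ℕ.^ c))
      (cong ((1ℚ + u) ^_) (sym (ℕP.^-distribˡ-+-* 2 m c)))

  euler-bound : ∀ {b} → 0ℚ ≤ b → ∃ λ N → ∃ λ K → 0ℚ < K × (∀ n → N ℕ.≤ n → euler n b ≤ K)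
  euler-bound {b} 0≤b = bound (vanishes b 0≤b (positive⁻¹ ½))
    where
    bound : (∃ λ N → ∀ n → N ℕ.≤ n → b * ½ ^ n ≤ ½) → _
    bound (c , small) = c , 2ℚ ^ (2 ℕ.^ c) , <-≤-trans 0<1 (1≤^ (2 ℕ.^ c) 1≤2) , λ n c≤n →
      subst (λ n → euler n b ≤ 2ℚ ^ (2 ℕ.^ c)) (ℕP.m∸n+n≡m c≤n)
        (euler-bound-at 0≤b c (small c ℕP.≤-refl) (n ℕ.∸ c))

  module Euler {b : ℚ} (0≤b : 0ℚ ≤ b) where

    N₀ : ℕ
    N₀ = proj₁ (euler-bound 0≤b)

    K : ℚ
    K = proj₁ (proj₂ (euler-bound 0≤b))

    0<K : 0ℚ < K
    0<K = proj₁ (proj₂ (proj₂ (euler-bound 0≤b)))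

    ≤K : ∀ n → N₀ ℕ.≤ n → euler n b ≤ K
    ≤K = proj₂ (proj₂ (proj₂ (euler-bound 0≤b)))

    0≤h : ∀ n → 0ℚ ≤ ½ ^ n
    0≤h n = ^-nonneg n 0≤½

    ∣1+∣ : ∀ n {x} → ∣ x ∣ ≤ b → ∣ 1ℚ + x * ½ ^ n ∣ ≤ 1ℚ + b * ½ ^ n
    ∣1+∣ n {x} h = ≤-trans (∣p+q∣≤∣p∣+∣q∣ 1ℚ (x * ½ ^ n)) (+-monoʳ-≤ 1ℚ
      (subst (_≤ b * ½ ^ n)
        (trans (cong (∣ x ∣ *_) (sym (0≤p⇒∣p∣≡p (0≤h n)))) (sym (∣p*q∣≡∣p∣*∣q∣ x (½ ^ n))))
        (*-monoʳ-≤-nonNeg (½ ^ n) {{nonNegative (0≤h n)}} h)))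

    1≤1+ : ∀ n → 1ℚ ≤ 1ℚ + b * ½ ^ n
    1≤1+ n = subst (_≤ 1ℚ + b * ½ ^ n) (+-identityʳ 1ℚ) (+-monoʳ-≤ 1ℚ (*-nonneg 0≤b (0≤h n)))

    lipschitz : ∀ n {x y δ} → N₀ ℕ.≤ n → ∣ x ∣ ≤ b → ∣ y ∣ ≤ b → ∣ x - y ∣ ≤ δ →
                ∣ euler n x - euler n y ∣ ≤ K * δ
    lipschitz n {x} {y} {δ} N₀≤n hx hy h = ≤-trans
      (^-diff (1ℚ + x * ½ ^ n) (1ℚ + y * ½ ^ n) (2 ℕ.^ n) (1≤1+ n) (∣1+∣ n hx) (∣1+∣ n hy) close)
      (subst (_≤ K * δ)
        (trans (sym (*-identityˡ (euler n b * δ)))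
          (trans (cong (_* (euler n b * δ)) (sym (2^*½^ n))) (eq (fromℕ (2 ℕ.^ n)) (½ ^ n) (euler n b) δ)))
        (*-monoʳ-≤-nonNeg δ {{nonNegative (≤-trans (0≤∣p∣ (x - y)) h)}} (≤K n N₀≤n)))
      where
      eq : ∀ k h P δ → (k * h) * (P * δ) ≡ (k * P) * (h * δ)
      eq = solve 4 (λ k h P δ → (k :* h) :* (P :* δ) := (k :* P) :* (h :* δ)) refl
      close : ∣ (1ℚ + x * ½ ^ n) - (1ℚ + y * ½ ^ n) ∣ ≤ ½ ^ n * δ
      close = subst (_≤ ½ ^ n * δ)
        (trans (cong (_* ∣ x - y ∣) (sym (0≤p⇒∣p∣≡p (0≤h n))))
          (trans (sym (∣p*q∣≡∣p∣*∣q∣ (½ ^ n) (x - y)))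
            (cong ∣_∣ (solve 3 (λ x y h → h :* (x :- y) := (con 1ℚ :+ x :* h) :- (con 1ℚ :+ y :* h)) refl x y (½ ^ n)))))
        (*-monoˡ-≤-nonNeg (½ ^ n) {{nonNegative (0≤h n)}} h)

    C : ℚ
    C = K * (b * b)

    0≤C : 0ℚ ≤ C
    0≤C = *-nonneg (<⇒≤ 0<K) (*-nonneg 0≤b 0≤b)

    step : ∀ n {x} → N₀ ℕ.≤ n → ∣ x ∣ ≤ b →
           ∣ euler (suc n) x - euler n x ∣ ≤ C * (½ ^ n - ½ ^ suc n)
    step n {x} N₀≤n hx = ≤-trans
      (subst (λ e → ∣ e - euler n x ∣ ≤ (fromℕ (2 ℕ.^ n) * M ^ (2 ℕ.^ n)) * D) (^-assocʳ v 2 (2 ℕ.^ n))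
        (^-diff (v ^ 2) (1ℚ + x * h) (2 ℕ.^ n) 1≤M ∣v²∣≤M ∣w∣≤M close))
      (≤-trans
        (*-monoʳ-≤-nonNeg D {{nonNegative (*-nonneg (*-nonneg 0≤b 0≤b) (*-nonneg (0≤h (suc n)) (0≤h (suc n))))}}
          (*-monoˡ-≤-nonNeg (fromℕ (2 ℕ.^ n)) {{nonNegative (0≤fromℕ (2 ℕ.^ n))}}
            (subst (_≤ K) (sym (^-assocʳ (1ℚ + b * ½ ^ suc n) 2 (2 ℕ.^ n))) (≤K (suc n) (ℕP.m≤n⇒m≤1+n N₀≤n)))))
        (subst₂ _≤_
          (trans (cong (λ s → C * (½ * (½ * (s * h)))) (sym (2^*½^ n))) (eq₁ (fromℕ (2 ℕ.^ n)) K b h))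
          (eq₂ C h)
          (*-monoˡ-≤-nonNeg C {{nonNegative 0≤C}}
            (subst (½ * (½ * (1ℚ * h)) ≤_) (half-sum (½ * h))
              (subst₂ _≤_ (eq₃ h) refl (+-monoˡ-≤ (½ * (½ * h)) (*-nonneg 0≤½ (*-nonneg 0≤½ (0≤h n)))))))))
      where
      h v M D : ℚ
      h = ½ ^ n
      v = 1ℚ + x * ½ ^ suc n
      M = (1ℚ + b * ½ ^ suc n) ^ 2
      D = (b * b) * (½ ^ suc n * ½ ^ suc n)
      1≤M : 1ℚ ≤ M
      1≤M = 1≤^ 2 (1≤1+ (suc n))
      ∣v²∣≤M : ∣ v ^ 2 ∣ ≤ M
      ∣v²∣≤M = subst (_≤ M) (sym (∣^∣ v 2)) (^-mono 2 (0≤∣p∣ v) (∣1+∣ (suc n) hx))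
      ∣w∣≤M : ∣ 1ℚ + x * h ∣ ≤ M
      ∣w∣≤M = ≤-trans (∣1+∣ n hx) (subst₂ _≤_ (+-identityʳ (1ℚ + b * h))
        (solve 2 (λ b h → (con 1ℚ :+ b :* h) :+ ((b :* (con ½ :* h)) :* (b :* (con ½ :* h)))
                   := (con 1ℚ :+ b :* (con ½ :* h)) :* ((con 1ℚ :+ b :* (con ½ :* h)) :* con 1ℚ)) refl b h)
        (+-monoʳ-≤ (1ℚ + b * h) (*-nonneg 0≤bh 0≤bh)))
        where
        0≤bh : 0ℚ ≤ b * ½ ^ suc n
        0≤bh = *-nonneg 0≤b (0≤h (suc n))
      close : ∣ v ^ 2 - (1ℚ + x * h) ∣ ≤ D
      close = subst (_≤ D)
        (trans (trans (cong ((∣ x ∣ * ∣ x ∣) *_) (sym (0≤p⇒∣p∣≡p (*-nonneg (0≤h (suc n)) (0≤h (suc n))))))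
            (trans (cong (_* ∣ ½ ^ suc n * ½ ^ suc n ∣) (sym (∣p*q∣≡∣p∣*∣q∣ x x)))
              (sym (∣p*q∣≡∣p∣*∣q∣ (x * x) (½ ^ suc n * ½ ^ suc n)))))
          (cong ∣_∣ (solve 2 (λ x h → (x :* x) :* ((con ½ :* h) :* (con ½ :* h))
             := ((con 1ℚ :+ x :* (con ½ :* h)) :* ((con 1ℚ :+ x :* (con ½ :* h)) :* con 1ℚ)) :- (con 1ℚ :+ x :* h)) refl x h)))
        (*-monoʳ-≤-nonNeg (½ ^ suc n * ½ ^ suc n) {{nonNegative (*-nonneg (0≤h (suc n)) (0≤h (suc n)))}}
          (*-mono (0≤∣p∣ x) 0≤b hx hx))
      eq₁ : ∀ k K b h → (K * (b * b)) * (½ * (½ * ((k * h) * h))) ≡ (k * K) * ((b * b) * ((½ * h) * (½ * h)))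
      eq₁ = solve 4 (λ k K b h → (K :* (b :* b)) :* (con ½ :* (con ½ :* ((k :* h) :* h)))
              := (k :* K) :* ((b :* b) :* ((con ½ :* h) :* (con ½ :* h)))) refl
      eq₂ : ∀ C h → C * (½ * h) ≡ C * (h - ½ * h)
      eq₂ = solve 2 (λ C h → C :* (con ½ :* h) := C :* (h :- con ½ :* h)) refl
      eq₃ : ∀ h → 0ℚ + ½ * (½ * h) ≡ ½ * (½ * (1ℚ * h))
      eq₃ = solve 1 (λ h → con 0ℚ :+ con ½ :* (con ½ :* h) := con ½ :* (con ½ :* (con 1ℚ :* h))) refl

    telescope : ∀ {m n x} → N₀ ℕ.≤ m → m ℕ.≤′ n → ∣ x ∣ ≤ b →
                ∣ euler n x - euler m x ∣ ≤ C * (½ ^ m - ½ ^ n)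
    telescope {m} {.m} {x} _ ℕ.≤′-refl _ = ≤-reflexive
      (trans (cong ∣_∣ (+-inverseʳ (euler m x)))
        (sym (trans (cong (C *_) (+-inverseʳ (½ ^ m))) (*-zeroʳ C))))
    telescope {m} {suc n} {x} N₀≤m (ℕ.≤′-step m≤n) hx = subst (_ ≤_) (eq C (½ ^ m) (½ ^ n) (½ ^ suc n))
      (triangle (euler (suc n) x) (euler n x) (euler m x)
        (step n (ℕP.≤-trans N₀≤m (ℕP.≤′⇒≤ m≤n)) hx) (telescope N₀≤m m≤n hx))
      where
      eq : ∀ C p q r → C * (q - r) + C * (p - q) ≡ C * (p - r)
      eq = solve 4 (λ C p q r → C :* (q :- r) :+ C :* (p :- q) := C :* (p :- r)) refl

    tail : ∀ {m n x} → N₀ ℕ.≤ m → m ℕ.≤ n → ∣ x ∣ ≤ b → ∣ euler n x - euler m x ∣ ≤ C * ½ ^ m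
    tail {m} {n} N₀≤m m≤n hx = ≤-trans (telescope N₀≤m (ℕP.≤⇒≤′ m≤n) hx)
      (*-monoˡ-≤-nonNeg C {{nonNegative 0≤C}}
        (subst (½ ^ m - ½ ^ n ≤_) (+-identityʳ (½ ^ m)) (+-monoʳ-≤ (½ ^ m) (neg-antimono-≤ (0≤h n)))))

  Cauchy : (ℕ → ℚ) → Set
  Cauchy x = ∀ δ → 0ℚ < δ → ∃ λ N → ∀ m n → N ℕ.≤ m → N ℕ.≤ n → ∣ x m - x n ∣ ≤ δ

  Bounded : (ℕ → ℚ) → Set
  Bounded x = ∃ λ N → ∃ λ b → 0ℚ < b × (∀ n → N ℕ.≤ n → ∣ x n ∣ ≤ b)

  ⊔-≤ˡ : ∀ m n {o} → m ℕ.⊔ n ℕ.≤ o → m ℕ.≤ o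
  ⊔-≤ˡ m n = ℕP.m⊔n≤o⇒m≤o m n

  ⊔-≤ʳ : ∀ m n {o} → m ℕ.⊔ n ℕ.≤ o → n ℕ.≤ o
  ⊔-≤ʳ m n = ℕP.m⊔n≤o⇒n≤o m n

  cauchy⇒bounded : ∀ {x} → Cauchy x → Bounded x
  cauchy⇒bounded {x} cx = from (cx 1ℚ 0<1)
    where
    from : (∃ λ N → ∀ m n → N ℕ.≤ m → N ℕ.≤ n → ∣ x m - x n ∣ ≤ 1ℚ) → Bounded x
    from (N , h) = N , 1ℚ + ∣ x N ∣ , +-pos 0<1 (0≤∣p∣ (x N)) , λ n N≤n →
      subst (λ t → ∣ t ∣ ≤ 1ℚ + ∣ x N ∣) (x-y+y (x n) (x N))
        (≤-trans (∣p+q∣≤∣p∣+∣q∣ (x n - x N) (x N)) (+-monoˡ-≤ ∣ x N ∣ (h n N N≤n ℕP.≤-refl)))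

  const-cauchy : ∀ q → Cauchy (λ _ → q)
  const-cauchy q δ 0<δ = 0 , λ _ _ _ _ → subst (λ t → ∣ t ∣ ≤ δ) (sym (+-inverseʳ q)) (<⇒≤ 0<δ)

  neg-cauchy : ∀ {x} → Cauchy x → Cauchy (λ n → - x n)
  neg-cauchy {x} cx δ 0<δ with cx δ 0<δ
  ... | N , h = N , λ m n N≤m N≤n → subst (_≤ δ) (trans (sym (∣-p∣≡∣p∣ (x m - x n)))
      (cong ∣_∣ (solve 2 (λ p q → :- (p :- q) := :- p :- :- q) refl (x m) (x n)))) (h m n N≤m N≤n)

  +-cauchy : ∀ {x y} → Cauchy x → Cauchy y → Cauchy (λ n → x n + y n)
  +-cauchy {x} {y} cx cy δ 0<δ with cx (½ * δ) (half-pos 0<δ) | cy (½ * δ) (half-pos 0<δ)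
  ... | N , h | M , k = N ℕ.⊔ M , λ m n a b → subst₂ _≤_
      (cong ∣_∣ (solve 4 (λ p q r s → (p :- q) :+ (r :- s) := (p :+ r) :- (q :+ s)) refl (x m) (x n) (y m) (y n)))
      (half-sum δ)
      (≤-trans (∣p+q∣≤∣p∣+∣q∣ (x m - x n) (y m - y n))
        (+-mono-≤ (h m n (⊔-≤ˡ N M a) (⊔-≤ˡ N M b)) (k m n (⊔-≤ʳ N M a) (⊔-≤ʳ N M b))))

  *-cauchy : ∀ {x y} → Cauchy x → Cauchy y → Cauchy (λ n → x n * y n)
  *-cauchy {x} {y} cx cy δ 0<δ = from (cauchy⇒bounded cx) (cauchy⇒bounded cy)
    where
    from : Bounded x → Bounded y → ∃ λ N → ∀ m n → N ℕ.≤ m → N ℕ.≤ n → ∣ x m * y m - x n * y n ∣ ≤ δ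
    from (N₁ , a , 0<a , ha) (N₂ , b , 0<b , hb) =
      choose (quotient 0<a (half-pos 0<δ)) (quotient 0<b (half-pos 0<δ))
      where
      choose : Σ[ κ ∈ ℚ ] (0ℚ < κ × a * κ ≡ ½ * δ) → Σ[ κ ∈ ℚ ] (0ℚ < κ × b * κ ≡ ½ * δ) → _
      choose (κ , 0<κ , aκ) (μ , 0<μ , bμ) with cx μ 0<μ | cy κ 0<κ
      ... | N₃ , h | N₄ , k = (N₁ ℕ.⊔ N₂) ℕ.⊔ (N₃ ℕ.⊔ N₄) , λ m n p q →
        let p₁ = ⊔-≤ˡ (N₁ ℕ.⊔ N₂) (N₃ ℕ.⊔ N₄) p; p₂ = ⊔-≤ʳ (N₁ ℕ.⊔ N₂) (N₃ ℕ.⊔ N₄) p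
            q₁ = ⊔-≤ˡ (N₁ ℕ.⊔ N₂) (N₃ ℕ.⊔ N₄) q; q₂ = ⊔-≤ʳ (N₁ ℕ.⊔ N₂) (N₃ ℕ.⊔ N₄) q
        in subst (∣ x m * y m - x n * y n ∣ ≤_) (trans (cong₂ _+_ aκ bμ) (half-sum δ))
          (*-diff (x m) (x n) (y m) (y n)
            (ha m (⊔-≤ˡ N₁ N₂ p₁)) (hb n (⊔-≤ʳ N₁ N₂ q₁))
            (h m n (⊔-≤ˡ N₃ N₄ p₂) (⊔-≤ˡ N₃ N₄ q₂)) (k m n (⊔-≤ʳ N₃ N₄ p₂) (⊔-≤ʳ N₃ N₄ q₂)))

  ⊔-mono-+ : ∀ c p q {κ} → 0ℚ ≤ κ → p ≤ q + κ → p ⊔ c ≤ (q ⊔ c) + κ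
  ⊔-mono-+ c p q {κ} 0≤κ h = ⊔-lub
    (≤-trans h (+-monoˡ-≤ κ (p≤p⊔q q c)))
    (≤-trans (p≤q⊔p q c) (subst (_≤ (q ⊔ c) + κ) (+-identityʳ (q ⊔ c)) (+-monoʳ-≤ (q ⊔ c) 0≤κ)))

  ⊔-close : ∀ c p q {κ} → ∣ p - q ∣ ≤ κ → ∣ (p ⊔ c) - (q ⊔ c) ∣ ≤ κ
  ⊔-close c p q {κ} h = abs-≤ (⊔-mono-+ c p q 0≤κ (abs-≤⁻ p q h))
    (⊔-mono-+ c q p 0≤κ (abs-≤⁻ q p (subst (_≤ κ) (∣p-q∣≡∣q-p∣ p q) h)))
    where
    0≤κ : 0ℚ ≤ κ
    0≤κ = ≤-trans (0≤∣p∣ (p - q)) h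

  ⊔-cauchy : ∀ c {x} → Cauchy x → Cauchy (λ n → x n ⊔ c)
  ⊔-cauchy c {x} cx δ 0<δ with cx δ 0<δ
  ... | N , h = N , λ m n a b → ⊔-close c (x m) (x n) (h m n a b)

  -- 1 / max(q, c), which is 1 / q as soon as q ≥ c > 0
  recip : ∀ c → 0ℚ < c → ℚ → ℚ
  recip c 0<c q = (1/ (q ⊔ c)) {{ℚ.>-nonZero (<-≤-trans 0<c (p≤q⊔p q c))}}

  recip-inverse : ∀ c (0<c : 0ℚ < c) q → (q ⊔ c) * recip c 0<c q ≡ 1ℚ
  recip-inverse c 0<c q = *-inverseʳ (q ⊔ c) {{ℚ.>-nonZero (<-≤-trans 0<c (p≤q⊔p q c))}}

  recip-pos : ∀ c (0<c : 0ℚ < c) q → 0ℚ < recip c 0<c q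
  recip-pos c 0<c q = positive⁻¹ _ {{1/pos⇒pos (q ⊔ c) {{positive (<-≤-trans 0<c (p≤q⊔p q c))}}}}

  -- u⁻¹ - v⁻¹ = u⁻¹ v⁻¹ (v - u)
  inverse-diff : ∀ u v r s {e κ} → u * r ≡ 1ℚ → v * s ≡ 1ℚ → 0ℚ ≤ r → 0ℚ ≤ s → r ≤ e → s ≤ e →
                 ∣ v - u ∣ ≤ κ → ∣ r - s ∣ ≤ (e * e) * κ
  inverse-diff u v r s {e} {κ} ur vs 0≤r 0≤s r≤e s≤e h = subst (_≤ (e * e) * κ)
    (trans (cong (_* ∣ v - u ∣) (sym (0≤p⇒∣p∣≡p (*-nonneg 0≤r 0≤s))))
      (trans (sym (∣p*q∣≡∣p∣*∣q∣ (r * s) (v - u))) (cong ∣_∣ eq)))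
    (*-mono (*-nonneg 0≤r 0≤s) (≤-trans (0≤∣p∣ (v - u)) h)
      (*-mono 0≤r (≤-trans 0≤s s≤e) r≤e s≤e) h)
    where
    eq : (r * s) * (v - u) ≡ r - s
    eq = trans (solve 4 (λ u v r s → (r :* s) :* (v :- u) := r :* (v :* s) :- s :* (u :* r)) refl u v r s)
      (cong₂ _-_ (trans (cong (r *_) vs) (*-identityʳ r)) (trans (cong (s *_) ur) (*-identityʳ s)))

  recip-cauchy : ∀ c (0<c : 0ℚ < c) {x} → Cauchy x → Cauchy (λ n → recip c 0<c (x n))
  recip-cauchy c 0<c {x} cx δ 0<δ = from (quotient 0<c 0<1)
    where
    from : Σ[ e ∈ ℚ ] (0ℚ < e × c * e ≡ 1ℚ) → ∃ λ N → ∀ m n → N ℕ.≤ m → N ℕ.≤ n →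
           ∣ recip c 0<c (x m) - recip c 0<c (x n) ∣ ≤ δ
    from (e , 0<e , ce) = choose (quotient (*-pos 0<e 0<e) 0<δ)
      where
      recip≤e : ∀ q → recip c 0<c q ≤ e
      recip≤e q = *-cancelˡ-≤-pos c {{positive 0<c}} (subst (c * recip c 0<c q ≤_) (trans (recip-inverse c 0<c q) (sym ce))
        (*-monoʳ-≤-nonNeg (recip c 0<c q) {{nonNegative (<⇒≤ (recip-pos c 0<c q))}} (p≤q⊔p q c)))
      choose : Σ[ κ ∈ ℚ ] (0ℚ < κ × (e * e) * κ ≡ δ) → _
      choose (κ , 0<κ , eκ) with cx κ 0<κ
      ... | N , h = N , λ m n a b → subst (∣ recip c 0<c (x m) - recip c 0<c (x n) ∣ ≤_) eκ
        (inverse-diff (x m ⊔ c) (x n ⊔ c) (recip c 0<c (x m)) (recip c 0<c (x n))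
          (recip-inverse c 0<c (x m)) (recip-inverse c 0<c (x n))
          (<⇒≤ (recip-pos c 0<c (x m))) (<⇒≤ (recip-pos c 0<c (x n))) (recip≤e (x m)) (recip≤e (x n))
          (⊔-close c (x n) (x m) (h n m b a)))

  euler-cauchy : ∀ {x} → Cauchy x → Cauchy (λ n → euler n (x n))
  euler-cauchy {x} cx δ 0<δ = from (cauchy⇒bounded cx)
    where
    from : Bounded x → ∃ λ N → ∀ m n → N ℕ.≤ m → N ℕ.≤ n → ∣ euler m (x m) - euler n (x n) ∣ ≤ δ
    from (N₁ , b , 0<b , hb) = choose
      (quotient 0<K (half-pos 0<δ)) (vanishes C 0≤C (half-pos (half-pos 0<δ)))
      where
      open Euler (<⇒≤ 0<b)
      choose : Σ[ κ ∈ ℚ ] (0ℚ < κ × K * κ ≡ ½ * δ) →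
               (∃ λ N → ∀ n → N ℕ.≤ n → C * ½ ^ n ≤ ½ * (½ * δ)) → _
      choose (κ , 0<κ , Kκ) (N₂ , small) with cx κ 0<κ
      ... | N₃ , h = M , λ m n p q →
        subst (∣ euler m (x m) - euler n (x n) ∣ ≤_) (eq δ)
          (triangle (euler m (x m)) (euler M (x m)) (euler n (x n))
            (near m p)
            (triangle (euler M (x m)) (euler M (x n)) (euler n (x n))
              (subst (∣ euler M (x m) - euler M (x n) ∣ ≤_) Kκ
                (lipschitz M N₀≤M (hb m (≤₁ p)) (hb n (≤₁ q)) (h m n (≤₃ p) (≤₃ q))))
              (subst (_≤ ½ * (½ * δ)) (∣p-q∣≡∣q-p∣ (euler n (x n)) (euler M (x n))) (near n q))))
        where
        M : ℕ
        M = (N₁ ℕ.⊔ N₂) ℕ.⊔ (N₃ ℕ.⊔ N₀)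
        ≤₁ : ∀ {n} → M ℕ.≤ n → N₁ ℕ.≤ n
        ≤₁ p = ⊔-≤ˡ N₁ N₂ (⊔-≤ˡ (N₁ ℕ.⊔ N₂) (N₃ ℕ.⊔ N₀) p)
        ≤₃ : ∀ {n} → M ℕ.≤ n → N₃ ℕ.≤ n
        ≤₃ p = ⊔-≤ˡ N₃ N₀ (⊔-≤ʳ (N₁ ℕ.⊔ N₂) (N₃ ℕ.⊔ N₀) p)
        N₂≤M : N₂ ℕ.≤ M
        N₂≤M = ⊔-≤ʳ N₁ N₂ (⊔-≤ˡ (N₁ ℕ.⊔ N₂) (N₃ ℕ.⊔ N₀) ℕP.≤-refl)
        N₀≤M : N₀ ℕ.≤ M
        N₀≤M = ⊔-≤ʳ N₃ N₀ (⊔-≤ʳ (N₁ ℕ.⊔ N₂) (N₃ ℕ.⊔ N₀) ℕP.≤-refl)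
        near : ∀ n → M ℕ.≤ n → ∣ euler n (x n) - euler M (x n) ∣ ≤ ½ * (½ * δ)
        near n p = ≤-trans (tail N₀≤M p (hb n (≤₁ p))) (small M N₂≤M)
        eq : ∀ δ → ½ * (½ * δ) + (½ * δ + ½ * (½ * δ)) ≡ δ
        eq = solve 1 (λ δ → con ½ :* (con ½ :* δ) :+ (con ½ :* δ :+ con ½ :* (con ½ :* δ)) := δ) refl

  rootStep : ℚ → ℚ → ℚ → ℚ
  rootStep q h s with (s + h) * (s + h) ≤? q
  ... | yes _ = s + h
  ... | no  _ = s

  -- Square root by binary digits: root n q ≤ √q ≤ root n q + (1 + q) / 2ⁿ for q ≥ 0.
  root : ℕ → ℚ → ℚ
  root zero    q = 0ℚ
  root (suc n) q = rootStep q ((1ℚ + q) * ½ ^ suc n) (root n q)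

  RootBounds : ℚ → ℚ → ℚ → Set
  RootBounds q h s = 0ℚ ≤ s × s * s ≤ q × q ≤ (s + h) * (s + h)

  rootStep-bounds : ∀ q h s → 0ℚ ≤ h → RootBounds q (h + h) s → RootBounds q h (rootStep q h s)
  rootStep-bounds q h s 0≤h (0≤s , lo , hi) with (s + h) * (s + h) ≤? q
  ... | yes p = +-nonneg 0≤s 0≤h , p ,
        subst (λ t → q ≤ t * t) (sym (+-assoc s h h)) hi
  ... | no ¬p = 0≤s , lo , <⇒≤ (≰⇒> ¬p)

  root-bounds : ∀ n q → 0ℚ ≤ q → RootBounds q ((1ℚ + q) * ½ ^ n) (root n q)
  root-bounds zero q 0≤q = ≤-refl , 0≤q , subst₂ _≤_ (+-identityʳ q)
    (solve 1 (λ q → q :+ (con 1ℚ :+ q :+ q :* q) := (con 0ℚ :+ (con 1ℚ :+ q) :* con 1ℚ) :* (con 0ℚ :+ (con 1ℚ :+ q) :* con 1ℚ)) refl q)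
    (+-monoʳ-≤ q (+-nonneg (+-nonneg 0≤1 0≤q) (*-nonneg 0≤q 0≤q)))
  root-bounds (suc n) q 0≤q = rootStep-bounds q ((1ℚ + q) * ½ ^ suc n) (root n q)
    (*-nonneg (+-nonneg 0≤1 0≤q) (^-nonneg (suc n) 0≤½))
    (subst (λ h → RootBounds q h (root n q))
      (solve 2 (λ p h → p :* h := p :* (con ½ :* h) :+ p :* (con ½ :* h)) refl (1ℚ + q) (½ ^ n))
      (root-bounds n q 0≤q))

  root-compare : ∀ {s s' q q' h η} → 0ℚ ≤ s' → 0ℚ ≤ h → 0ℚ ≤ η →
                 s * s ≤ q → q' ≤ (s' + h) * (s' + h) → q ≤ q' + η * η → s ≤ s' + (h + η)
  root-compare {s} {s'} {q} {q'} {h} {η} 0≤s' 0≤h 0≤η lo hi q≤ with s ≤? s' + (h + η)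
  ... | yes p = p
  ... | no ¬p = contradiction (<-≤-trans a²<s² s²≤a²) (<-irrefl refl)
    where
    a : ℚ
    a = s' + (h + η)
    0≤a : 0ℚ ≤ a
    0≤a = +-nonneg 0≤s' (+-nonneg 0≤h 0≤η)
    a<s : a < s
    a<s = ≰⇒> ¬p
    a²<s² : a * a < s * s
    a²<s² = ≤-<-trans (*-monoˡ-≤-nonNeg a {{nonNegative 0≤a}} (<⇒≤ a<s))
      (*-monoˡ-<-pos s {{positive (≤-<-trans 0≤a a<s)}} a<s)
    s²≤a² : s * s ≤ a * a
    s²≤a² = ≤-trans lo (≤-trans q≤ (≤-trans (+-monoˡ-≤ (η * η) hi)
      (subst₂ _≤_ (+-identityʳ _)
        (solve 3 (λ s h η → ((s :+ h) :* (s :+ h) :+ η :* η) :+ ((s :+ h) :* η :+ (s :+ h) :* η)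
                   := (s :+ (h :+ η)) :* (s :+ (h :+ η))) refl s' h η)
        (+-monoʳ-≤ ((s' + h) * (s' + h) + η * η) (+-nonneg 0≤shη 0≤shη)))))
      where
      0≤shη : 0ℚ ≤ (s' + h) * η
      0≤shη = *-nonneg (+-nonneg 0≤s' 0≤h) 0≤η

  root-cauchy : ∀ {x} → Cauchy x → (∀ n → 0ℚ ≤ x n) → Cauchy (λ n → root n (x n))
  root-cauchy {x} cx 0≤x δ 0<δ = from (cauchy⇒bounded cx)
    where
    η : ℚ
    η = ½ * δ
    0<η : 0ℚ < η
    0<η = half-pos 0<δ
    from : Bounded x → ∃ λ N → ∀ m n → N ℕ.≤ m → N ℕ.≤ n → ∣ root m (x m) - root n (x n) ∣ ≤ δ
    from (N₁ , b , 0<b , hb) = choose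
      (vanishes (1ℚ + b) (+-nonneg 0≤1 (<⇒≤ 0<b)) 0<η) (cx (η * η) (*-pos 0<η 0<η))
      where
      choose : (∃ λ N → ∀ n → N ℕ.≤ n → (1ℚ + b) * ½ ^ n ≤ η) →
               (∃ λ N → ∀ m n → N ℕ.≤ m → N ℕ.≤ n → ∣ x m - x n ∣ ≤ η * η) → _
      choose (N₂ , small) (N₃ , h) = M , λ m n p q → abs-≤ (half m n p q) (half n m q p)
        where
        M : ℕ
        M = (N₁ ℕ.⊔ N₂) ℕ.⊔ N₃
        half : ∀ m n → M ℕ.≤ m → M ℕ.≤ n → root m (x m) ≤ root n (x n) + δ
        half m n p q = ≤-trans
          (root-compare (proj₁ bn) 0≤w (<⇒≤ 0<η) (proj₁ (proj₂ bm)) (proj₂ (proj₂ bn))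
            (abs-≤⁻ (x m) (x n) (h m n (⊔-≤ʳ (N₁ ℕ.⊔ N₂) N₃ p) (⊔-≤ʳ (N₁ ℕ.⊔ N₂) N₃ q))))
          (+-monoʳ-≤ (root n (x n)) (subst (w + η ≤_) (half-sum δ) (+-monoˡ-≤ η w≤η)))
          where
          w : ℚ
          w = (1ℚ + x n) * ½ ^ n
          bm : RootBounds (x m) ((1ℚ + x m) * ½ ^ m) (root m (x m))
          bm = root-bounds m (x m) (0≤x m)
          bn : RootBounds (x n) w (root n (x n))
          bn = root-bounds n (x n) (0≤x n)
          0≤w : 0ℚ ≤ w
          0≤w = *-nonneg (+-nonneg 0≤1 (0≤x n)) (^-nonneg n 0≤½)
          w≤η : w ≤ η
          w≤η = ≤-trans
            (*-monoʳ-≤-nonNeg (½ ^ n) {{nonNegative (^-nonneg n 0≤½)}}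
              (+-monoʳ-≤ 1ℚ (≤-trans (p≤∣p∣ (x n)) (hb n (⊔-≤ˡ N₁ N₂ (⊔-≤ˡ (N₁ ℕ.⊔ N₂) N₃ q))))))
            (small n (⊔-≤ʳ N₁ N₂ (⊔-≤ˡ (N₁ ℕ.⊔ N₂) N₃ q)))

open RationalLemmas using
  ( Cauchy; fromℕ; const-cauchy; neg-cauchy; +-cauchy; *-cauchy; ⊔-cauchy
  ; recip; recip-cauchy; euler; euler-cauchy; root; root-cauchy )

-- Real numbers are Cauchy sequences of rationals, compared through the setoid equality _≈_.

record ℝ : Set where
  constructor mkℝ
  field
    seq    : ℕ → ℚ
    cauchy : Cauchy seq

open ℝ public

infix 4 _≈_ _≤_ _<_

_≈_ : Rel ℝ 0ℓ
x ≈ y = ∀ δ → 0ℚ ℚ.< δ → ∃[ N ] ∀ n → N ℕ.≤ n → ℚ.∣ seq x n ℚ.- seq y n ∣ ℚ.≤ δ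

_≤_ : Rel ℝ 0ℓ
x ≤ y = ∀ δ → 0ℚ ℚ.< δ → ∃[ N ] ∀ n → N ℕ.≤ n → seq x n ℚ.≤ seq y n ℚ.+ δ

_<_ : Rel ℝ 0ℓ
x < y = Σ[ δ ∈ ℚ ] (0ℚ ℚ.< δ × (∃[ N ] ∀ n → N ℕ.≤ n → seq x n ℚ.+ δ ℚ.≤ seq y n))

fromℚ : ℚ → ℝ
fromℚ q = mkℝ (λ _ → q) (const-cauchy q)

0ℝ 1ℝ : ℝ
0ℝ = fromℚ 0ℚ
1ℝ = fromℚ 1ℚ

infixl 6 _+_ _-_
infixl 7 _*_
infix  8 -_

_+_ : ℝ → ℝ → ℝ
x + y = mkℝ (λ n → seq x n ℚ.+ seq y n) (+-cauchy {seq x} {seq y} (cauchy x) (cauchy y))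

_*_ : ℝ → ℝ → ℝ
x * y = mkℝ (λ n → seq x n ℚ.* seq y n) (*-cauchy {seq x} {seq y} (cauchy x) (cauchy y))

-_ : ℝ → ℝ
- x = mkℝ (λ n → ℚ.- seq x n) (neg-cauchy {seq x} (cauchy x))

_-_ : ℝ → ℝ → ℝ
x - y = x + - y

ℝ-rawRing : RawRing 0ℓ 0ℓ
ℝ-rawRing = record { Carrier = ℝ; _≈_ = _≈_; _+_ = _+_; _*_ = _*_; -_ = -_; 0# = 0ℝ; 1# = 1ℝ }

open RawSemiringDefs (RawRing.rawSemiring ℝ-rawRing) public using (_^_; sum)

-- The witness δ of 0 < x bounds seq x from below eventually, and recip δ q is 1/q for q ≥ δ.
inv : (x : ℝ) → 0ℝ < x → ℝ
inv x (δ , 0<δ , _) = mkℝ (λ n → recip δ 0<δ (seq x n)) (recip-cauchy δ 0<δ {seq x} (cauchy x))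

-- √ x is the square root of max(x, 0).
√ : ℝ → ℝ
√ x = mkℝ (λ n → root n (seq x n ℚ.⊔ 0ℚ))
  (root-cauchy {λ n → seq x n ℚ.⊔ 0ℚ} (⊔-cauchy 0ℚ {seq x} (cauchy x)) (λ n → ℚP.p≤q⊔p (seq x n) 0ℚ))

-- exp x = lim (1 + x/N)ᴺ along N = 2ⁿ
exp : ℝ → ℝ
exp x = mkℝ (λ n → euler n (seq x n)) (euler-cauchy {seq x} (cauchy x))

-- l = ln x.  As a partial function ln is given by its graph.
IsLn : ℝ → ℝ → Set
IsLn x l = exp l ≈ x

-- y = xᵖ for x > 0 and real p
IsPower : ℝ → ℝ → ℝ → Set
IsPower x p y = ∃[ l ] (IsLn x l × y ≈ exp (p * l))

Point : ℕ → Set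
Point d = Vector ℝ d

infix 4 _≋_

_≋_ : ∀ {d} → Rel (Point d) 0ℓ
p ≋ q = ∀ i → p i ≈ q i

∥_∥ : ∀ {d} → Point d → ℝ
∥ p ∥ = √ (sum (λ i → p i ^ 2))

dist : ∀ {d} → Point d → Point d → ℝ
dist p q = ∥ (λ i → p i - q i) ∥

-- Closed ball about the origin
Ball : ∀ {d} → ℝ → Pred (Point d) 0ℓ
Ball T p = ∥ p ∥ ≤ T

-- Segment with end points a and b; its length is dist a b.
Segment : ∀ {d} → Point d → Point d → Pred (Point d) 0ℓ
Segment a b p = ∃[ t ] (0ℝ ≤ t × t ≤ 1ℝ × p ≋ (λ i → (1ℝ - t) * a i + t * b i))

-- dist(x, L) ≤ ε, where dist(x, L) is the infimum of dist x y over y ∈ L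
DistanceTo_From_AtMost_ : ∀ {d} → Pred (Point d) 0ℓ → Point d → ℝ → Set
DistanceTo L From x AtMost ε = ∀ δ → 0ℝ < δ → ∃[ y ] (y ∈ L × dist x y < ε + δ)

-- #A ≤ c: any k pairwise distinct points of A satisfy k ≤ c.
CardinalityAtMost : ∀ {d} → Pred (Point d) 0ℓ → ℝ → Set
CardinalityAtMost {d} A c = ∀ k (p : Fin k → Point d) →
  Injective _≡_ _≋_ p → (∀ i → p i ∈ A) → fromℚ (fromℕ k) ≤ c

FiniteDensity : ∀ {d} → Pred (Point d) 0ℓ → Set
FiniteDensity {d} Y = ∃[ C ] (0ℝ < C ×
  (∀ T → 0ℝ < T → CardinalityAtMost (Ball T ∩ Y) (C * T ^ d)))

-- The open interval (0,1)
𝕀 : Set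
𝕀 = Σ[ ε ∈ ℝ ] (0ℝ < ε × ε < 1ℝ)

PositiveValued : (𝕀 → ℝ) → Set
PositiveValued W = ∀ ε → 0ℝ < W ε

Decreasing : (𝕀 → ℝ) → Set
Decreasing W = ∀ ε ε′ → proj₁ ε ≤ proj₁ ε′ → W ε′ ≤ W ε

TendsTo+∞At0⁺ : (𝕀 → ℝ) → Set
TendsTo+∞At0⁺ W = ∀ M → ∃[ δ ] (0ℝ < δ × (∀ ε → proj₁ ε < δ → M < W ε))

Visible : ∀ {d} → Pred (Point d) 0ℓ → (𝕀 → ℝ) → Set
Visible {d} F W = ∀ ε (a b : Point d) → dist a b ≈ W ε →
  ∃[ x ] (x ∈ F × DistanceTo Segment a b From x AtMost proj₁ ε)

-- F is a subset of ℝᵈ, where points are identified up to _≋_, so it must respect _≋_.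
IsDenseForest : ∀ {d} → Pred (Point d) 0ℓ → (𝕀 → ℝ) → Set
IsDenseForest F W = F Respects _≋_ × FiniteDensity F
  × PositiveValued W × Decreasing W × TendsTo+∞At0⁺ W × Visible F W

-- r = ε^{-(d-1)} · ln(1/ε) · (ln ln(1/ε))^{1+η}
IsRate : ℕ → ℝ → 𝕀 → ℝ → Set
IsRate d η (ε , 0<ε , _) r =
  ∃[ l ] ∃[ m ] ∃[ y ] ( IsLn (inv ε 0<ε) l × IsLn l m × IsPower m (1ℝ + η) y
                       × r ≈ inv ε 0<ε ^ (d ℕ.∸ 1) * l * y )

-- The bound includes that the rate is defined at every ε ∈ (0, ε₀]; its value is unique.
IsBigORate : ℕ → ℝ → (𝕀 → ℝ) → Set
IsBigORate d η W = ∃[ C ] ∃[ ε₀ ] (0ℝ < C × 0ℝ < ε₀ × ε₀ < exp (- 1ℝ) ×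
  (∀ ε → proj₁ ε ≤ ε₀ → ∃[ r ] (IsRate d η ε r × W ε ≤ C * r)))

{-# OPTIONS --safe #-}
module Submission where

-- Put shifted copies θ n + ℤ^(d-1) of the integer lattice into the parallel hyperplanes
-- x_i = (2n + 1) G.  A segment that is long in direction i meets consecutive hyperplanes in an
-- arithmetic progression, so it is seen as soon as θ comes ε-close modulo 1 to that progression.
-- A random θ does so within N = C ε^(-(d-1)) ln(1/ε) steps with failure probability a large power
-- of ε, while up to precision there are only polynomially many progressions; hence one periodic
-- sequence θ, found by derandomisation, serves all scales ε = 4^(-j) with j ≤ 4^(k+1) at once.
-- Block k uses such a sequence, with hyperplanes 2G ≈ k (ln k)² apart.  Grouping the blocks with
-- 4^s ≤ k < 4^(s+1), G = 4^s (s+1)(s+2), gives finite density.  As k is about ln ln(1/ε), the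
-- visibility N G is ε^(-(d-1)) ln(1/ε) k s², and s² = O(k^η).

-- Within block k a single exponent B = 4^(k + c) governs all scales. A window at scale j fails with
-- probability at most 2^(-B), and the tests of the block number only 2^(O(4^k)), since period and
-- denominator are powers of 4 with exponents O(4^k). A scale j is served by the block with 4^k ≤ j
-- < 4^(k+1), so B is O(j), and this is the one factor ln(1/ε). Probabilities appear as counts of
-- letters, which keeps the combinatorics in ℕ. Comparison of reals is undecidable here, and this
-- shapes the analytic half. The visibility cannot be a step function of the scale, so it is a
-- constant times the rate itself, taken at max(1/ε, 4^5); the scale is read off a rational
-- approximation, and the estimates leave room for that error. The logarithm is needed as a function
-- and is obtained by inverting the Euler powers digit by digit. The number 4 stands in for e: from
-- exp j ≤ 4^j follows ln(4^j) ≥ j, with rational data throughout.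

-- Finite sums, conditional expectations and the union bound

module UnionBound where

  open import Data.Bool.Base using (Bool; true; false; if_then_else_)
  open import Data.Nat.Base
  open import Data.Nat.Properties
  open import Data.Nat.Solver using (module +-*-Solver)
  open +-*-Solver using (solve; _:+_; _:*_; _:=_)
  open import Data.List.Base using (List; []; _∷_; map; length)
  open import Data.Nat.ListAction using (sum)
  open import Data.List.Membership.Propositional using (_∈_)
  open import Data.List.Relation.Unary.Any using (here; there)
  open import Data.Product using (∃-syntax; Σ-syntax; _×_; _,_)
  open import Relation.Nullary using (yes; no; contradiction)
  open import Relation.Binary.PropositionalEquality

  ∑ : {A : Set} → List A → (A → ℕ) → ℕ
  ∑ xs f = sum (map f xs)

  module _ {A : Set} where

    ∑-cong : ∀ (xs : List A) {f g : A → ℕ} → (∀ x → f x ≡ g x) → ∑ xs f ≡ ∑ xs g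
    ∑-cong []       h = refl
    ∑-cong (x ∷ xs) h = cong₂ _+_ (h x) (∑-cong xs h)

    ∑-mono : ∀ (xs : List A) {f g : A → ℕ} → (∀ x → f x ≤ g x) → ∑ xs f ≤ ∑ xs g
    ∑-mono []       h = z≤n
    ∑-mono (x ∷ xs) h = +-mono-≤ (h x) (∑-mono xs h)

    ∑-const : ∀ (xs : List A) c → ∑ xs (λ _ → c) ≡ length xs * c
    ∑-const []       c = refl
    ∑-const (x ∷ xs) c = cong (c +_) (∑-const xs c)

    ∑-+ : ∀ (xs : List A) (f g : A → ℕ) → ∑ xs (λ x → f x + g x) ≡ ∑ xs f + ∑ xs g
    ∑-+ []       f g = refl
    ∑-+ (x ∷ xs) f g = trans (cong (f x + g x +_) (∑-+ xs f g))
      (solve 4 (λ a b c d → (a :+ b) :+ (c :+ d) := (a :+ c) :+ (b :+ d)) refl (f x) (g x) (∑ xs f) (∑ xs g))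

    ∑-*ʳ : ∀ (xs : List A) (f : A → ℕ) c → ∑ xs (λ x → f x * c) ≡ ∑ xs f * c
    ∑-*ʳ []       f c = refl
    ∑-*ʳ (x ∷ xs) f c = trans (cong (f x * c +_) (∑-*ʳ xs f c)) (sym (*-distribʳ-+ c (f x) (∑ xs f)))

    ∑-*ˡ : ∀ (xs : List A) (f : A → ℕ) c → ∑ xs (λ x → c * f x) ≡ c * ∑ xs f
    ∑-*ˡ xs f c = trans (∑-cong xs (λ x → *-comm c (f x))) (trans (∑-*ʳ xs f c) (*-comm (∑ xs f) c))

    averaging : ∀ (xs : List A) (f : A → ℕ) b → ∑ xs f < length xs * b → ∃[ x ] f x < b
    averaging (x ∷ xs) f b h with f x <? b
    ... | yes p = x , p
    ... | no ¬p = averaging xs f b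
      (+-cancelˡ-< b _ _ (≤-<-trans (+-monoˡ-≤ (∑ xs f) (≮⇒≥ ¬p)) h))

    ∑-zero : ∀ (xs : List A) (f : A → ℕ) → ∑ xs f < 1 → ∀ {x} → x ∈ xs → f x ≡ 0
    ∑-zero xs f h x∈ = n<1⇒n≡0 (≤-<-trans (term xs x∈) h)
      where
      term : ∀ (xs : List A) {x} → x ∈ xs → f x ≤ ∑ xs f
      term (x ∷ xs) (here refl) = m≤m+n (f x) (∑ xs f)
      term (x ∷ xs) (there p)   = ≤-trans (term xs p) (m≤n+m (∑ xs f) (f x))

  ∑-swap : ∀ {A B : Set} (xs : List A) (ys : List B) (f : A → B → ℕ) →
           ∑ xs (λ x → ∑ ys (f x)) ≡ ∑ ys (λ y → ∑ xs (λ x → f x y))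
  ∑-swap []       ys f = sym (trans (∑-const ys 0) (*-zeroʳ (length ys)))
  ∑-swap (x ∷ xs) ys f = trans (cong (∑ ys (f x) +_) (∑-swap xs ys f))
    (sym (∑-+ ys (f x) (λ y → ∑ xs (λ x → f x y))))

  prod : ℕ → (ℕ → ℕ) → ℕ
  prod zero    f = 1
  prod (suc n) f = f 0 * prod n (λ i → f (suc i))

  prod-+ : ∀ m n f → prod (m + n) f ≡ prod m f * prod n (λ i → f (m + i))
  prod-+ zero    n f = sym (+-identityʳ (prod n f))
  prod-+ (suc m) n f = trans (cong (f 0 *_) (prod-+ m n (λ i → f (suc i))))
    (sym (*-assoc (f 0) (prod m (λ i → f (suc i))) (prod n (λ i → f (suc m + i)))))

  prod-≤ : ∀ n f c → (∀ i → i < n → f i ≤ c) → prod n f ≤ c ^ n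
  prod-≤ zero    f c h = ≤-refl
  prod-≤ (suc n) f c h = *-mono-≤ (h 0 z<s) (prod-≤ n (λ i → f (suc i)) c (λ i i<n → h (suc i) (s<s i<n)))

  -- A test is a requirement on the sequence of letters θ 0, θ 1, … that is met as soon as one
  -- letter hits it.
  Test : Set → Set
  Test Ω = ℕ → Ω → Bool

  module _ {Ω : Set} (ω₀ : Ω) (Ωs : List Ω) where

    missed : ℕ → Bool → ℕ
    missed u b = if b then 0 else u

    misses : Test Ω → ℕ → ℕ
    misses τ i = ∑ Ωs (λ ω → missed 1 (τ i ω))

    missed-* : ∀ u b → missed u b ≡ missed 1 b * u
    missed-* u true  = refl
    missed-* u false = sym (+-identityʳ u)

    -- Method of conditional expectations: u τ is the weight of τ as long as τ has not been hit.
    derandomise : ∀ {T : Set} (ts : List T) (hit : T → Test Ω) (u : T → ℕ) n →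
      ∑ ts (λ τ → u τ * prod n (misses (hit τ))) < length Ωs ^ n →
      Σ[ θ ∈ (ℕ → Ω) ] (∀ τ → τ ∈ ts → u τ ≢ 0 → ∃[ i ] (i < n × hit τ i (θ i) ≡ true))
    -- No letters remain, so the total weight is below 1 and every weight is 0: no test is left
    -- unmet.
    derandomise ts hit u zero h = (λ _ → ω₀) , λ τ τ∈ u≢0 →
      contradiction (trans (sym (*-identityʳ (u τ))) (∑-zero ts (λ τ → u τ * 1) h τ∈)) u≢0
    derandomise {T} ts hit u (suc n) h = step (averaging Ωs total (length Ωs ^ n) (subst (_< length Ωs ^ suc n) eq h))
      where
      hit′ : T → Test Ω
      hit′ τ i = hit τ (suc i)
      rest : T → ℕ
      rest τ = prod n (misses (hit′ τ))
      u′ : Ω → T → ℕ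
      u′ ω τ = missed (u τ) (hit τ 0 ω)
      total : Ω → ℕ
      total ω = ∑ ts (λ τ → u′ ω τ * rest τ)
      eq : ∑ ts (λ τ → u τ * prod (suc n) (misses (hit τ))) ≡ ∑ Ωs total
      eq = trans (∑-cong ts (λ τ → sym (trans
             (∑-cong Ωs (λ ω → trans (cong (_* rest τ) (missed-* (u τ) (hit τ 0 ω)))
               (*-assoc (missed 1 (hit τ 0 ω)) (u τ) (rest τ))))
             (trans (∑-*ʳ Ωs (λ ω → missed 1 (hit τ 0 ω)) (u τ * rest τ))
               (solve 3 (λ a b c → a :* (b :* c) := b :* (a :* c)) refl (misses (hit τ) 0) (u τ) (rest τ))))))
           (∑-swap ts Ωs (λ τ ω → u′ ω τ * rest τ))
      step : (∃[ ω ] total ω < length Ωs ^ n) → _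
      step (ω , h′) with derandomise ts hit′ (u′ ω) n h′
      ... | θ , good = θ′ , met
        where
        θ′ : ℕ → Ω
        θ′ zero    = ω
        θ′ (suc i) = θ i
        met : ∀ τ → τ ∈ ts → u τ ≢ 0 → ∃[ i ] (i < suc n × hit τ i (θ′ i) ≡ true)
        met τ τ∈ u≢0 with hit τ 0 ω in e
        ... | true  = 0 , z<s , e
        ... | false with good τ τ∈ (λ z → u≢0 (trans (sym (cong (missed (u τ)) e)) z))
        ...   | i , i<n , hits = suc i , s<s i<n , hits

    -- With unit weights the expected number of missed tests is below b * (1/b) = 1. The factor
    -- `length Ωs ^ n` clears the denominators of the probabilities.
    unionBound : ∀ {T : Set} (ts : List T) (hit : T → Test Ω) n b → length ts < b →
      (∀ τ → b * prod n (misses (hit τ)) ≤ length Ωs ^ n) →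
      0 < length Ωs →
      Σ[ θ ∈ (ℕ → Ω) ] (∀ τ → τ ∈ ts → ∃[ i ] (i < n × hit τ i (θ i) ≡ true))
    unionBound ts hit n b few small 0<R with derandomise ts hit (λ _ → 1) n
      (*-cancelˡ-< b _ _ (≤-<-trans
        (≤-trans (≤-reflexive (trans (sym (∑-*ˡ ts (λ τ → 1 * prod n (misses (hit τ))) b))
            (∑-cong ts (λ τ → cong (b *_) (+-identityʳ _)))))
          (≤-trans (∑-mono ts small) (≤-reflexive (∑-const ts (length Ωs ^ n)))))
        (*-monoˡ-< (length Ωs ^ n) {{>-nonZero (m^n>0 (length Ωs) {{>-nonZero 0<R}} n)}} few)))
    ... | θ , good = θ , λ τ τ∈ → good τ τ∈ λ ()

-- Counting points of cubes in the discrete torus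

module Cubes where

  open import Data.Bool.Base using (Bool; true; false; T; if_then_else_; _∧_)
  open import Data.Bool.Properties using (T-∧; T-≡)
  open import Data.Nat.Base
  open import Data.Nat.Properties
  open import Data.Nat.DivMod
  open import Data.Nat.Solver using (module +-*-Solver)
  open +-*-Solver using (solve; _:+_; _:*_; _:=_; con)
  open import Data.Fin.Base using (Fin; toℕ; zero; suc)
  open import Data.List.Base using (List; []; _∷_; map; length; _++_; cartesianProductWith; tabulate; allFin)
  open import Data.List.Properties using (length-tabulate; length-++; length-map)
  open import Data.List.Membership.Propositional using (_∈_)
  open import Data.List.Membership.Propositional.Properties using (∈-cartesianProductWith⁺)
  open import Data.List.Relation.Unary.Any using (here)
  open import Data.Vec.Base using (Vec; []; _∷_; lookup)
  open import Data.Product using (_,_)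
  open import Function.Base using (_∘_; id)
  open import Function.Bundles using (Equivalence)
  open import Relation.Nullary using (contradiction)
  open import Relation.Binary.PropositionalEquality
  open UnionBound

  vecs : {A : Set} → List A → ∀ e → List (Vec A e)
  vecs xs zero    = [] ∷ []
  vecs xs (suc e) = cartesianProductWith _∷_ xs (vecs xs e)

  length-cartesianProductWith : {A B C : Set} (h : A → B → C) (xs : List A) (ys : List B) →
    length (cartesianProductWith h xs ys) ≡ length xs * length ys
  length-cartesianProductWith h []       ys = refl
  length-cartesianProductWith h (x ∷ xs) ys = trans (length-++ (map (h x) ys))
    (cong₂ _+_ (length-map (h x) ys) (length-cartesianProductWith h xs ys))

  length-vecs : {A : Set} (xs : List A) → ∀ e → length (vecs xs e) ≡ length xs ^ e
  length-vecs xs zero    = refl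
  length-vecs xs (suc e) = trans (length-cartesianProductWith _∷_ xs (vecs xs e)) (cong (length xs *_) (length-vecs xs e))

  ∈-vecs : {A : Set} (xs : List A) → ∀ {e} (v : Vec A e) → (∀ l → lookup v l ∈ xs) → v ∈ vecs xs e
  ∈-vecs xs []      h = here refl
  ∈-vecs xs (a ∷ v) h = ∈-cartesianProductWith⁺ _∷_ (h zero) (∈-vecs xs v (h ∘ suc))

  ∑-++ : {A : Set} (xs ys : List A) (f : A → ℕ) → ∑ (xs ++ ys) f ≡ ∑ xs f + ∑ ys f
  ∑-++ []       ys f = refl
  ∑-++ (x ∷ xs) ys f = trans (cong (f x +_) (∑-++ xs ys f)) (sym (+-assoc (f x) (∑ xs f) (∑ ys f)))

  ∑-map : {A B : Set} (h : A → B) (xs : List A) (f : B → ℕ) → ∑ (map h xs) f ≡ ∑ xs (f ∘ h)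
  ∑-map h []       f = refl
  ∑-map h (x ∷ xs) f = cong (f (h x) +_) (∑-map h xs f)

  ∑-cartesianProductWith : {A B C : Set} (h : A → B → C) (xs : List A) (ys : List B) (f : C → ℕ) →
    ∑ (cartesianProductWith h xs ys) f ≡ ∑ xs (λ x → ∑ ys (λ y → f (h x y)))
  ∑-cartesianProductWith h []       ys f = refl
  ∑-cartesianProductWith h (x ∷ xs) ys f = trans (∑-++ (map (h x) ys) (cartesianProductWith h xs ys) f)
    (cong₂ _+_ (∑-map (h x) ys f) (∑-cartesianProductWith h xs ys f))

  below : ℕ → (ℕ → ℕ) → ℕ
  below zero    f = 0
  below (suc n) f = f 0 + below n (f ∘ suc)

  below-cong : ∀ n {f g} → (∀ i → i < n → f i ≡ g i) → below n f ≡ below n g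
  below-cong zero    h = refl
  below-cong (suc n) h = cong₂ _+_ (h 0 z<s) (below-cong n (λ i i<n → h (suc i) (s<s i<n)))

  below-const : ∀ n c → below n (λ _ → c) ≡ n * c
  below-const zero    c = refl
  below-const (suc n) c = cong (c +_) (below-const n c)

  below-+ : ∀ m n f → below (m + n) f ≡ below m f + below n (f ∘ (m +_))
  below-+ zero    n f = refl
  below-+ (suc m) n f = trans (cong (f 0 +_) (below-+ m n (f ∘ suc))) (sym (+-assoc (f 0) _ _))

  below-shift : ∀ n f → f 0 + below n (f ∘ suc) ≡ below n f + f n
  below-shift zero    f = +-comm (f 0) 0
  below-shift (suc n) f = trans (cong (f 0 +_) (below-shift n (f ∘ suc))) (sym (+-assoc (f 0) _ _))

  -- Moving the start of the range by one drops `f s` and gains `f (n + s)`, which periodicity makes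
  -- equal.
  below-periodic : ∀ n f → (∀ i → f (i + n) ≡ f i) → ∀ s → below n (λ i → f (i + s)) ≡ below n f
  below-periodic n f h zero    = below-cong n (λ i _ → cong f (+-identityʳ i))
  below-periodic n f h (suc s) = trans (below-cong n (λ i _ → cong f (+-suc i s)))
    (trans (+-cancelˡ-≡ (f s) _ _ (trans (below-shift n (λ i → f (i + s)))
        (trans (+-comm (below n (λ i → f (i + s))) (f (n + s)))
          (cong (_+ below n (λ i → f (i + s))) (trans (cong f (+-comm n s)) (h s))))))
      (below-periodic n f h s))

  ∑-tabulate : ∀ {A : Set} n (h : Fin n → A) (g : A → ℕ) (f : ℕ → ℕ) → (∀ i → g (h i) ≡ f (toℕ i)) →
               ∑ (tabulate h) g ≡ below n f
  ∑-tabulate zero    h g f eq = refl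
  ∑-tabulate (suc n) h g f eq = cong₂ _+_ (eq zero) (∑-tabulate n (h ∘ suc) g (f ∘ suc) (eq ∘ suc))

  indicator : Bool → ℕ
  indicator b = if b then 1 else 0

  indicator-∧ : ∀ a b → indicator (a ∧ b) ≡ indicator b * indicator a
  indicator-∧ true  b = sym (*-identityʳ (indicator b))
  indicator-∧ false b = sym (*-zeroʳ (indicator b))

  module _ (Q M : ℕ) .{{_ : NonZero Q}} where

    inArc : ℕ → Bool
    inArc i = i % Q <ᵇ M

    -- Membership in the cube of side `M` with corner -s in the torus of residues modulo `Q`; it may
    -- wrap around.
    inCube : ∀ {e} → (Fin e → ℕ) → Vec (Fin Q) e → Bool
    inCube s []      = true
    inCube s (a ∷ v) = inArc (toℕ a + s zero) ∧ inCube (s ∘ suc) v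

    inCube⁻ : ∀ {e} (s : Fin e → ℕ) (v : Vec (Fin Q) e) → T (inCube s v) → ∀ l → (toℕ (lookup v l) + s l) % Q < M
    inCube⁻ s (a ∷ v) h l with Equivalence.to (T-∧ {inArc (toℕ a + s zero)} {inCube (s ∘ suc) v}) h
    inCube⁻ s (a ∷ v) h zero    | p , _ = <ᵇ⇒< _ _ p
    inCube⁻ s (a ∷ v) h (suc l) | _ , q = inCube⁻ (s ∘ suc) v q l

    arc-size : M ≤ Q → ∀ s → ∑ (allFin Q) (λ a → indicator (inArc (toℕ a + s))) ≡ M
    arc-size M≤Q s = trans (∑-tabulate Q id _ (λ i → indicator (inArc (i + s))) (λ _ → refl))
      (trans (below-periodic Q (indicator ∘ inArc) (λ i → cong (λ r → indicator (r <ᵇ M)) ([m+n]%n≡m%n i Q)) s)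
      (trans (cong (λ n → below n (indicator ∘ inArc)) (sym (m+[n∸m]≡n M≤Q)))
      (trans (below-+ M (Q ∸ M) (indicator ∘ inArc))
      (trans (cong₂ _+_
        (trans (below-cong M inside) (trans (below-const M 1) (*-identityʳ M)))
        (trans (below-cong (Q ∸ M) outside) (trans (below-const (Q ∸ M) 0) (*-zeroʳ (Q ∸ M)))))
        (+-identityʳ M)))))
      where
      inside : ∀ i → i < M → indicator (inArc i) ≡ 1
      inside i i<M = cong indicator (Equivalence.to T-≡ (<⇒<ᵇ (subst (_< M) (sym (m<n⇒m%n≡m (<-≤-trans i<M M≤Q))) i<M)))
      outside : ∀ i → i < Q ∸ M → indicator (inArc (M + i)) ≡ 0
      outside i i<r with inArc (M + i) in eq
      ... | false = refl
      ... | true  = contradiction (subst (_< M) (m<n⇒m%n≡m (subst (M + i <_) (m+[n∸m]≡n M≤Q) (+-monoʳ-< M i<r)))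
                      (<ᵇ⇒< _ _ (Equivalence.from T-≡ eq))) (≤⇒≯ (m≤m+n M i))

    cube-size : M ≤ Q → ∀ e (s : Fin e → ℕ) → ∑ (vecs (allFin Q) e) (indicator ∘ inCube s) ≡ M ^ e
    cube-size M≤Q zero    s = refl
    cube-size M≤Q (suc e) s =
      trans (∑-cartesianProductWith _∷_ (allFin Q) (vecs (allFin Q) e) (indicator ∘ inCube s))
      (trans (∑-cong (allFin Q) (λ a → trans
          (∑-cong (vecs (allFin Q) e) (λ v → indicator-∧ (inArc (toℕ a + s zero)) (inCube (s ∘ suc) v)))
          (trans (∑-*ʳ (vecs (allFin Q) e) (indicator ∘ inCube (s ∘ suc)) (indicator (inArc (toℕ a + s zero))))
            (trans (cong (_* indicator (inArc (toℕ a + s zero))) (cube-size M≤Q e (s ∘ suc))) (*-comm (M ^ e) _)))))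
      (trans (∑-*ʳ (allFin Q) (λ a → indicator (inArc (toℕ a + s zero))) (M ^ e))
        (cong (_* M ^ e) (arc-size M≤Q (s zero)))))

    -- Stated as a sum rather than as a difference, so that no truncated subtraction enters; every
    -- letter is counted once, as a miss or as a hit.
    cube-misses : M ≤ Q → ∀ e (s : Fin e → ℕ) → ∑ (vecs (allFin Q) e) (λ v → if inCube s v then 0 else 1) + M ^ e ≡ Q ^ e
    cube-misses M≤Q e s = trans (cong (∑ (vecs (allFin Q) e) (λ v → if inCube s v then 0 else 1) +_) (sym (cube-size M≤Q e s)))
      (trans (sym (∑-+ (vecs (allFin Q) e) _ _))
      (trans (∑-cong (vecs (allFin Q) e) (λ v → one (inCube s v)))
      (trans (∑-const (vecs (allFin Q) e) 1)
      (trans (*-identityʳ _)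
      (trans (length-vecs (allFin Q) e) (cong (_^ e) (length-tabulate {n = Q} id)))))))
      where
      one : ∀ b → (if b then 0 else 1) + indicator b ≡ 1
      one true  = refl
      one false = refl

  ^-distribʳ-* : ∀ n a b → (a * b) ^ n ≡ a ^ n * b ^ n
  ^-distribʳ-* zero    a b = refl
  ^-distribʳ-* (suc n) a b = trans (cong (a * b *_) (^-distribʳ-* n a b))
    (solve 4 (λ a b p q → a :* b :* (p :* q) := a :* p :* (b :* q)) refl a b (a ^ n) (b ^ n))

  -- These are the first two terms of the binomial expansion of the right side.
  binomial : ∀ y n → y ^ suc n + suc n * y ^ n ≤ suc y ^ suc n
  binomial y zero    = ≤-reflexive (solve 1 (λ y → y :* con 1 :+ con 1 :* con 1 := (con 1 :+ y) :* con 1) refl y)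
  binomial y (suc n) = ≤-trans (≤-trans (m≤m+n _ (suc n * y ^ n))
    (≤-reflexive (solve 3 (λ y n p → y :* (y :* p) :+ (con 2 :+ n) :* (y :* p) :+ (con 1 :+ n) :* p
       := (con 1 :+ y) :* (y :* p :+ (con 1 :+ n) :* p)) refl y n (y ^ n))))
    (*-monoʳ-≤ (suc y) (binomial y n))

  doubling : ∀ y → 2 * y ^ suc y ≤ suc y ^ suc y
  doubling y = ≤-trans (≤-trans (m≤m+n (2 * y ^ suc y) (y ^ y)) (≤-reflexive
    (solve 2 (λ y p → con 2 :* (y :* p) :+ p := y :* p :+ (con 1 :+ y) :* p) refl y (y ^ y)))) (binomial y y)

  -- (1 - 1/x)^x ≤ 1/2, raised to the power B and cleared of denominators.
  decay : ∀ x B → 0 < x → 2 ^ B * (x ∸ 1) ^ (x * B) ≤ x ^ (x * B)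
  decay (suc y) B _ = subst₂ _≤_
    (trans (^-distribʳ-* B 2 (y ^ suc y)) (cong (2 ^ B *_) (^-*-assoc y (suc y) B)))
    (^-*-assoc (suc y) (suc y) B) (^-monoˡ-≤ B (doubling y))

-- One periodic sequence that serves all scales of a block

module Block where

  open import Data.Bool.Base using (Bool; true; false; if_then_else_; _∧_)
  open import Data.Bool.Properties using (T-∧; T-≡)
  open import Data.Nat.Base
  open import Data.Nat.Properties
  open import Data.Nat.DivMod
  open import Data.Nat.Solver using (module +-*-Solver)
  open +-*-Solver using (solve; _:+_; _:*_; _:=_; con)
  open import Data.Fin.Base using (Fin; toℕ; zero; suc; fromℕ<)
  open import Data.Fin.Properties using (toℕ-fromℕ<; toℕ<n)
  open import Data.List.Base using (List; length; cartesianProductWith; allFin; upTo)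
  open import Data.List.Properties using (length-tabulate; length-upTo)
  open import Data.List.Membership.Propositional using (_∈_)
  open import Data.List.Membership.Propositional.Properties using (∈-cartesianProductWith⁺; ∈-allFin; ∈-upTo⁺)
  open import Data.Vec.Base using (Vec; lookup; replicate)
  open import Data.Product using (∃-syntax; _×_; _,_; map₂)
  open import Function.Base using (id)
  open import Function.Bundles using (Equivalence)
  open import Relation.Binary.PropositionalEquality hiding (J)
  open UnionBound
  open Cubes

  abstract

    -- Sealed, so that numerals such as `4^ 5` never unfold; the exponent laws below are what later
    -- arguments use.
    4^ : ℕ → ℕ
    4^ n = 4 ^ n

    4^≡ : ∀ n → 4^ n ≡ 4 ^ n
    4^≡ n = refl

  instance
    4^-nonZero : ∀ {n} → NonZero (4^ n)
    4^-nonZero {n} = subst NonZero (sym (4^≡ n)) (m^n≢0 4 n)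

  4^-+ : ∀ m n → 4^ (m + n) ≡ 4^ m * 4^ n
  4^-+ m n rewrite 4^≡ m | 4^≡ n | 4^≡ (m + n) = ^-distribˡ-+-* 4 m n

  4^-^ : ∀ m n → 4^ m ^ n ≡ 4^ (m * n)
  4^-^ m n rewrite 4^≡ m | 4^≡ (m * n) = ^-*-assoc 4 m n

  4^-mono : ∀ {m n} → m ≤ n → 4^ m ≤ 4^ n
  4^-mono {m} {n} h rewrite 4^≡ m | 4^≡ n = ^-monoʳ-≤ 4 h

  4^-suc : ∀ n → 4^ (suc n) ≡ 4 * 4^ n
  4^-suc n rewrite 4^≡ (suc n) | 4^≡ n = refl

  0<4^ : ∀ n → 0 < 4^ n
  0<4^ n = >-nonZero⁻¹ (4^ n)

  n<4^n : ∀ n → n < 4^ n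
  n<4^n zero    = 0<4^ 0
  n<4^n (suc n) = subst (suc n <_) (sym (4^-suc n)) (≤-trans (+-mono-≤ (0<4^ n) (n<4^n n))
    (≤-trans (≤-reflexive (cong (4^ n +_) (sym (+-identityʳ (4^ n))))) (*-monoˡ-≤ (4^ n) {2} {4} (s≤s (s≤s z≤n)))))

  module Parameters (e c₂ b J : ℕ) where

    B : ℕ
    B = 4^ b

    -- A cube of side 4^(-(j + c₂)) fills a proportion 1 / 4^(cells j) of the unit cube.
    cells : ℕ → ℕ
    cells j = (j + c₂) * e

    -- Among `4^ (cells j)` random letters all miss a given cube with probability at most 1/2. A
    -- window consists of `B` such runs, so it fails with probability at most 2^(-B).
    N : ℕ → ℕ
    N j = 4^ (cells j + b)

    -- `P` is the period, a common multiple of the window lengths. `Q` carries `P` as a factor so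
    -- that `M j` is at least `N j`: a slope rounded to a multiple of 1/`Q` then drifts, over a
    -- whole window, by at most the side `M j` / `Q` of the cube.
    P Q : ℕ
    P = N J
    Q = 4^ (J + c₂ + (cells J + b))

    M D : ℕ → ℕ
    M j = 4^ (J ∸ j + (cells J + b))
    D j = 4^ ((J ∸ j) * e)

    Letter : Set
    Letter = Vec (Fin Q) e

    letters : List Letter
    letters = vecs (allFin Q) e

    length-letters : length letters ≡ Q ^ e
    length-letters = trans (length-vecs (allFin Q) e) (cong (_^ e) (length-tabulate {n = Q} id))

    P≡DN : ∀ {j} → j ≤ J → P ≡ D j * N j
    P≡DN {j} j≤J = trans (cong 4^ (trans (cong (λ i → (i + c₂) * e + b) (sym (m∸n+n≡m j≤J)))
      (solve 5 (λ d j c₂ e b → (d :+ j :+ c₂) :* e :+ b := d :* e :+ ((j :+ c₂) :* e :+ b)) refl (J ∸ j) j c₂ e b)))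
      (4^-+ ((J ∸ j) * e) (cells j + b))

    Q≡4^M : ∀ {j} → j ≤ J → Q ≡ 4^ (j + c₂) * M j
    Q≡4^M {j} j≤J = trans (cong 4^ (trans (cong (λ i → i + c₂ + (cells J + b)) (sym (m∸n+n≡m j≤J)))
      (solve 4 (λ d j c₂ x → d :+ j :+ c₂ :+ x := j :+ c₂ :+ (d :+ x)) refl (J ∸ j) j c₂ (cells J + b))))
      (4^-+ (j + c₂) (J ∸ j + (cells J + b)))

    M≤Q : ∀ {j} → j ≤ J → M j ≤ Q
    M≤Q {j} j≤J = subst (M j ≤_) (sym (Q≡4^M j≤J)) (m≤n*m (M j) (4^ (j + c₂)))

    Q^e≡ : ∀ {j} → j ≤ J → Q ^ e ≡ 4^ (cells j) * M j ^ e
    Q^e≡ {j} j≤J = trans (cong (_^ e) (Q≡4^M j≤J)) (trans (^-distribʳ-* e (4^ (j + c₂)) (M j))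
      (cong (_* M j ^ e) (4^-^ (j + c₂) e)))

    N≤M : ∀ {j} → j ≤ J → N j ≤ M j
    N≤M {j} j≤J = 4^-mono (≤-trans (+-monoˡ-≤ b (*-monoˡ-≤ e (+-monoˡ-≤ c₂ j≤J))) (m≤n+m (cells J + b) (J ∸ j)))

    -- Scale, window, slope and offset.
    Line : Set
    Line = (Fin J × ℕ) × (Letter × Letter)

    -- Reducing the window number modulo `D` keeps the window inside one period, so the bound on
    -- failures holds for every `Line`, listed or not, as `unionBound` demands.
    scale start : Line → ℕ
    scale ((j , _) , _) = toℕ j
    start ((j , q) , _) = q % D (toℕ j) * N (toℕ j)

    shift : Line → ℕ → Fin e → ℕ
    shift (_ , (α , β)) r l = toℕ (lookup β l) + r * toℕ (lookup α l)

    window : ℕ → ℕ → ℕ → Bool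
    window a n i = (a ≤ᵇ i) ∧ (i <ᵇ a + n)

    meets : Line → Test Letter
    meets τ i ω = window (start τ) (N (scale τ)) i ∧ inCube Q (M (scale τ)) (shift τ (i ∸ start τ)) ω

    -- Window numbers run up to `P`, which bounds `D j` at every scale, so that the list is a plain
    -- product. The repetitions cost only a factor in the count.
    lines : List Line
    lines = cartesianProductWith _,_ (cartesianProductWith _,_ (allFin J) (upTo P)) (cartesianProductWith _,_ letters letters)

    length-lines : length lines ≡ (J * P) * (Q ^ e * Q ^ e)
    length-lines = trans (length-cartesianProductWith _,_ (cartesianProductWith _,_ (allFin J) (upTo P)) (cartesianProductWith _,_ letters letters)) (cong₂ _*_
      (trans (length-cartesianProductWith _,_ (allFin J) (upTo P)) (cong₂ _*_ (length-tabulate {n = J} id) (length-upTo P)))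
      (trans (length-cartesianProductWith _,_ letters letters) (cong₂ _*_ length-letters length-letters)))

    scale≤J : ∀ τ → scale τ ≤ J
    scale≤J ((j , _) , _) = <⇒≤ (toℕ<n j)

    ω₀ : Letter
    ω₀ = replicate e (fromℕ< (0<4^ (J + c₂ + (cells J + b))))

    misses≤ : ∀ τ i → misses ω₀ letters (meets τ) i ≤ Q ^ e
    misses≤ τ i = ≤-trans (∑-mono letters (λ ω → ≤1 (meets τ i ω)))
      (≤-reflexive (trans (∑-const letters 1) (trans (*-identityʳ _) length-letters)))
      where
      ≤1 : ∀ b → (if b then 0 else 1) ≤ 1
      ≤1 true  = z≤n
      ≤1 false = ≤-refl

    window-true : ∀ a n r → r < n → window a n (a + r) ≡ true
    window-true a n r r<n = Equivalence.to T-≡ (Equivalence.from T-∧ (≤⇒≤ᵇ (m≤m+n a r) , <⇒<ᵇ (+-monoʳ-< a r<n)))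

    misses-window : ∀ τ r → r < N (scale τ) →
      misses ω₀ letters (meets τ) (start τ + r) ≤ (4^ (cells (scale τ)) ∸ 1) * M (scale τ) ^ e
    misses-window τ r r<N = ≤-reflexive (trans
      (cong (λ w → ∑ letters (λ ω → if w ∧ inCube Q m (shift τ (start τ + r ∸ start τ)) ω then 0 else 1))
        (window-true (start τ) (N (scale τ)) r r<N))
      (+-cancelʳ-≡ (m ^ e) _ _ (trans (cube-misses Q m (M≤Q (scale≤J τ)) e (shift τ (start τ + r ∸ start τ)))
        (trans (Q^e≡ (scale≤J τ)) (trans (cong (_* m ^ e) (sym (m∸n+n≡m (0<4^ (cells (scale τ))))))
          (solve 2 (λ a p → (a :+ con 1) :* p := a :* p :+ p) refl (4^ (cells (scale τ)) ∸ 1) (m ^ e)))))))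
      where
      m : ℕ
      m = M (scale τ)

    window-in-period : ∀ τ → start τ + N (scale τ) ≤ P
    window-in-period ((j , q) , _) = subst (q % D (toℕ j) * N (toℕ j) + N (toℕ j) ≤_) (sym (P≡DN (<⇒≤ (toℕ<n j))))
      (≤-trans (≤-reflexive (+-comm (q % D (toℕ j) * N (toℕ j)) (N (toℕ j))))
        (*-monoˡ-≤ (N (toℕ j)) (m%n<n q (D (toℕ j)))))

    window-unlikely : ∀ τ → 2 ^ B * ((4^ (cells (scale τ)) ∸ 1) * M (scale τ) ^ e) ^ N (scale τ) ≤ (Q ^ e) ^ N (scale τ)
    window-unlikely τ = subst₂ _≤_
      (trans (*-assoc (2 ^ B) ((x ∸ 1) ^ n) (μ ^ n)) (cong (2 ^ B *_) (sym (^-distribʳ-* n (x ∸ 1) μ))))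
      (trans (sym (^-distribʳ-* n x μ)) (cong (_^ n) (sym (Q^e≡ (scale≤J τ)))))
      (*-monoˡ-≤ (μ ^ n) (subst (λ n → 2 ^ B * (x ∸ 1) ^ n ≤ x ^ n) (sym (4^-+ (cells (scale τ)) b))
        (decay x B (0<4^ (cells (scale τ))))))
      where
      x μ n : ℕ
      x = 4^ (cells (scale τ))
      μ = M (scale τ) ^ e
      n = N (scale τ)

    -- Only the window matters: the period splits into the part before it, the window and the part
    -- after it, and each outer factor is at most the number of letters.
    unlikely : ∀ τ → 2 ^ B * prod P (misses ω₀ letters (meets τ)) ≤ length letters ^ P
    unlikely τ = subst₂ (λ p R → 2 ^ B * prod p f ≤ R ^ p) (m+[n∸m]≡n (window-in-period τ)) (sym length-letters)
      (begin
        2 ^ B * prod (a + n + r) f                              ≡⟨ cong (2 ^ B *_) (prod-+ (a + n) r f) ⟩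
        2 ^ B * (prod (a + n) f * prod r h)                     ≡⟨ cong (λ t → 2 ^ B * (t * prod r h)) (prod-+ a n f) ⟩
        2 ^ B * (prod a f * prod n g * prod r h)
          ≤⟨ *-monoʳ-≤ (2 ^ B) (*-mono-≤ (*-mono-≤ (prod-≤ a f R (λ i _ → misses≤ τ i))
               (prod-≤ n g F (misses-window τ))) (prod-≤ r h R (λ i _ → misses≤ τ (a + n + i)))) ⟩
        2 ^ B * (R ^ a * F ^ n * R ^ r)                         ≡⟨ rearrange (2 ^ B) (R ^ a) (F ^ n) (R ^ r) ⟩
        R ^ a * (2 ^ B * F ^ n) * R ^ r                         ≤⟨ *-monoˡ-≤ (R ^ r) (*-monoʳ-≤ (R ^ a) (window-unlikely τ)) ⟩
        R ^ a * R ^ n * R ^ r                                   ≡⟨ cong (_* R ^ r) (^-distribˡ-+-* R a n) ⟨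
        R ^ (a + n) * R ^ r                                     ≡⟨ ^-distribˡ-+-* R (a + n) r ⟨
        R ^ (a + n + r)                                         ∎)
      where
      open ≤-Reasoning hiding (start)
      n a r R F : ℕ
      n = N (scale τ)
      a = start τ
      r = P ∸ (a + n)
      R = Q ^ e
      F = (4^ (cells (scale τ)) ∸ 1) * M (scale τ) ^ e
      f g h : ℕ → ℕ
      f = misses ω₀ letters (meets τ)
      g i = f (a + i)
      h i = f (a + n + i)
      rearrange : ∀ u v w z → u * (v * w * z) ≡ v * (u * w) * z
      rearrange = solve 4 (λ u v w z → u :* (v :* w :* z) := v :* (u :* w) :* z) refl

    -- In every aligned window of length N j, the points θ n modulo 1 come within 4^(-(j + c₂)) of
    -- any given arithmetic progression, here encoded by its negative.
    Hits : (ℕ → Letter) → Set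
    Hits θ = ∀ j → j < J → ∀ q → q < D j → ∀ (α β : Letter) →
      ∃[ r ] (r < N j × (∀ l → (toℕ (lookup (θ (q * N j + r)) l) + (toℕ (lookup β l) + r * toℕ (lookup α l))) % Q < M j))

    hitting : length lines < 2 ^ B → ∃[ θ ] Hits θ
    hitting few = map₂ (λ {θ} → hits θ) (unionBound ω₀ letters lines meets P (2 ^ B) few unlikely
      (subst (0 <_) (sym length-letters) (m^n>0 Q e)))
      where
      module _ (θ : ℕ → Letter) (good : ∀ τ → τ ∈ lines → ∃[ i ] (i < P × meets τ i (θ i) ≡ true)) where
        hits : Hits θ
        hits j j<J q q<D α β = from (good τ τ∈)
          where
          jᶠ : Fin J
          jᶠ = fromℕ< j<J
          τ : Line
          τ = (jᶠ , q) , (α , β)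
          ∈letters : ∀ ω → ω ∈ letters
          ∈letters ω = ∈-vecs (allFin Q) ω (λ l → ∈-allFin (lookup ω l))
          q<P : q < P
          q<P = <-≤-trans q<D (subst (D j ≤_) (sym (P≡DN (<⇒≤ j<J))) (m≤m*n (D j) (N j)))
          τ∈ : τ ∈ lines
          τ∈ = ∈-cartesianProductWith⁺ _,_ (∈-cartesianProductWith⁺ _,_ (∈-allFin jᶠ) (∈-upTo⁺ q<P))
            (∈-cartesianProductWith⁺ _,_ (∈letters α) (∈letters β))
          start≡ : start τ ≡ q * N j
          start≡ = trans (cong (λ i → q % D i * N i) (toℕ-fromℕ< j<J)) (cong (_* N j) (m<n⇒m%n≡m q<D))
          from : ∃[ i ] (i < P × meets τ i (θ i) ≡ true) → _
          from (i , _ , hit) with Equivalence.to T-∧ (Equivalence.from T-≡ hit)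
          ... | inWindow , inside with Equivalence.to T-∧ inWindow
          ... | lo , hi = r , r<N , λ l → subst₂ (λ i m → (toℕ (lookup (θ i) l) + shift τ r l) % Q < m)
                  i≡ (cong M (toℕ-fromℕ< j<J)) (inCube⁻ Q (M (toℕ jᶠ)) (shift τ r) (θ i) inside l)
            where
            a≤i : start τ ≤ i
            a≤i = ≤ᵇ⇒≤ _ _ lo
            r : ℕ
            r = i ∸ start τ
            i≡ : i ≡ q * N j + r
            i≡ = trans (sym (m+[n∸m]≡n a≤i)) (cong (_+ r) start≡)
            r<N : r < N j
            r<N = subst (r <_) (cong N (toℕ-fromℕ< j<J)) (+-cancelˡ-< (start τ) _ _
              (subst (_< start τ + N (toℕ jᶠ)) (sym (m+[n∸m]≡n a≤i)) (<ᵇ⇒< _ _ hi)))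

  square≤4^ : ∀ n → suc n * suc n ≤ 4^ n
  square≤4^ zero    = 0<4^ 0
  square≤4^ (suc n) = subst (suc (suc n) * suc (suc n) ≤_) (sym (4^-suc n)) (≤-trans
    (*-mono-≤ grow grow)
    (≤-trans (≤-reflexive (solve 1 (λ n → (con 1 :+ n :+ (con 1 :+ n)) :* (con 1 :+ n :+ (con 1 :+ n))
        := con 4 :* ((con 1 :+ n) :* (con 1 :+ n))) refl n))
      (*-monoʳ-≤ 4 (square≤4^ n))))
    where
    grow : suc (suc n) ≤ suc n + suc n
    grow = s≤s (m≤n+m (suc n) n)

  -- At w = u + v the left side is below (1 + u + v)², which `square≤4^` bounds.
  linear<4^ : ∀ u v → ∃[ w ] u * w + v < 4^ w
  linear<4^ u v = u + v , <-≤-trans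
    (subst (u * (u + v) + v <_)
      (solve 2 (λ u v → con 1 :+ (u :* (u :+ v) :+ v :+ (v :* (u :+ v) :+ u :+ (u :+ v)))
        := (con 1 :+ (u :+ v)) :* (con 1 :+ (u :+ v))) refl u v)
      (s≤s (m≤m+n (u * (u + v) + v) (v * (u + v) + u + (u + v)))))
    (square≤4^ (u + v))

  4^≡2^ : ∀ n → 4^ n ≡ 2 ^ (2 * n)
  4^≡2^ n = trans (4^≡ n) (^-*-assoc 2 2 n)

  module _ (e c₂ : ℕ) where

    -- The logarithm to base 4 of the number of tests in block `k`: the summands belong to the
    -- scales, to the windows and to the two letters for slope and offset.
    exponent : ℕ → ℕ → ℕ
    exponent k w = suc k + ((J + c₂) * e + b) + ((J + c₂ + ((J + c₂) * e + b)) * e + (J + c₂ + ((J + c₂) * e + b)) * e)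
      where
      J b : ℕ
      J = 4^ (suc k)
      b = k + suc w

    u v : ℕ
    u = 2 * (1 + 2 * e)
    v = 2 * (2 + e * (1 + c₂) + 2 * (e * (2 + c₂ + e * (1 + c₂))))

    -- Every summand is at most J = 4^(k+1) times a linear function of `w`, because `suc k` ≤ J and
    -- n ≤ J * n for the other terms.
    exponent≤ : ∀ k w → 2 * exponent k w ≤ 4^ (suc k) * (u * w + v)
    exponent≤ k w = ≤-trans
      (*-monoʳ-≤ 2 (+-mono-≤ (+-mono-≤ k<J base)
        (+-mono-≤ (*-monoˡ-≤ e top) (*-monoˡ-≤ e top))))
      (≤-reflexive (solve 4 (λ J c₂ e w →
        con 2 :* (J :+ ((J :+ J :* c₂) :* e :+ (J :+ J :* w))
          :+ ((J :+ J :* c₂ :+ ((J :+ J :* c₂) :* e :+ (J :+ J :* w))) :* e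
            :+ (J :+ J :* c₂ :+ ((J :+ J :* c₂) :* e :+ (J :+ J :* w))) :* e))
        := J :* (con 2 :* (con 1 :+ con 2 :* e) :* w
            :+ con 2 :* (con 2 :+ e :* (con 1 :+ c₂) :+ con 2 :* (e :* (con 2 :+ c₂ :+ e :* (con 1 :+ c₂))))))
        refl J c₂ e w))
      where
      J : ℕ
      J = 4^ (suc k)
      k<J : suc k ≤ J
      k<J = <⇒≤ (n<4^n (suc k))
      scaled : ∀ n → n ≤ J * n
      scaled n = m≤n*m n J
      J+c₂≤ : J + c₂ ≤ J + J * c₂
      J+c₂≤ = +-monoʳ-≤ J (scaled c₂)
      base : (J + c₂) * e + (k + suc w) ≤ (J + J * c₂) * e + (J + J * w)
      base = +-mono-≤ (*-monoˡ-≤ e J+c₂≤) (≤-trans (≤-reflexive (+-suc k w)) (+-mono-≤ k<J (scaled w)))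
      top : J + c₂ + ((J + c₂) * e + (k + suc w)) ≤ J + J * c₂ + ((J + J * c₂) * e + (J + J * w))
      top = +-mono-≤ J+c₂≤ base

    -- The budget of block `k` is 2^(J * 4^w) tests, with J = 4^(k+1), while there are at most 2^(J
    -- * (u * w + v)). The factor J cancels, so one `w`, and hence one `c`, serves every block.
    -- Raising `w` lengthens the windows and thereby enlarges period and denominator, but their
    -- exponents grow only linearly.
    blocks : ∃[ c ] ∀ k → ∃[ θ ] Parameters.Hits e c₂ (k + c) (4^ (suc k)) θ
    blocks = from (linear<4^ u v)
      where
      from : ∃[ w ] u * w + v < 4^ w → ∃[ c ] ∀ k → ∃[ θ ] Parameters.Hits e c₂ (k + c) (4^ (suc k)) θ
      from (w , small) = suc w , λ k → Parameters.hitting e c₂ (k + suc w) (4^ (suc k)) (few k)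
        where
        few : ∀ k → length (Parameters.lines e c₂ (k + suc w) (4^ (suc k))) < 2 ^ 4^ (k + suc w)
        few k = subst₂ _<_ (sym total) refl (^-monoʳ-< 2 (s≤s (s≤s z≤n)) (≤-<-trans (exponent≤ k w)
          (subst (4^ (suc k) * (u * w + v) <_) (trans (sym (4^-+ (suc k) w)) (cong 4^ (sym (+-suc k w))))
            (*-monoʳ-< (4^ (suc k)) small))))
          where
          open Parameters e c₂ (k + suc w) (4^ (suc k))
          q : ℕ
          q = 4^ (suc k) + c₂ + (cells (4^ (suc k)) + (k + suc w))
          total : length lines ≡ 2 ^ (2 * exponent k w)
          total = trans length-lines (trans (cong₂ _*_ (sym (4^-+ (suc k) (cells (4^ (suc k)) + (k + suc w))))
              (trans (cong₂ _*_ (4^-^ q e) (4^-^ q e)) (sym (4^-+ (q * e) (q * e)))))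
            (trans (sym (4^-+ (suc k + (cells (4^ (suc k)) + (k + suc w))) (q * e + q * e))) (4^≡2^ (exponent k w))))

-- Integers inside the rationals, floors and remainders

module Rationals where

  open import Defs using (module RationalLemmas)
  open RationalLemmas using (fromℕ)
  open import Data.Nat.Base as ℕ using (ℕ; suc)
  import Data.Nat.Properties as ℕP
  import Data.Nat.Coprimality as Coprimality
  open import Data.Integer.Base as ℤ using (ℤ; +_; -[1+_]; _%ℕ_; _/ℕ_)
  import Data.Integer.Properties as ℤP
  open import Data.Integer.DivMod using (n%ℕd<d; a≡a%ℕn+[a/ℕn]*n; [n/ℕd]*d≤n; n<s[n/ℕd]*d)
  open import Algebra.Bundles using (module AbelianGroup)
  import Data.Integer.Solver as ℤS
  open import Data.Rational.Base hiding (_/_)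
  open import Data.Rational.Properties
  open import Data.Product using (∃-syntax; _×_; _,_)
  open import Relation.Nullary using (yes; no; contradiction)
  open import Relation.Binary.PropositionalEquality hiding (J)

  ≤-add : ∀ {p q} r → 0ℚ ≤ r → p + r ≡ q → p ≤ q
  ≤-add {p} r 0≤r refl = subst (_≤ p + r) (+-identityʳ p) (+-monoʳ-≤ p 0≤r)

  fromℤ : ℤ → ℚ
  fromℤ i = mkℚ i 0 (Coprimality.sym (Coprimality.1-coprimeTo ℤ.∣ i ∣))

  /1≡fromℤ : ∀ i → i Data.Rational.Base./ 1 ≡ fromℤ i
  /1≡fromℤ (+ n)    = normalize-coprime _
  /1≡fromℤ -[1+ n ] = cong -_ (normalize-coprime {suc n} {0} _)

  fromℤ-+ : ∀ i j → fromℤ (i ℤ.+ j) ≡ fromℤ i + fromℤ j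
  fromℤ-+ i j = sym (trans
    (cong₂ (λ a b → (a ℤ.+ b) Data.Rational.Base./ 1) (ℤP.*-identityʳ i) (ℤP.*-identityʳ j))
    (/1≡fromℤ (i ℤ.+ j)))

  fromℤ-* : ∀ i j → fromℤ (i ℤ.* j) ≡ fromℤ i * fromℤ j
  fromℤ-* i j = sym (/1≡fromℤ (i ℤ.* j))

  fromℤ-mono : ∀ {i j} → i ℤ.≤ j → fromℤ i ≤ fromℤ j
  fromℤ-mono {i} {j} h = *≤* (subst₂ ℤ._≤_ (sym (ℤP.*-identityʳ i)) (sym (ℤP.*-identityʳ j)) h)

  fromℤ-cancel-≤ : ∀ {i j} → fromℤ i ≤ fromℤ j → i ℤ.≤ j
  fromℤ-cancel-≤ {i} {j} (*≤* h) = subst₂ ℤ._≤_ (ℤP.*-identityʳ i) (ℤP.*-identityʳ j) h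

  fromℕ-mono : ∀ {m n} → m ℕ.≤ n → fromℕ m ≤ fromℕ n
  fromℕ-mono h = fromℤ-mono (ℤ.+≤+ h)

  fromℕ-cancel-≤ : ∀ {m n} → fromℕ m ≤ fromℕ n → m ℕ.≤ n
  fromℕ-cancel-≤ h = ℤP.drop‿+≤+ (fromℤ-cancel-≤ h)

  fromℕ-* : ∀ m n → fromℕ (m ℕ.* n) ≡ fromℕ m * fromℕ n
  fromℕ-* m n = trans (cong fromℤ (ℤP.pos-* m n)) (fromℤ-* (+ m) (+ n))

  floor-bounds : ∀ p → ∃[ v ] (fromℤ v ≤ p × p ≤ fromℤ v + 1ℚ)
  floor-bounds p@(mkℚ n d _) = v ,
    *≤* (subst (v ℤ.* + suc d ℤ.≤_) (sym (ℤP.*-identityʳ n)) ([n/ℕd]*d≤n n (suc d))) ,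
    subst (p ≤_) (trans (fromℤ-+ (+ 1) v) (+-comm 1ℚ (fromℤ v)))
      (*≤* (subst (ℤ._≤ ℤ.suc v ℤ.* + suc d) (sym (ℤP.*-identityʳ n)) (ℤP.<⇒≤ (n<s[n/ℕd]*d n (suc d)))))
    where
    v : ℤ
    v = n /ℕ suc d

  recipℕ : (n : ℕ) → .{{ℕ.NonZero n}} → ℚ
  recipℕ (suc n) = mkℚ (+ 1) n (Coprimality.1-coprimeTo (suc n))

  recipℕ-inverse : ∀ n .{{_ : ℕ.NonZero n}} → fromℕ n * recipℕ n ≡ 1ℚ
  recipℕ-inverse (suc n) = *-inverseʳ (fromℕ (suc n))

  0<recipℕ : ∀ n .{{_ : ℕ.NonZero n}} → 0ℚ < recipℕ n
  0<recipℕ (suc n) = positive⁻¹ (recipℕ (suc n))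

  private
    smaller-quotient : ∀ n r r′ (w w′ : ℤ) → + r ℤ.+ w ℤ.* + n ≡ + r′ ℤ.+ w′ ℤ.* + n → r′ ℕ.< n → w ℤ.≤ w′
    smaller-quotient n r r′ w w′ eq r′<n with w ℤP.≤? w′
    ... | yes p = p
    ... | no ¬p = contradiction
      (ℤP.<-≤-trans (ℤP.+-monoˡ-< (w′ ℤ.* + n) (ℤ.+<+ r′<n))
        (subst₂ ℤ._≤_ (ℤP.suc-* w′ (+ n)) eq
          (ℤP.≤-trans (ℤP.*-monoʳ-≤-nonNeg (+ n) (ℤP.i<j⇒suc[i]≤j (ℤP.≰⇒> ¬p))) (ℤP.i≤j+i (w ℤ.* + n) (+ r)))))
      (ℤP.<-irrefl refl)

  %ℕ-unique : ∀ n .{{_ : ℕ.NonZero n}} i r w → i ≡ + r ℤ.+ w ℤ.* + n → r ℕ.< n → i %ℕ n ≡ r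
  %ℕ-unique n i r w eq r<n = ℤP.+-injective (∙-cancelʳ (w ℤ.* + n) (+ (i %ℕ n)) (+ r)
    (trans (cong (λ w → + (i %ℕ n) ℤ.+ w ℤ.* + n) (sym quotients)) eq′))
    where
    open import Algebra.Properties.Group (AbelianGroup.group ℤP.+-0-abelianGroup) using (∙-cancelʳ)
    quotients : i /ℕ n ≡ w
    eq′ : + (i %ℕ n) ℤ.+ (i /ℕ n) ℤ.* + n ≡ + r ℤ.+ w ℤ.* + n
    eq′ = trans (sym (a≡a%ℕn+[a/ℕn]*n i n)) eq
    quotients = ℤP.≤-antisym (smaller-quotient n (i %ℕ n) r (i /ℕ n) w eq′ r<n)
      (smaller-quotient n r (i %ℕ n) w (i /ℕ n) (sym eq′) (n%ℕd<d i n))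

  -- This moves a window from anywhere in ℤ into the first period: its number is reduced modulo `m`,
  -- and the position inside it stays.
  %ℕ-* : ∀ m n .{{_ : ℕ.NonZero m}} .{{_ : ℕ.NonZero (m ℕ.* n)}} (q : ℤ) r → r ℕ.< n →
         (q ℤ.* + n ℤ.+ + r) %ℕ (m ℕ.* n) ≡ (q %ℕ m) ℕ.* n ℕ.+ r
  %ℕ-* m n q r r<n = %ℕ-unique (m ℕ.* n) (q ℤ.* + n ℤ.+ + r) ((q %ℕ m) ℕ.* n ℕ.+ r) (q /ℕ m)
    (trans (cong (λ q → q ℤ.* + n ℤ.+ + r) (a≡a%ℕn+[a/ℕn]*n q m))
      (trans (solve 5 (λ a w m n r → (a :+ w :* m) :* n :+ r := (a :* n :+ r) :+ w :* (m :* n)) refl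
          (+ (q %ℕ m)) (q /ℕ m) (+ m) (+ n) (+ r))
        (cong₂ ℤ._+_ (trans (cong (ℤ._+ + r) (sym (ℤP.pos-* (q %ℕ m) n))) (sym (ℤP.pos-+ ((q %ℕ m) ℕ.* n) r)))
          (cong ((q /ℕ m) ℤ.*_) (sym (ℤP.pos-* m n))))))
    (ℕP.<-≤-trans (ℕP.+-monoʳ-< ((q %ℕ m) ℕ.* n) r<n)
      (ℕP.≤-trans (ℕP.≤-reflexive (ℕP.+-comm ((q %ℕ m) ℕ.* n) n)) (ℕP.*-monoˡ-≤ n (n%ℕd<d q m))))
    where
    open ℤS.+-*-Solver

-- From residues to rational arithmetic progressions modulo 1

module Lines where

  open import Defs using (module RationalLemmas)
  open RationalLemmas using (fromℕ; fromℕ-suc; abs-≤; 0≤fromℕ)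
  open import Data.Nat.Base as ℕ using (ℕ)
  import Data.Nat.Properties as ℕP
  import Data.Nat.DivMod as ℕD
  open import Data.Integer.Base as ℤ using (ℤ; +_; _%ℕ_; _/ℕ_)
  import Data.Integer.Properties as ℤP
  open import Data.Integer.DivMod using (n%ℕd<d; a≡a%ℕn+[a/ℕn]*n)
  import Data.Integer.Solver as ℤS
  open import Data.Rational.Base hiding (_/_)
  open import Data.Rational.Properties
  open import Data.Rational.Solver using (module +-*-Solver)
  open import Data.Fin.Base using (Fin; toℕ; fromℕ<)
  open import Data.Fin.Properties using (toℕ-fromℕ<)
  open import Data.Vec.Base using (Vec; lookup; tabulate)
  open import Data.Vec.Properties using (lookup∘tabulate)
  open import Data.Product using (∃-syntax; Σ-syntax; _×_; _,_; proj₁; proj₂)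
  open import Relation.Binary.PropositionalEquality hiding (J)
  open Rationals
  open Block using (4^; 4^-nonZero; module Parameters)

  module Hitting (e c₂ b J : ℕ) (θ : ℕ → Parameters.Letter e c₂ b J) where

    open Parameters e c₂ b J

    digit : ℤ → Fin e → ℕ
    digit n l = toℕ (lookup (θ (n %ℕ P)) l)

    coordinate : ℤ → ℤ → Fin e → ℚ
    coordinate n z l = fromℤ (+ digit n l ℤ.+ z ℤ.* + Q) * recipℕ Q

    -- The sign matches `Hits`: a letter lies just above the progression when the letter plus the
    -- negated progression is small modulo `Q`.
    residue : ℤ → Fin Q
    residue i = fromℕ< (n%ℕd<d (ℤ.- i) Q)

    residue-eq : ∀ i → i ≡ ℤ.- (+ toℕ (residue i) ℤ.+ (ℤ.- i) /ℕ Q ℤ.* + Q)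
    residue-eq i = trans (sym (ℤP.neg-involutive i)) (cong ℤ.-_ (trans (a≡a%ℕn+[a/ℕn]*n (ℤ.- i) Q)
      (cong (λ r → + r ℤ.+ (ℤ.- i) /ℕ Q ℤ.* + Q) (sym (toℕ-fromℕ< (n%ℕd<d (ℤ.- i) Q))))))

    -- The congruence becomes an equation: the integer part `z` absorbs the quotients by `Q` of `s`,
    -- of -i and of -a, and the remainder of `s` is the excess over the progression i + r a.
    lift : ∀ (ω r : ℕ) (i a : ℤ) → let s = ω ℕ.+ (toℕ (residue i) ℕ.+ r ℕ.* toℕ (residue a)) in
           ∃[ z ] + ω ℤ.+ z ℤ.* + Q ≡ + (s ℕ.% Q) ℤ.+ (i ℤ.+ + r ℤ.* a)
    lift ω r i a = ℤ.- (+ t ℤ.+ (w ℤ.+ + r ℤ.* x)) , sym (trans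
      (cong₂ (λ i a → + u ℤ.+ (i ℤ.+ + r ℤ.* a)) (residue-eq i) (residue-eq a))
      (trans (solve 8 (λ u β w Q r α x t →
          u :+ (:- (β :+ w :* Q) :+ r :* (:- (α :+ x :* Q)))
          := (u :+ t :* Q) :- (β :+ r :* α) :+ (:- (t :+ (w :+ r :* x))) :* Q) refl
          (+ u) (+ β) w (+ Q) (+ r) (+ α) x (+ t))
        (cong (ℤ._+ ℤ.- (+ t ℤ.+ (w ℤ.+ + r ℤ.* x)) ℤ.* + Q)
          (trans (cong (ℤ._- (+ β ℤ.+ + r ℤ.* + α)) (sym s≡))
            (solve 4 (λ ω β r α → ω :+ (β :+ r :* α) :- (β :+ r :* α) := ω) refl (+ ω) (+ β) (+ r) (+ α))))))
      where
      open ℤS.+-*-Solver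
      β α s u t : ℕ
      β = toℕ (residue i)
      α = toℕ (residue a)
      s = ω ℕ.+ (β ℕ.+ r ℕ.* α)
      u = s ℕ.% Q
      t = s ℕD./ Q
      w x : ℤ
      w = (ℤ.- i) /ℕ Q
      x = (ℤ.- a) /ℕ Q
      s≡ : + ω ℤ.+ (+ β ℤ.+ + r ℤ.* + α) ≡ + u ℤ.+ + t ℤ.* + Q
      s≡ = trans (cong (λ p → + ω ℤ.+ (+ β ℤ.+ p)) (sym (ℤP.pos-* r α)))
        (trans (cong +_ (ℕD.m≡m%n+[m/n]*n s Q)) (cong (λ p → + u ℤ.+ p) (ℤP.pos-* t Q)))

    radius : ∀ j → ℚ
    radius j = recipℕ (4^ (j ℕ.+ c₂))

    M/Q : ∀ {j} → j ℕ.≤ J → fromℕ (M j) * recipℕ Q ≡ radius j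
    M/Q {j} j≤J = trans (sym (*-identityˡ _)) (trans (cong (_* (m * κ)) (trans (sym (recipℕ-inverse (4^ (j ℕ.+ c₂)))) (*-comm f ρ)))
      (trans (solve 4 (λ f ρ m κ → (ρ :* f) :* (m :* κ) := ρ :* ((f :* m) :* κ)) refl f ρ m κ)
      (trans (cong (λ q → ρ * (q * κ)) (trans (sym (fromℕ-* (4^ (j ℕ.+ c₂)) (M j))) (cong fromℕ (sym (Q≡4^M j≤J)))))
      (trans (cong (ρ *_) (recipℕ-inverse Q)) (*-identityʳ ρ)))))
      where
      open +-*-Solver
      f ρ m κ : ℚ
      f = fromℕ (4^ (j ℕ.+ c₂))
      ρ = radius j
      m = fromℕ (M j)
      κ = recipℕ Q

    floor-scaled : ℚ → ℤ
    floor-scaled p = proj₁ (floor-bounds (fromℕ Q * p))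

    -- The two errors have opposite signs and do not add up: the excess `u` < `M j` pushes upwards,
    -- while rounding down `Y` and `r` copies of `A` loses at most 1 + r ≤ `N j` ≤ `M j`.
    close : ∀ {j r u} (Y A : ℚ) → j ℕ.≤ J → r ℕ.< N j → u ℕ.< M j →
      ∣ fromℤ (+ u ℤ.+ (floor-scaled Y ℤ.+ + r ℤ.* floor-scaled A)) * recipℕ Q - (Y + fromℕ r * A) ∣ ≤ radius j
    close {j} {r} {u} Y A j≤J r<N u<M = abs-≤
      (subst₂ _≤_ refl (trans (*-distribʳ-+ κ y m) (cong₂ _+_ y/Q (M/Q j≤J))) (*-monoʳ-≤-nonNeg κ {{nonNegative 0≤κ}} upper))
      (subst₂ _≤_ y/Q (trans (*-distribʳ-+ κ x m) (cong (λ p → x * κ + p) (M/Q j≤J))) (*-monoʳ-≤-nonNeg κ {{nonNegative 0≤κ}} lower))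
      where
      open +-*-Solver
      q κ m R x y v w : ℚ
      q = fromℕ Q
      κ = recipℕ Q
      m = fromℕ (M j)
      R = fromℕ r
      v = fromℤ (floor-scaled Y)
      w = fromℤ (floor-scaled A)
      x = fromℤ (+ u ℤ.+ (floor-scaled Y ℤ.+ + r ℤ.* floor-scaled A))
      y = q * Y + R * (q * A)
      0≤κ : 0ℚ ≤ κ
      0≤κ = <⇒≤ (0<recipℕ Q)
      x≡ : x ≡ fromℕ u + (v + R * w)
      x≡ = trans (fromℤ-+ (+ u) (floor-scaled Y ℤ.+ + r ℤ.* floor-scaled A)) (cong (λ p → fromℕ u + p)
        (trans (fromℤ-+ (floor-scaled Y) (+ r ℤ.* floor-scaled A)) (cong (λ p → v + p) (fromℤ-* (+ r) (floor-scaled A)))))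
      y/Q : y * κ ≡ Y + R * A
      y/Q = trans (solve 5 (λ q Y R A κ → (q :* Y :+ R :* (q :* A)) :* κ := (q :* κ) :* (Y :+ R :* A)) refl q Y R A κ)
        (trans (cong (_* (Y + R * A)) (recipℕ-inverse Q)) (*-identityˡ _))
      upper : x ≤ y + m
      upper = subst₂ _≤_ (sym x≡) (+-comm m y) (+-mono-≤ (fromℕ-mono (ℕP.<⇒≤ u<M))
        (+-mono-≤ (proj₁ (proj₂ (floor-bounds (q * Y))))
          (*-monoˡ-≤-nonNeg R {{nonNegative (0≤fromℕ r)}} (proj₁ (proj₂ (floor-bounds (q * A)))))))
      lower : y ≤ x + m
      lower = ≤-trans (+-mono-≤ (proj₂ (proj₂ (floor-bounds (q * Y))))
          (*-monoˡ-≤-nonNeg R {{nonNegative (0≤fromℕ r)}} (proj₂ (proj₂ (floor-bounds (q * A))))))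
        (≤-trans (≤-add (fromℕ u) (0≤fromℕ u)
            (solve 4 (λ u v R w → (v :+ con 1ℚ :+ R :* (w :+ con 1ℚ)) :+ u := (u :+ (v :+ R :* w)) :+ (con 1ℚ :+ R)) refl (fromℕ u) v R w))
          (+-mono-≤ (≤-reflexive (sym x≡)) (subst (_≤ m) (fromℕ-suc r) (fromℕ-mono (ℕP.≤-trans r<N (N≤M j≤J))))))

    period-index : ∀ {j r} → j ℕ.≤ J → r ℕ.< N j → ∀ q → (q ℤ.* + N j ℤ.+ + r) %ℕ P ≡ (q %ℕ D j) ℕ.* N j ℕ.+ r
    period-index {j} {r} j≤J r<N q = trans (lemma (q ℤ.* + N j ℤ.+ + r) (P≡DN j≤J)) (%ℕ-* (D j) (N j) q r r<N)
      where
      instance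
        nz : ℕ.NonZero (D j ℕ.* N j)
        nz = subst ℕ.NonZero (P≡DN j≤J) 4^-nonZero
      lemma : ∀ {p p′} .{{_ : ℕ.NonZero p}} .{{_ : ℕ.NonZero p′}} (i : ℤ) → p ≡ p′ → i %ℕ p ≡ i %ℕ p′
      lemma i refl = refl

    line-hit : Hits θ → ∀ {j} → j ℕ.< J → ∀ (q : ℤ) (Y A : Fin e → ℚ) →
      ∃[ r ] (r ℕ.< N j × Σ[ z ∈ (Fin e → ℤ) ] (∀ l →
        ∣ coordinate (q ℤ.* + N j ℤ.+ + r) (z l) l - (Y l + fromℕ r * A l) ∣ ≤ radius j))
    line-hit hits {j} j<J q Y A = from (hits j j<J (q %ℕ D j) (n%ℕd<d q (D j)) (letter A) (letter Y))
      where
      letter : (Fin e → ℚ) → Letter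
      letter Z = tabulate (λ l → residue (floor-scaled (Z l)))
      shifted : (ℕ → ℕ) → ℕ → Fin e → ℕ
      shifted ω r l = ω r ℕ.+ (toℕ (lookup (letter Y) l) ℕ.+ r ℕ.* toℕ (lookup (letter A) l))
      from : ∃[ r ] (r ℕ.< N j × (∀ l → shifted (λ r → toℕ (lookup (θ ((q %ℕ D j) ℕ.* N j ℕ.+ r)) l)) r l ℕ.% Q ℕ.< M j)) → _
      from (r , r<N , h) = r , r<N , (λ l → proj₁ (lifted l)) , λ l →
        subst (λ m → ∣ fromℤ m * recipℕ Q - (Y l + fromℕ r * A l) ∣ ≤ radius j) (sym (proj₂ (lifted l)))
          (close (Y l) (A l) (ℕP.<⇒≤ j<J) r<N (small l))
        where
        n : ℤ
        n = q ℤ.* + N j ℤ.+ + r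
        lifted : ∀ l → _
        lifted l = lift (digit n l) r (floor-scaled (Y l)) (floor-scaled (A l))
        small : ∀ l → (digit n l ℕ.+ (toℕ (residue (floor-scaled (Y l))) ℕ.+ r ℕ.* toℕ (residue (floor-scaled (A l))))) ℕ.% Q ℕ.< M j
        small l = subst₂ (λ i s → (toℕ (lookup (θ i) l) ℕ.+ s) ℕ.% Q ℕ.< M j)
          (sym (period-index (ℕP.<⇒≤ j<J) r<N q))
          (cong₂ (λ β α → toℕ β ℕ.+ r ℕ.* toℕ α) (lookup∘tabulate _ l) (lookup∘tabulate _ l)) (h l)

-- Long segments crossing the hyperplanes of one axis

module Segments where

  open import Defs using (module RationalLemmas)
  open RationalLemmas using (fromℕ; fromℕ-suc; *-nonneg; 0≤fromℕ; 0<1; quotient; +-nonneg; +-pos)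
  open import Data.Nat.Base as ℕ using (ℕ; suc)
  open import Data.Integer.Base as ℤ using (ℤ; +_)
  open import Data.Rational.Base hiding (_/_)
  open import Data.Rational.Properties hiding (_≟_)
  open import Data.Rational.Solver using (module +-*-Solver)
  open +-*-Solver using (solve; _:+_; _:*_; _:-_; :-_; _:=_; con)
  open import Data.Fin.Base using (Fin; punchIn)
  open import Data.Fin.Properties using (_≟_; punchIn-punchOut)
  open import Data.Vec.Functional using (insertAt)
  open import Data.Vec.Functional.Properties using (insertAt-lookup; insertAt-punchIn)
  open import Data.Product using (∃-syntax; Σ-syntax; _×_; _,_; proj₁; proj₂)
  open import Data.Sum.Base using (inj₁; inj₂)
  open import Function.Base using (_∘_)
  open import Relation.Nullary using (yes; no)
  open import Relation.Binary.PropositionalEquality hiding (J)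
  open Rationals
  open Block using (4^; 4^-nonZero; module Parameters)
  open Lines

  along : ∀ {d} → (Fin d → ℚ) → (Fin d → ℚ) → ℚ → Fin d → ℚ
  along a b t l = (1ℚ - t) * a l + t * b l

  axis-or-punchIn : ∀ {n} (i : Fin (suc n)) (P : Fin (suc n) → Set) → P i → (∀ l → P (punchIn i l)) → ∀ l → P l
  axis-or-punchIn i P p q l with i ≟ l
  ... | yes refl = p
  ... | no i≢l   = subst P (punchIn-punchOut i≢l) (q _)

  module Planes (e c₂ b J : ℕ) (θ : ℕ → Parameters.Letter e c₂ b J) (G : ℕ) where

    open Parameters e c₂ b J
    open Hitting e c₂ b J θ using (coordinate; radius; line-hit)

    -- Odd multiples of G stay away from 0, so that small balls meet few layers.
    height : ℤ → ℚ
    height n = fromℤ (n ℤ.+ n ℤ.+ + 1) * fromℕ G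

    forestPoint : Fin (suc e) → ℤ → (Fin e → ℤ) → Fin (suc e) → ℚ
    forestPoint i n z = insertAt (λ l → coordinate n (z l) l) i (height n)

    module _ (hits : Hits θ) (0<G : 0 ℕ.< G) {j : ℕ} (j<J : j ℕ.< J) where

      Hit : (a b : Fin (suc e) → ℚ) → Fin (suc e) → Set
      Hit a b i = ∃[ n ] Σ[ z ∈ (Fin e → ℤ) ] ∃[ t ] (0ℚ ≤ t × t ≤ 1ℚ ×
        (∀ l → ∣ forestPoint i n z l - along a b t l ∣ ≤ radius j))

      -- `S` is the extent of one window across its `N j` hyperplanes, which are 2 `g` apart. An
      -- interval of length 2 `S` contains a whole aligned window, wherever it begins.
      S g m : ℚ
      m = fromℕ (N j)
      g = fromℕ G
      S = (g + g) * m

      0<g : 0ℚ < g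
      0<g = <-≤-trans 0<1 (fromℕ-mono 0<G)

      0≤g : 0ℚ ≤ g
      0≤g = <⇒≤ 0<g

      0<S : 0ℚ < S
      0<S = RationalLemmas.*-pos (+-pos 0<g 0≤g) (<-≤-trans 0<1 (fromℕ-mono (ℕ.>-nonZero⁻¹ (N j))))

      height-+ : ∀ q r → height (q ℤ.* + N j ℤ.+ + r) ≡ S * fromℤ q + (g + (g + g) * fromℕ r)
      height-+ q r = trans (cong (_* g) (trans (fromℤ-+ (n ℤ.+ n) (+ 1)) (cong (_+ 1ℚ) (trans (fromℤ-+ n n) (cong₂ _+_ n≡ n≡)))))
        (solve 4 (λ q m r g → (q :* m :+ r :+ (q :* m :+ r) :+ con 1ℚ) :* g := (g :+ g) :* m :* q :+ (g :+ (g :+ g) :* r))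
          refl (fromℤ q) m (fromℕ r) g)
        where
        n : ℤ
        n = q ℤ.* + N j ℤ.+ + r
        n≡ : fromℤ n ≡ fromℤ q * m + fromℕ r
        n≡ = trans (fromℤ-+ (q ℤ.* + N j) (+ r)) (cong (_+ fromℕ r) (fromℤ-* q (+ N j)))

      offset≤S : ∀ {r} → r ℕ.< N j → g + (g + g) * fromℕ r ≤ S
      offset≤S {r} r<N = ≤-trans (≤-add g 0≤g (trans
        (solve 2 (λ g r → g :+ (g :+ g) :* r :+ g := (g :+ g) :* (con 1ℚ :+ r)) refl g (fromℕ r))
        (cong ((g + g) *_) (sym (fromℕ-suc r)))))
        (*-monoˡ-≤-nonNeg (g + g) {{nonNegative (+-nonneg 0≤g 0≤g)}} (fromℕ-mono r<N))

      ascending : ∀ a b i → a i + (S + S) ≤ b i → Hit a b i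
      ascending a b i long = from (quotient (<-≤-trans 0<S+S S+S≤L) 0<1) (quotient 0<S 0<1)
        where
        0<S+S : 0ℚ < S + S
        0<S+S = +-pos 0<S (<⇒≤ 0<S)
        L : ℚ
        L = b i - a i
        S+S≤L : S + S ≤ L
        S+S≤L = subst (_≤ L) (solve 2 (λ a s → a :+ s :- a := s) refl (a i) (S + S)) (+-monoˡ-≤ (- a i) long)
        from : Σ[ κ ∈ ℚ ] (0ℚ < κ × L * κ ≡ 1ℚ) → Σ[ σ ∈ ℚ ] (0ℚ < σ × S * σ ≡ 1ℚ) → Hit a b i
        from (κ , 0<κ , Lκ) (σ , 0<σ , Sσ) = hit (line-hit hits j<J q (Y ∘ punchIn i) (A ∘ punchIn i))
          where
          fl : ∃[ v ] (fromℤ v ≤ a i * σ × a i * σ ≤ fromℤ v + 1ℚ)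
          fl = floor-bounds (a i * σ)
          v q : ℤ
          v = proj₁ fl
          -- Window `q` begins at height S q, between `a i` and `a i + S`, and therefore ends before
          -- `a i + 2 S`, which is at most `b i`.
          q = v ℤ.+ + 1
          q≡ : fromℤ q ≡ fromℤ v + 1ℚ
          q≡ = fromℤ-+ v (+ 1)
          S*a*σ : S * (a i * σ) ≡ a i
          S*a*σ = trans (solve 3 (λ S a σ → S :* (a :* σ) := a :* (S :* σ)) refl S (a i) σ)
            (trans (cong (a i *_) Sσ) (*-identityʳ (a i)))
          a≤Sq : a i ≤ S * fromℤ q
          a≤Sq = subst₂ _≤_ S*a*σ (cong (S *_) (sym q≡)) (*-monoˡ-≤-nonNeg S {{nonNegative (<⇒≤ 0<S)}} (proj₂ (proj₂ fl)))
          Sq≤a+S : S * fromℤ q ≤ a i + S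
          Sq≤a+S = subst₂ _≤_ (trans (solve 2 (λ S v → S :* v :+ S := S :* (v :+ con 1ℚ)) refl S (fromℤ v)) (cong (S *_) (sym q≡)))
            (cong (_+ S) S*a*σ) (+-monoˡ-≤ S (*-monoˡ-≤-nonNeg S {{nonNegative (<⇒≤ 0<S)}} (proj₁ (proj₂ fl))))
          Y A : Fin (suc e) → ℚ
          -- Since κ is 1 / (b i - a i), `Y l + r * A l` is coordinate l of the crossing of the line
          -- through `a` and `b` with hyperplane `r` of window `q`.
          Y l = a l + (S * fromℤ q + g - a i) * κ * (b l - a l)
          A l = (g + g) * κ * (b l - a l)
          hit : ∃[ r ] (r ℕ.< N j × Σ[ z ∈ (Fin e → ℤ) ] (∀ l →
            ∣ coordinate (q ℤ.* + N j ℤ.+ + r) (z l) l - (Y (punchIn i l) + fromℕ r * A (punchIn i l)) ∣ ≤ radius j)) → Hit a b i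
          hit (r , r<N , z , h) = n , z , t , 0≤t , t≤1 ,
            axis-or-punchIn i (λ l → ∣ forestPoint i n z l - along a b t l ∣ ≤ radius j)
              (subst (_≤ radius j) (sym (cong ∣_∣ (trans (cong₂ _-_ (insertAt-lookup (λ l → coordinate n (z l) l) i (height n)) along-axis)
                (+-inverseʳ X)))) (<⇒≤ (0<recipℕ (4^ (j ℕ.+ c₂)))))
              (λ l → subst₂ (λ x y → ∣ x - y ∣ ≤ radius j)
                (sym (insertAt-punchIn (λ l → coordinate n (z l) l) i (height n) l)) (along-line (punchIn i l)) (h l))
            where
            n : ℤ
            n = q ℤ.* + N j ℤ.+ + r
            X t : ℚ
            X = height n
            t = (X - a i) * κ
            R : ℚ
            R = fromℕ r
            along-line : ∀ l → Y l + R * A l ≡ along a b t l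
            along-line l = trans
              (solve 7 (λ al bl Sq g ai κ r →
                al :+ (Sq :+ g :- ai) :* κ :* (bl :- al) :+ r :* ((g :+ g) :* κ :* (bl :- al))
                := (con 1ℚ :- (Sq :+ (g :+ (g :+ g) :* r) :- ai) :* κ) :* al :+ (Sq :+ (g :+ (g :+ g) :* r) :- ai) :* κ :* bl)
                refl (a l) (b l) (S * fromℤ q) g (a i) κ R)
              (cong (λ X → along a b ((X - a i) * κ) l) (sym (height-+ q r)))
            along-axis : along a b t i ≡ X
            along-axis = trans (solve 4 (λ X a b κ → (con 1ℚ :- (X :- a) :* κ) :* a :+ (X :- a) :* κ :* b := a :+ (X :- a) :* ((b :- a) :* κ))
                refl X (a i) (b i) κ)
              (trans (cong (λ p → a i + (X - a i) * p) Lκ) (solve 2 (λ X a → a :+ (X :- a) :* con 1ℚ := X) refl X (a i)))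
            a≤X : a i ≤ X
            a≤X = ≤-trans a≤Sq (≤-add (g + (g + g) * R) (+-nonneg 0≤g (*-nonneg (+-nonneg 0≤g 0≤g) (0≤fromℕ r))) (sym (height-+ q r)))
            X≤b : X ≤ b i
            X≤b = ≤-trans (subst₂ _≤_ (sym (height-+ q r)) (+-assoc (a i) S S) (+-mono-≤ Sq≤a+S (offset≤S r<N))) long
            0≤t : 0ℚ ≤ t
            0≤t = *-nonneg (subst (_≤ X - a i) (+-inverseʳ (a i)) (+-monoˡ-≤ (- a i) a≤X)) (<⇒≤ 0<κ)
            t≤1 : t ≤ 1ℚ
            t≤1 = subst (t ≤_) Lκ (*-monoʳ-≤-nonNeg κ {{nonNegative (<⇒≤ 0<κ)}} (+-monoˡ-≤ (- a i) X≤b))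

      reverse : ∀ a b i → Hit b a i → Hit a b i
      reverse a b i (n , z , t , 0≤t , t≤1 , h) = n , z , 1ℚ - t ,
        subst (_≤ 1ℚ - t) (+-inverseʳ t) (+-monoˡ-≤ (- t) t≤1) ,
        subst (1ℚ - t ≤_) (+-identityʳ 1ℚ) (+-monoʳ-≤ 1ℚ (neg-antimono-≤ 0≤t)) ,
        λ l → subst (λ y → ∣ forestPoint i n z l - y ∣ ≤ radius j)
          (solve 3 (λ t a b → (con 1ℚ :- t) :* b :+ t :* a := (con 1ℚ :- (con 1ℚ :- t)) :* a :+ (con 1ℚ :- t) :* b) refl t (a l) (b l))
          (h l)

      segment-hit : ∀ a b i → S + S ≤ ∣ b i - a i ∣ → Hit a b i
      segment-hit a b i long with ∣p∣≡p∨∣p∣≡-p (b i - a i)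
      ... | inj₁ eq = ascending a b i (subst (a i + (S + S) ≤_)
        (solve 2 (λ a b → a :+ (b :- a) := b) refl (a i) (b i)) (+-monoʳ-≤ (a i) (subst (S + S ≤_) eq long)))
      ... | inj₂ eq = reverse a b i (ascending b a i (subst (b i + (S + S) ≤_)
        (solve 2 (λ a b → b :+ (:- (b :- a)) := a) refl (a i) (b i)) (+-monoʳ-≤ (b i) (subst (S + S ≤_) eq long))))

-- Counting forest points in a box

module Density where

  open import Defs using (module RationalLemmas)
  open RationalLemmas using (fromℕ; 0≤fromℕ)
  open import Data.Nat.Base
  open import Data.Nat.Properties hiding (_≟_)
  open import Data.Nat.DivMod
  open import Data.Nat.Solver using (module +-*-Solver)
  open +-*-Solver using (solve; _:+_; _:*_; _:=_; con)
  open import Data.Integer.Base as ℤ using (ℤ; +_; -[1+_]; _%ℕ_)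
  import Data.Integer.Properties as ℤP
  import Data.Integer.Solver as ℤS
  open import Data.Rational.Base as ℚ using (ℚ; 1ℚ)
  import Data.Rational.Properties as ℚP
  open import Data.Fin.Base using (Fin; zero; suc; punchIn)
  open import Data.Fin.Properties using (injective⇒≤; toℕ<n)
  open import Data.List.Base using (List; []; _∷_; map; length; concatMap; cartesianProductWith; allFin; upTo; applyUpTo; lookup)
  open import Data.List.Properties using (length-++; length-map; length-upTo; length-tabulate)
  open import Data.List.Membership.Propositional using (_∈_)
  open import Data.List.Membership.Propositional.Properties
    using (∈-cartesianProductWith⁺; ∈-allFin; ∈-upTo⁺; ∈-map⁺; ∈-concatMap⁺)
  open import Data.List.Relation.Unary.Any using (index)
  import Data.List.Relation.Unary.Any as Any
  open import Data.List.Relation.Unary.Any.Properties using (lookup-index)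
  open import Data.Vec.Base as Vec using (Vec)
  open import Data.Vec.Functional.Properties using (insertAt-lookup; insertAt-punchIn)
  open import Data.Product using (∃-syntax; _×_; _,_)
  open import Function.Base using (_∘_; id)
  open import Function.Definitions using (Injective)
  open import Relation.Binary.PropositionalEquality hiding (J)
  open UnionBound
  open Cubes
  open Rationals
  open Block using (4^; 4^-nonZero; 0<4^; n<4^n; 4^-suc; module Parameters)
  open Lines
  open Segments

  injective-∈⇒≤ : ∀ {A : Set} {n} (xs : List A) (f : Fin n → A) → Injective _≡_ _≡_ f → (∀ i → f i ∈ xs) → n ≤ length xs
  injective-∈⇒≤ xs f inj f∈ = injective⇒≤ {f = index ∘ f∈} λ {i} {j} eq →
    inj (trans (lookup-index (f∈ i)) (trans (cong (lookup xs) eq) (sym (lookup-index (f∈ j)))))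

  length-concatMap : ∀ {A B : Set} (f : A → List B) (xs : List A) → length (concatMap f xs) ≡ ∑ xs (length ∘ f)
  length-concatMap f []       = refl
  length-concatMap f (x ∷ xs) = trans (length-++ (f x)) (cong (λ n → length (f x) + n) (length-concatMap f xs))

  ∑-applyUpTo : ∀ {A : Set} n (h : ℕ → A) (f : A → ℕ) → ∑ (applyUpTo h n) f ≡ below n (f ∘ h)
  ∑-applyUpTo zero    h f = refl
  ∑-applyUpTo (suc n) h f = cong (λ m → f (h 0) + m) (∑-applyUpTo n (h ∘ suc) f)

  below-mono : ∀ n {f g} → (∀ i → f i ≤ g i) → below n f ≤ below n g
  below-mono zero    h = z≤n
  below-mono (suc n) h = +-mono-≤ (h 0) (below-mono n (h ∘ suc))

  below-*ʳ : ∀ n f c → below n (λ i → f i * c) ≡ below n f * c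
  below-*ʳ zero    f c = refl
  below-*ʳ (suc n) f c = trans (cong (λ m → f 0 * c + m) (below-*ʳ n (f ∘ suc) c)) (sym (*-distribʳ-+ c (f 0) _))

  -- The cleared form of the telescoping sum of 1 / ((s+1)(s+2)) over s < S, which is S / (S+1);
  -- rounding the quotients down only helps.
  telescope : ∀ U S → suc S * below S (λ s → U / (suc s * suc (suc s))) ≤ U * S
  telescope U zero    = z≤n
  telescope U (suc S) = *-cancelˡ-≤ (suc S) (≤-trans
    (≤-reflexive (trans (cong (λ b → suc S * (suc (suc S) * b)) (below-shift S t))
      (solve 3 (λ S b t → (con 1 :+ S) :* ((con 2 :+ S) :* (b :+ t))
        := (con 2 :+ S) :* ((con 1 :+ S) :* b) :+ t :* ((con 1 :+ S) :* (con 2 :+ S))) refl S (below S t) (t S))))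
    (≤-trans (+-mono-≤ (*-monoʳ-≤ (suc (suc S)) (telescope U S)) (m/n*n≤m U (suc S * suc (suc S))))
      (≤-reflexive (solve 2 (λ S U → (con 2 :+ S) :* (U :* S) :+ U := (con 1 :+ S) :* (U :* (con 1 :+ S))) refl S U))))
    where
    t : ℕ → ℕ
    t s = U / (suc s * suc (suc s))

  ∑reciprocals : ∀ U S → below S (λ s → U / (suc s * suc (suc s))) ≤ U
  ∑reciprocals U S = *-cancelˡ-≤ (suc S) (≤-trans (telescope U S)
    (≤-trans (≤-reflexive (*-comm U S)) (*-monoˡ-≤ U (n≤1+n S))))

  interval : ℕ → ℕ → List ℤ
  interval a m = map (λ i → + i ℤ.- + a) (upTo m)

  ∈-interval : ∀ {a m x} i → x ℤ.+ + a ≡ + i → i < m → x ∈ interval a m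
  ∈-interval {a} {m} {x} i eq i<m = subst (_∈ interval a m)
    (trans (cong (ℤ._- + a) (sym eq)) (ℤ-cancel x (+ a)))
    (∈-map⁺ (λ i → + i ℤ.- + a) (∈-upTo⁺ i<m))
    where
    ℤ-cancel : ∀ i j → i ℤ.+ j ℤ.- j ≡ i
    ℤ-cancel = S.solve 2 (λ i j → i S.:+ j S.:- j S.:= i) refl
      where
      module S = ℤS.+-*-Solver

  length-interval : ∀ a m → length (interval a m) ≡ m
  length-interval a m = trans (length-map (λ i → + i ℤ.- + a) (upTo m)) (length-upTo m)

  f<3f : ∀ f → 0 < f → f + f < 3 * f
  f<3f f 0<f = subst (f + f <_) (solve 1 (λ f → f :+ f :+ f := con 3 :* f) refl f) (m<m+n (f + f) 0<f)

  1≤odd : ∀ n → 1 ≤ ℤ.∣ n ℤ.+ n ℤ.+ + 1 ∣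
  1≤odd (+ m)    = m≤n+m 1 (m + m)
  1≤odd -[1+ m ] = s≤s z≤n

  -- The length `3 * f` has no additive constant. A constant would be counted once for each of the
  -- 4^(s+1) blocks of every layer `s` and spoil finite density; here a layer too high for the box
  -- contributes nothing.
  odd-bound : ∀ n f → ℤ.∣ n ℤ.+ n ℤ.+ + 1 ∣ ≤ f → n ∈ interval f (3 * f)
  odd-bound (+ m) f h = ∈-interval (m + f) refl (≤-<-trans (+-monoˡ-≤ f (≤-trans (m≤m+n m (m + 1)) h′))
    (f<3f f (≤-trans (m≤n+m 1 (m + m)) h)))
    where
    h′ : m + (m + 1) ≤ f
    h′ = subst (_≤ f) (+-assoc m m 1) h
  odd-bound -[1+ m ] f h = ∈-interval {f} (f ∸ suc m) (ℤP.⊖-≥ (≤-trans (s≤s (m≤m+n m m)) h))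
    (≤-<-trans (≤-trans (m∸n≤m f (suc m)) (m≤m+n f f)) (f<3f f (≤-trans z<s h)))

  -- Here ω is the digit and z the integer part of a number bounded by U with denominator Q.
  integer-part-bound : ∀ Q ω z U → 0 < Q → ω < Q → ℤ.∣ + ω ℤ.+ z ℤ.* + Q ∣ ≤ U * Q → z ∈ interval (suc U) (2 * U + 2)
  integer-part-bound Q ω (+ m) U 0<Q ω<Q h = ∈-interval (m + suc U) refl
    (subst (m + suc U <_) (solve 1 (λ U → con 1 :+ (U :+ (con 1 :+ U)) := con 2 :* U :+ con 2) refl U) (s≤s (+-monoˡ-≤ (suc U) m≤U)))
    where
    m≤U : m ≤ U
    m≤U = *-cancelʳ-≤ m U Q {{>-nonZero 0<Q}} (≤-trans (m≤n+m (m * Q) ω)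
      (subst (λ i → ℤ.∣ + ω ℤ.+ i ∣ ≤ U * Q) (sym (ℤP.pos-* m Q)) h))
  integer-part-bound Q@(suc _) ω -[1+ m ] U 0<Q ω<Q h = ∈-interval {suc U} (U ∸ m) (ℤP.⊖-≥ (s≤s m≤U))
    (≤-<-trans (m∸n≤m U m) (subst (U <_) (solve 1 (λ U → con 1 :+ (U :+ (con 1 :+ U)) := con 2 :* U :+ con 2) refl U) (s≤s (m≤m+n U (suc U)))))
    where
    ω≤ : ω ≤ suc m * Q
    ω≤ = ≤-trans (<⇒≤ ω<Q) (m≤m+n Q (m * Q))
    m≤U : m ≤ U
    m≤U = *-cancelʳ-≤ m U Q (+-cancelˡ-≤ Q (m * Q) (U * Q) (≤-trans (≤-trans (≤-reflexive (sym (m+[n∸m]≡n ω≤)))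
      (+-mono-≤ (<⇒≤ ω<Q) (≤-reflexive (sym (trans (cong ℤ.∣_∣ (ℤP.⊖-≤ ω≤)) (ℤP.∣-i∣≡∣i∣ (+ (suc m * Q ∸ ω)))))))) (+-monoʳ-≤ Q h)))

  -- Layer s holds 4^(s+1) blocks whose hyperplanes are 2 spacing s apart; the factor
  -- (s+1)(s+2) makes the sum of their densities converge.
  spacing : ℕ → ℕ
  spacing s = 4^ s * (suc s * suc (suc s))

  s<spacing : ∀ s → s < spacing s
  s<spacing s = <-≤-trans (n<4^n s) (m≤m*n (4^ s) (suc s * suc (suc s)))

  0<spacing : ∀ s → 0 < spacing s
  0<spacing s = ≤-<-trans z≤n (s<spacing s)

  instance
    spacing-nonZero : ∀ {s} → NonZero (spacing s)
    spacing-nonZero {s} = >-nonZero (0<spacing s)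

  -- The factor 4^s of the spacing pays for the 4^(s+1) blocks of the layer, and 4 * 3 remains as
  -- the constant 12.
  layer-count : ∀ U s → 4^ (suc s) * (3 * (U / spacing s)) ≤ 12 * (U / (suc s * suc (suc s)))
  layer-count U s = ≤-trans (≤-reflexive (trans (cong₂ (λ a b → a * (3 * b)) (4^-suc s)
      (trans (/-congʳ {n = 4^ s * m} {o = m * 4^ s} (*-comm (4^ s) m)) (sym (m/n/o≡m/[n*o] U m (4^ s)))))
      (solve 2 (λ p t → con 4 :* p :* (con 3 :* t) := con 12 :* (t :* p)) refl (4^ s) (U / m / 4^ s))))
    (*-monoʳ-≤ 12 (m/n*n≤m (U / m) (4^ s)))
    where
    m : ℕ
    m = suc s * suc (suc s)
    instance
      nz₁ : NonZero (4^ s * m)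
      nz₁ = spacing-nonZero {s}
      nz₂ : NonZero (m * 4^ s)
      nz₂ = subst NonZero (*-comm (4^ s) m) nz₁

  module Codes (e c₂ c : ℕ) (θ : ∀ k → ℕ → Parameters.Letter e c₂ (k + c) (4^ (suc k))) where

    -- Layer, block, axis, index of the hyperplane, integer parts.
    Code : Set
    Code = ℕ × (ℕ × Fin (suc e)) × (ℤ × Vec ℤ e)

    module Layer (k : ℕ) = Planes e c₂ (k + c) (4^ (suc k)) (θ k)

    decode : Code → Fin (suc e) → ℚ
    decode (s , (k , i) , (n , z)) = Layer.forestPoint k (spacing s) i n (Vec.lookup z)

    Valid : Code → Set
    Valid (s , (k , _) , _) = k < 4^ (suc s)

    layerCodes : ℕ → ℕ → List Code
    layerCodes U s = map (s ,_) (cartesianProductWith _,_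
      (cartesianProductWith _,_ (upTo (4^ (suc s))) (allFin (suc e)))
      (cartesianProductWith _,_ (interval (U / spacing s) (3 * (U / spacing s))) (vecs (interval (suc U) (2 * U + 2)) e)))

    -- Layers from `U` on lie outside the box, since each height is at least `spacing s`, which
    -- exceeds `s`.
    codes : ℕ → List Code
    codes U = concatMap (layerCodes U) (upTo U)

    length-layerCodes : ∀ U s → length (layerCodes U s) ≡ 4^ (suc s) * (3 * (U / spacing s)) * (suc e * (2 * U + 2) ^ e)
    length-layerCodes U s = trans (length-map (s ,_) (cartesianProductWith _,_ ki nz))
      (trans (length-cartesianProductWith _,_ ki nz)
      (trans (cong₂ _*_
        (trans (length-cartesianProductWith _,_ ks is) (cong₂ _*_ (length-upTo (4^ (suc s))) (length-tabulate {n = suc e} id)))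
        (trans (length-cartesianProductWith _,_ ns zs) (cong₂ _*_ (length-interval f (3 * f))
          (trans (length-vecs (interval (suc U) (2 * U + 2)) e) (cong (_^ e) (length-interval (suc U) (2 * U + 2)))))))
      (solve 4 (λ a b c d → a :* b :* (c :* d) := a :* c :* (b :* d)) refl (4^ (suc s)) (suc e) (3 * f) ((2 * U + 2) ^ e))))
      where
      f : ℕ
      f = U / spacing s
      ks : List ℕ
      ks = upTo (4^ (suc s))
      is : List (Fin (suc e))
      is = allFin (suc e)
      ns : List ℤ
      ns = interval f (3 * f)
      zs : List (Vec ℤ e)
      zs = vecs (interval (suc U) (2 * U + 2)) e
      ki : List (ℕ × Fin (suc e))
      ki = cartesianProductWith _,_ ks is
      nz : List (ℤ × Vec ℤ e)
      nz = cartesianProductWith _,_ ns zs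

    -- 12 comes from `layer-count`, `suc e` from the choice of an axis and 4^e from 2U + 2 ≤ 4U in
    -- the other coordinates.
    density : ℕ
    density = 12 * suc e * 4 ^ e

    length-codes : ∀ U → 0 < U → length (codes U) ≤ density * U ^ suc e
    length-codes U 0<U = begin
      length (codes U)                                         ≡⟨ length-concatMap (layerCodes U) (upTo U) ⟩
      ∑ (upTo U) (length ∘ layerCodes U)                       ≡⟨ ∑-applyUpTo U id (length ∘ layerCodes U) ⟩
      below U (length ∘ layerCodes U)                          ≡⟨ below-cong U (λ s _ → length-layerCodes U s) ⟩
      below U (λ s → 4^ (suc s) * (3 * (U / spacing s)) * C)   ≡⟨ below-*ʳ U (λ s → 4^ (suc s) * (3 * (U / spacing s))) C ⟩
      below U (λ s → 4^ (suc s) * (3 * (U / spacing s))) * C   ≤⟨ *-monoˡ-≤ C (below-mono U (layer-count U)) ⟩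
      below U (λ s → 12 * (U / (suc s * suc (suc s)))) * C
        ≡⟨ cong (_* C) (trans (below-cong U (λ s _ → *-comm 12 (U / (suc s * suc (suc s)))))
             (below-*ʳ U (λ s → U / (suc s * suc (suc s))) 12)) ⟩
      below U (λ s → U / (suc s * suc (suc s))) * 12 * C       ≤⟨ *-monoˡ-≤ C (*-monoˡ-≤ 12 (∑reciprocals U U)) ⟩
      U * 12 * C                                               ≤⟨ *-monoʳ-≤ (U * 12) (*-monoʳ-≤ (suc e) (^-monoˡ-≤ e 2U+2≤4U)) ⟩
      U * 12 * (suc e * (4 * U) ^ e)                           ≡⟨ cong (λ p → U * 12 * (suc e * p)) (^-distribʳ-* e 4 U) ⟩
      U * 12 * (suc e * (4 ^ e * U ^ e))
        ≡⟨ solve 4 (λ U d p q → U :* con 12 :* (d :* (p :* q)) := con 12 :* d :* p :* (U :* q)) refl U (suc e) (4 ^ e) (U ^ e) ⟩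
      density * U ^ suc e                                      ∎
      where
      open ≤-Reasoning
      C : ℕ
      C = suc e * (2 * U + 2) ^ e
      2U+2≤4U : 2 * U + 2 ≤ 4 * U
      2U+2≤4U = ≤-trans (+-monoʳ-≤ (2 * U) (*-monoʳ-≤ 2 0<U)) (≤-reflexive (solve 1 (λ U → con 2 :* U :+ con 2 :* U := con 4 :* U) refl U))

    scaled-bound : ∀ i g U → ℚ.∣ fromℤ i ℚ.* fromℕ g ∣ ℚ.≤ fromℕ U → ℤ.∣ i ∣ * g ≤ U
    scaled-bound i g U h = ℤP.drop‿+≤+ (fromℤ-cancel-≤ (subst (ℚ._≤ fromℕ U)
      (trans (ℚP.∣p*q∣≡∣p∣*∣q∣ (fromℤ i) (fromℕ g)) (sym (fromℕ-* ℤ.∣ i ∣ g))) h))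

    numerator-bound : ∀ i q U .{{_ : NonZero q}} → ℚ.∣ fromℤ i ℚ.* recipℕ q ∣ ℚ.≤ fromℕ U → ℤ.∣ i ∣ ≤ U * q
    numerator-bound i q U h = ℤP.drop‿+≤+ (fromℤ-cancel-≤ (subst₂ ℚ._≤_
      (trans (trans (cong (ℚ.∣ x ∣ ℚ.*_) (sym (ℚP.0≤p⇒∣p∣≡p (0≤fromℕ q)))) (sym (ℚP.∣p*q∣≡∣p∣*∣q∣ x (fromℕ q))))
        (cong ℚ.∣_∣ (trans (ℚP.*-assoc (fromℤ i) (recipℕ q) (fromℕ q))
          (trans (cong (fromℤ i ℚ.*_) (trans (ℚP.*-comm (recipℕ q) (fromℕ q)) (recipℕ-inverse q))) (ℚP.*-identityʳ (fromℤ i))))))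
      (sym (fromℕ-* U q))
      (ℚP.*-monoʳ-≤-nonNeg (fromℕ q) {{ℚ.nonNegative (0≤fromℕ q)}} h)))
      where
      x : ℚ
      x = fromℤ i ℚ.* recipℕ q

    ∈-codes : ∀ U γ → Valid γ → (∀ l → ℚ.∣ decode γ l ∣ ℚ.≤ fromℕ U) → γ ∈ codes U
    ∈-codes U γ@(s , (k , i) , (n , z)) k< bounded = ∈-concatMap⁺ (layerCodes U)
      (Any.map (λ { refl → ∈-map⁺ (s ,_) (∈-cartesianProductWith⁺ _,_
        (∈-cartesianProductWith⁺ _,_ (∈-upTo⁺ k<) (∈-allFin i))
        (∈-cartesianProductWith⁺ _,_ (odd-bound n (U / G) odd≤)
          (∈-vecs (interval (suc U) (2 * U + 2)) z z∈))) })
        (∈-upTo⁺ s<U))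
      where
      open Layer k (spacing s)
      open Parameters e c₂ (k + c) (4^ (suc k))
      open Hitting e c₂ (k + c) (4^ (suc k)) (θ k) using (coordinate; digit)
      G : ℕ
      G = spacing s
      height≤ : ℤ.∣ n ℤ.+ n ℤ.+ + 1 ∣ * G ≤ U
      height≤ = scaled-bound (n ℤ.+ n ℤ.+ + 1) G U (subst (λ q → ℚ.∣ q ∣ ℚ.≤ fromℕ U)
        (insertAt-lookup (λ l → coordinate n (Vec.lookup z l) l) i (height n)) (bounded i))
      odd≤ : ℤ.∣ n ℤ.+ n ℤ.+ + 1 ∣ ≤ U / G
      odd≤ = ≤-trans (≤-reflexive (sym (m*n/n≡m _ G))) (/-monoˡ-≤ G height≤)
      s<U : s < U
      s<U = <-≤-trans (s<spacing s) (≤-trans (m≤n*m G ℤ.∣ n ℤ.+ n ℤ.+ + 1 ∣ {{>-nonZero (1≤odd n)}}) height≤)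
      z∈ : ∀ l → Vec.lookup z l ∈ interval (suc U) (2 * U + 2)
      z∈ l = integer-part-bound Q (digit n l) (Vec.lookup z l) U (0<4^ (4^ (suc k) + c₂ + (cells (4^ (suc k)) + (k + c))))
        (toℕ<n (Vec.lookup (θ k (n %ℕ P)) l))
        (numerator-bound (+ digit n l ℤ.+ Vec.lookup z l ℤ.* + Q) Q U (subst (λ q → ℚ.∣ q ∣ ℚ.≤ fromℕ U)
          (insertAt-punchIn (λ l → coordinate n (Vec.lookup z l) l) i (height n) l) (bounded (punchIn i l))))

    point-count : ∀ {K} U → 0 < U → (γ : Fin K → Code) → Injective _≡_ _≡_ γ → (∀ x → Valid (γ x)) →
      (∀ x l → ℚ.∣ decode (γ x) l ∣ ℚ.≤ fromℕ U) → K ≤ density * U ^ suc e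
    point-count U 0<U γ inj valid bounded = ≤-trans
      (injective-∈⇒≤ (codes U) γ inj (λ x → ∈-codes U (γ x) (valid x) (bounded x)))
      (length-codes U 0<U)

    -- The forest avoids a neighbourhood of the origin; otherwise C T^d could not bound the count
    -- for small T.
    1≤decode : ∀ γ → ∃[ l ] 1ℚ ℚ.≤ ℚ.∣ decode γ l ∣
    1≤decode (s , (k , i) , (n , z)) = i , subst (λ q → 1ℚ ℚ.≤ ℚ.∣ q ∣)
      (sym (insertAt-lookup (λ l → coordinate n (Vec.lookup z l) l) i (height n)))
      (subst (1ℚ ℚ.≤_) (trans (fromℕ-* ℤ.∣ n ℤ.+ n ℤ.+ + 1 ∣ (spacing s)) (sym (ℚP.∣p*q∣≡∣p∣*∣q∣ (fromℤ (n ℤ.+ n ℤ.+ + 1)) (fromℕ (spacing s)))))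
        (fromℕ-mono (*-mono-≤ (1≤odd n) (0<spacing s))))
      where
      open Layer k (spacing s)
      open Hitting e c₂ (k + c) (4^ (suc k)) (θ k) using (coordinate)

-- Euler powers at a finite stage and their inversion

module EulerFacts where

  open import Defs using (module RationalLemmas)
  open RationalLemmas hiding (2ℚ)
  open import Algebra.Bundles using (module CommutativeRing)
  import Algebra.Properties.CommutativeSemiring.Exp as CExp
  open import Data.Nat.Base as ℕ using (ℕ; zero; suc)
  import Data.Nat.Properties as ℕP
  open import Data.Rational.Base hiding (_/_)
  open import Data.Rational.Properties
  open import Data.Rational.Solver using (module +-*-Solver)
  open +-*-Solver using (solve; _:+_; _:*_; _:-_; :-_; _:=_; con)
  open import Data.Product using (∃; _×_; _,_; proj₁; proj₂)
  open import Relation.Nullary using (yes; no)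
  open import Relation.Binary.PropositionalEquality
  open Rationals using (≤-add)
  open CExp (CommutativeRing.commutativeSemiring +-*-commutativeRing) using (^-distrib-*)

  2^ : ℕ → ℕ
  2^ n = 2 ℕ.^ n

  0≤½^ : ∀ n → 0ℚ ≤ ½ ^ n
  0≤½^ n = ^-nonneg n 0≤½

  2^*½^*x : ∀ n x → fromℕ (2^ n) * (x * ½ ^ n) ≡ x
  2^*½^*x n x = trans (solve 3 (λ k x h → k :* (x :* h) := k :* h :* x) refl (fromℕ (2^ n)) x (½ ^ n))
    (trans (cong (_* x) (2^*½^ n)) (*-identityˡ x))

  -- Bernoulli's inequality at a base `b` ≥ 1, where the slope k b^(k-1) of the power is at least k.
  tangent : ∀ b t k → 1ℚ ≤ b → 0ℚ ≤ t → b ^ k + fromℕ k * t ≤ (b + t) ^ k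
  tangent b t zero    1≤b 0≤t = ≤-reflexive (solve 1 (λ t → con 1ℚ :+ con 0ℚ :* t := con 1ℚ) refl t)
  tangent b t (suc k) 1≤b 0≤t = ≤-trans
    (≤-trans (+-monoʳ-≤ (b * b ^ k) (subst (λ n → n * t ≤ t * b ^ k + fromℕ k * t * (b + t)) (sym (fromℕ-suc k)) grow))
      (≤-reflexive (solve 4 (λ b t p n → b :* p :+ (t :* p :+ n :* t :* (b :+ t)) := (b :+ t) :* (p :+ n :* t)) refl b t (b ^ k) (fromℕ k))))
    (*-monoˡ-≤-nonNeg (b + t) {{nonNegative (+-nonneg (≤-trans 0≤1 1≤b) 0≤t)}} (tangent b t k 1≤b 0≤t))
    where
    grow : (1ℚ + fromℕ k) * t ≤ t * b ^ k + fromℕ k * t * (b + t)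
    grow = subst (_≤ t * b ^ k + fromℕ k * t * (b + t))
      (solve 2 (λ n t → t :* con 1ℚ :+ n :* t :* con 1ℚ := (con 1ℚ :+ n) :* t) refl (fromℕ k) t)
      (+-mono-≤ (*-monoˡ-≤-nonNeg t {{nonNegative 0≤t}} (1≤^ k 1≤b))
        (*-monoˡ-≤-nonNeg (fromℕ k * t) {{nonNegative (*-nonneg (0≤fromℕ k) 0≤t)}}
          (≤-trans 1≤b (≤-add t 0≤t refl))))

  -- On nonnegative arguments the slope of `euler n` is at least 1. Its inverse therefore never
  -- enlarges distances, which is what makes the logarithms a Cauchy sequence.
  euler-expands : ∀ n {x y} → 0ℚ ≤ y → y ≤ x → euler n y + (x - y) ≤ euler n x
  euler-expands n {x} {y} 0≤y y≤x = subst₂ (λ u v → euler n y + u ≤ v ^ (2^ n))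
    (2^*½^*x n (x - y))
    (solve 3 (λ x y h → con 1ℚ :+ y :* h :+ (x :- y) :* h := con 1ℚ :+ x :* h) refl x y (½ ^ n))
    (tangent (1ℚ + y * ½ ^ n) ((x - y) * ½ ^ n) (2^ n)
      (≤-add (y * ½ ^ n) (*-nonneg 0≤y (0≤½^ n)) refl)
      (*-nonneg (subst (_≤ x - y) (+-inverseʳ y) (+-monoˡ-≤ (- y) y≤x)) (0≤½^ n)))

  euler-0 : ∀ n → euler n 0ℚ ≡ 1ℚ
  euler-0 n = trans (cong (λ p → (1ℚ + p) ^ (2^ n)) (*-zeroˡ (½ ^ n))) (one (2^ n))
    where
    one : ∀ k → (1ℚ + 0ℚ) ^ k ≡ 1ℚ
    one zero    = refl
    one (suc k) = trans (*-identityˡ _) (one k)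

  1+x≤euler : ∀ n {x} → 0ℚ ≤ x → 1ℚ + x ≤ euler n x
  1+x≤euler n {x} 0≤x = subst (_≤ euler n x) (trans (cong (_+ (x - 0ℚ)) (euler-0 n)) (solve 1 (λ x → con 1ℚ :+ (x :- con 0ℚ) := con 1ℚ :+ x) refl x))
    (euler-expands n ≤-refl 0≤x)

  euler-mono : ∀ n {x y} → 0ℚ ≤ y → y ≤ x → euler n y ≤ euler n x
  euler-mono n {x} {y} 0≤y y≤x = ^-mono (2^ n) (+-nonneg 0≤1 (*-nonneg 0≤y (0≤½^ n)))
    (+-monoʳ-≤ 1ℚ (*-monoʳ-≤-nonNeg (½ ^ n) {{nonNegative (0≤½^ n)}} y≤x))

  -- (1 + x/2ⁿ⁺¹)^(2ⁿ⁺¹) is the square of (1 + (x/2)/2ⁿ)^(2ⁿ)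
  euler-square : ∀ n {x} → 0ℚ ≤ x → (1ℚ + ½ * x) * (1ℚ + ½ * x) ≤ euler (suc n) x
  euler-square n {x} 0≤x = subst ((1ℚ + ½ * x) * (1ℚ + ½ * x) ≤_)
    (trans (cong (λ p → p * p) (cong (λ t → (1ℚ + t) ^ (2^ n)) (solve 2 (λ x h → con ½ :* x :* h := x :* (con ½ :* h)) refl x (½ ^ n))))
      (trans (sym (^-homo-* w (2^ n) (2^ n))) (cong (λ k → w ^ (2^ n ℕ.+ k)) (sym (ℕP.+-identityʳ (2^ n))))))
    (*-mono 0≤1+½x (≤-trans 0≤1+½x (1+x≤euler n (*-nonneg 0≤½ 0≤x))) (1+x≤euler n (*-nonneg 0≤½ 0≤x)) (1+x≤euler n (*-nonneg 0≤½ 0≤x)))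
    where
    w : ℚ
    w = 1ℚ + x * ½ ^ suc n
    0≤1+½x : 0ℚ ≤ 1ℚ + ½ * x
    0≤1+½x = +-nonneg 0≤1 (*-nonneg 0≤½ 0≤x)

  ∣x∣≤b⇒nonneg : ∀ {x b} → ∣ x ∣ ≤ b → 0ℚ ≤ b
  ∣x∣≤b⇒nonneg {x} h = ≤-trans (0≤∣p∣ x) h

  -- With h = 1/2^n, the bases 1 + (x+y)h and (1+xh)(1+yh) differ by xy h², at most b² h². Raising
  -- to the power 2^n multiplies this by at most 2^n K², and one factor h survives.
  euler-homo : ∀ {b} (0≤b : 0ℚ ≤ b) n {x y} → Euler.N₀ 0≤b ℕ.≤ n → ∣ x ∣ ≤ b → ∣ y ∣ ≤ b →
    ∣ euler n (x + y) - euler n x * euler n y ∣ ≤ Euler.K 0≤b * Euler.K 0≤b * (b * b) * ½ ^ n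
  euler-homo {b} 0≤b n {x} {y} N₀≤n hx hy = ≤-trans
    (subst (λ p → ∣ euler n (x + y) - p ∣ ≤ (fromℕ (2^ n) * M ^ (2^ n)) * D)
      (^-distrib-* (1ℚ + x * h) (1ℚ + y * h) (2^ n))
      (^-diff (1ℚ + (x + y) * h) ((1ℚ + x * h) * (1ℚ + y * h)) (2^ n) 1≤M ∣X∣≤M ∣Y∣≤M close))
    (subst (_≤ K * K * (b * b) * h)
      (trans (sym (*-identityˡ (euler n b * euler n b * (b * b) * h)))
        (trans (cong (_* (euler n b * euler n b * (b * b) * h)) (sym (2^*½^ n)))
          (trans (solve 4 (λ E b h k → (k :* h) :* (E :* E :* (b :* b) :* h) := k :* (E :* E) :* (b :* b :* (h :* h))) refl (euler n b) b h (fromℕ (2^ n)))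
            (cong (λ p → fromℕ (2^ n) * p * D) (sym (^-distrib-* w w (2^ n)))))))
      (*-monoʳ-≤-nonNeg h {{nonNegative (0≤½^ n)}} (*-monoʳ-≤-nonNeg (b * b) {{nonNegative (*-nonneg 0≤b 0≤b)}}
        (*-mono 0≤E (<⇒≤ 0<K) (≤K n N₀≤n) (≤K n N₀≤n)))))
    where
    open Euler 0≤b using (K; 0<K; ≤K; ∣1+∣; 1≤1+)
    h w M D : ℚ
    h = ½ ^ n
    w = 1ℚ + b * h
    M = w * w
    D = b * b * (h * h)
    0≤w : 0ℚ ≤ w
    0≤w = ≤-trans 0≤1 (1≤1+ n)
    0≤E : 0ℚ ≤ euler n b
    0≤E = ^-nonneg (2^ n) 0≤w
    1≤M : 1ℚ ≤ M
    1≤M = *-mono 0≤1 0≤w (1≤1+ n) (1≤1+ n)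
    ∣X∣≤M : ∣ 1ℚ + (x + y) * h ∣ ≤ M
    ∣X∣≤M = ≤-trans (subst (∣ 1ℚ + (x + y) * h ∣ ≤_) (+-assoc 1ℚ (b * h) (b * h)) (subst (λ t → ∣ t ∣ ≤ w + b * h)
        (solve 3 (λ x y h → con 1ℚ :+ x :* h :+ y :* h := con 1ℚ :+ (x :+ y) :* h) refl x y h)
        (≤-trans (∣p+q∣≤∣p∣+∣q∣ (1ℚ + x * h) (y * h)) (+-mono-≤ (∣1+∣ n hx)
          (subst (_≤ b * h) (trans (cong (∣ y ∣ *_) (sym (0≤p⇒∣p∣≡p (0≤½^ n)))) (sym (∣p*q∣≡∣p∣*∣q∣ y h)))
            (*-monoʳ-≤-nonNeg h {{nonNegative (0≤½^ n)}} hy))))))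
      (≤-add ((b * h) * (b * h)) (*-nonneg (*-nonneg 0≤b (0≤½^ n)) (*-nonneg 0≤b (0≤½^ n)))
        (solve 2 (λ b h → con 1ℚ :+ (b :* h :+ b :* h) :+ (b :* h) :* (b :* h) := (con 1ℚ :+ b :* h) :* (con 1ℚ :+ b :* h)) refl b h))
    ∣Y∣≤M : ∣ (1ℚ + x * h) * (1ℚ + y * h) ∣ ≤ M
    ∣Y∣≤M = subst (_≤ M) (sym (∣p*q∣≡∣p∣*∣q∣ (1ℚ + x * h) (1ℚ + y * h)))
      (*-mono (0≤∣p∣ (1ℚ + x * h)) 0≤w (∣1+∣ n hx) (∣1+∣ n hy))
    close : ∣ (1ℚ + (x + y) * h) - (1ℚ + x * h) * (1ℚ + y * h) ∣ ≤ D
    close = subst (_≤ D)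
      (trans (cong₂ _*_ (sym (∣p*q∣≡∣p∣*∣q∣ x y)) (sym (0≤p⇒∣p∣≡p (*-nonneg (0≤½^ n) (0≤½^ n)))))
        (trans (sym (∣p*q∣≡∣p∣*∣q∣ (x * y) (h * h))) (trans (sym (∣-p∣≡∣p∣ (x * y * (h * h))))
          (cong ∣_∣ (solve 3 (λ x y h → :- (x :* y :* (h :* h)) := (con 1ℚ :+ (x :+ y) :* h) :- (con 1ℚ :+ x :* h) :* (con 1ℚ :+ y :* h)) refl x y h)))))
      (*-monoʳ-≤-nonNeg (h * h) {{nonNegative (*-nonneg (0≤½^ n) (0≤½^ n))}} (*-mono (0≤∣p∣ x) 0≤b hx hy))

  digitStep : (ℚ → ℚ) → ℚ → ℚ → ℚ → ℚ
  digitStep f q h s with f (s + h) ≤? q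
  ... | yes _ = s + h
  ... | no  _ = s

  -- Solves f s = q on [0, q] by binary digits.
  bisect : (ℚ → ℚ) → ℚ → ℕ → ℚ
  bisect f q zero    = 0ℚ
  bisect f q (suc n) = digitStep f q (q * ½ ^ suc n) (bisect f q n)

  Bracket : (ℚ → ℚ) → ℚ → ℚ → ℚ → Set
  Bracket f q h s = 0ℚ ≤ s × f s ≤ q × q ≤ f (s + h)

  digitStep-bracket : ∀ f q h s → 0ℚ ≤ h → Bracket f q (h + h) s → Bracket f q h (digitStep f q h s)
  digitStep-bracket f q h s 0≤h (0≤s , lo , hi) with f (s + h) ≤? q
  ... | yes p = +-nonneg 0≤s 0≤h , p , subst (λ t → q ≤ f t) (sym (+-assoc s h h)) hi
  ... | no ¬p = 0≤s , lo , <⇒≤ (≰⇒> ¬p)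

  bisect-bracket : ∀ f q → 0ℚ ≤ q → f 0ℚ ≤ q → q ≤ f q → ∀ n → Bracket f q (q * ½ ^ n) (bisect f q n)
  bisect-bracket f q 0≤q lo hi zero    = ≤-refl , lo ,
    subst (λ t → q ≤ f t) (solve 1 (λ q → q := con 0ℚ :+ q :* con 1ℚ) refl q) hi
  bisect-bracket f q 0≤q lo hi (suc n) = digitStep-bracket f q (q * ½ ^ suc n) (bisect f q n) (*-nonneg 0≤q (0≤½^ (suc n)))
    (subst (λ h → Bracket f q h (bisect f q n)) (solve 2 (λ q h → q :* h := q :* (con ½ :* h) :+ q :* (con ½ :* h)) refl q (½ ^ n))
      (bisect-bracket f q 0≤q lo hi n))

  -- Both the number of digits and the function being inverted depend on `n`. The cut at 1 keeps the
  -- root nonnegative, where `euler n` expands.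
  log : ℕ → ℚ → ℚ
  log n q = bisect (euler n) (q ⊔ 1ℚ) n

  log-bracket : ∀ n q → Bracket (euler n) (q ⊔ 1ℚ) ((q ⊔ 1ℚ) * ½ ^ n) (log n q)
  log-bracket n q = bisect-bracket (euler n) p 0≤p (subst (_≤ p) (sym (euler-0 n)) 1≤p)
    (≤-trans (≤-add 1ℚ 0≤1 (+-comm p 1ℚ)) (1+x≤euler n 0≤p)) n
    where
    p : ℚ
    p = q ⊔ 1ℚ
    1≤p : 1ℚ ≤ p
    1≤p = p≤q⊔p q 1ℚ
    0≤p : 0ℚ ≤ p
    0≤p = ≤-trans 0≤1 1≤p

  0≤log : ∀ n q → 0ℚ ≤ log n q
  0≤log n q = proj₁ (log-bracket n q)

  log≤ : ∀ n q → log n q ≤ q ⊔ 1ℚ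
  log≤ n q = ≤-trans (≤-add 1ℚ 0≤1 (+-comm (log n q) 1ℚ)) (≤-trans (1+x≤euler n (0≤log n q)) (proj₁ (proj₂ (log-bracket n q))))

  euler-reflect : ∀ n {x y δ} → 0ℚ ≤ x → 0ℚ ≤ y → 0ℚ ≤ δ → euler n x ≤ euler n y + δ → x ≤ y + δ
  euler-reflect n {x} {y} {δ} 0≤x 0≤y 0≤δ h with y ≤? x
  ... | no ¬p = ≤-trans (<⇒≤ (≰⇒> ¬p)) (≤-add δ 0≤δ refl)
  ... | yes p = subst₂ _≤_ (cancel (euler n y) x y) (cancel′ (euler n y) y δ)
    (+-monoʳ-≤ (y - euler n y) (≤-trans (euler-expands n 0≤y p) h))
    where
    cancel : ∀ e x y → (y - e) + (e + (x - y)) ≡ x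
    cancel = solve 3 (λ e x y → (y :- e) :+ (e :+ (x :- y)) := x) refl
    cancel′ : ∀ e y δ → (y - e) + (e + δ) ≡ y + δ
    cancel′ = solve 3 (λ e y δ → (y :- e) :+ (e :+ δ) := y :+ δ) refl

  euler-distance : ∀ n {x y δ} → 0ℚ ≤ x → 0ℚ ≤ y → ∣ euler n x - euler n y ∣ ≤ δ → ∣ x - y ∣ ≤ δ
  euler-distance n {x} {y} {δ} 0≤x 0≤y h = abs-≤
    (euler-reflect n 0≤x 0≤y 0≤δ (abs-≤⁻ (euler n x) (euler n y) h))
    (euler-reflect n 0≤y 0≤x 0≤δ (abs-≤⁻ (euler n y) (euler n x) (subst (_≤ δ) (∣p-q∣≡∣q-p∣ (euler n x) (euler n y)) h)))
    where
    0≤δ : 0ℚ ≤ δ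
    0≤δ = ∣x∣≤b⇒nonneg {euler n x - euler n y} h

  module LogError {b : ℚ} (0≤b : 0ℚ ≤ b) where

    0≤2b : 0ℚ ≤ b + b
    0≤2b = +-nonneg 0≤b 0≤b

    open Euler 0≤2b public using (N₀; K; 0<K; C; 0≤C; lipschitz; tail)

    log≤b : ∀ n q → q ⊔ 1ℚ ≤ b → ∣ log n q ∣ ≤ b + b
    log≤b n q h = subst (_≤ b + b) (sym (0≤p⇒∣p∣≡p (0≤log n q))) (≤-trans (log≤ n q) (≤-trans h (≤-add b 0≤b refl)))

    -- After `n` digits the bracket has width at most b / 2^n, and `euler n` has Lipschitz constant
    -- `K` on the range concerned. The bound b + b leaves room for the upper end of the bracket.
    euler-log : ∀ n q → N₀ ℕ.≤ n → q ⊔ 1ℚ ≤ b → ∣ euler n (log n q) - (q ⊔ 1ℚ) ∣ ≤ K * b * ½ ^ n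
    euler-log n q N₀≤n h = ≤-trans (abs-≤
        (≤-trans lo (≤-add gap (0≤∣p∣ _) refl))
        (≤-trans hi (abs-≤⁻ (euler n (s + w)) (euler n s) ≤-refl)))
      (≤-trans (lipschitz n N₀≤n ∣s+w∣≤2b (log≤b n q h) (≤-reflexive (trans
          (cong ∣_∣ (solve 2 (λ s w → s :+ w :- s := w) refl s w)) (0≤p⇒∣p∣≡p 0≤w))))
        (≤-trans (*-monoˡ-≤-nonNeg K {{nonNegative (<⇒≤ 0<K)}} w≤) (≤-reflexive (sym (*-assoc K b (½ ^ n))))))
      where
      s w gap : ℚ
      s = log n q
      w = (q ⊔ 1ℚ) * ½ ^ n
      gap = ∣ euler n (s + w) - euler n s ∣
      lo : euler n s ≤ q ⊔ 1ℚ
      lo = proj₁ (proj₂ (log-bracket n q))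
      hi : q ⊔ 1ℚ ≤ euler n (s + w)
      hi = proj₂ (proj₂ (log-bracket n q))
      0≤p : 0ℚ ≤ q ⊔ 1ℚ
      0≤p = ≤-trans 0≤1 (p≤q⊔p q 1ℚ)
      0≤w : 0ℚ ≤ w
      0≤w = *-nonneg 0≤p (0≤½^ n)
      w≤ : w ≤ b * ½ ^ n
      w≤ = *-monoʳ-≤-nonNeg (½ ^ n) {{nonNegative (0≤½^ n)}} h
      w≤b : w ≤ b
      w≤b = ≤-trans w≤ (subst (b * ½ ^ n ≤_) (*-identityʳ b) (*-monoˡ-≤-nonNeg b {{nonNegative 0≤b}} (½^-anti {0} {n} ℕ.z≤n)))
      ∣s+w∣≤2b : ∣ s + w ∣ ≤ b + b
      ∣s+w∣≤2b = subst (_≤ b + b) (sym (0≤p⇒∣p∣≡p (+-nonneg (0≤log n q) 0≤w))) (+-mono-≤ (≤-trans (log≤ n q) h) w≤b)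

  -- Distances of logarithms are bounded by distances of their images under one fixed `euler M`.
  -- There `tail` passes from stage n to stage M, and `euler-log` leads back to the terms of `x`.
  log-cauchy : ∀ {x} → Cauchy x → Cauchy (λ n → log n (x n))
  log-cauchy {x} cx δ 0<δ = from (cauchy⇒bounded (⊔-cauchy 1ℚ {x} cx))
    where
    from : Bounded (λ n → x n ⊔ 1ℚ) → ∃ λ N → ∀ m n → N ℕ.≤ m → N ℕ.≤ n → ∣ log m (x m) - log n (x n) ∣ ≤ δ
    from (N₁ , b , 0<b , hb) = choose (vanishes E 0≤E (half-pos (half-pos 0<δ))) (⊔-cauchy 1ℚ {x} cx (½ * δ) (half-pos 0<δ))
      where
      open LogError (<⇒≤ 0<b)
      E : ℚ
      E = C + K * b
      0≤E : 0ℚ ≤ E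
      0≤E = +-nonneg 0≤C (*-nonneg (<⇒≤ 0<K) (<⇒≤ 0<b))
      choose : (∃ λ N → ∀ n → N ℕ.≤ n → E * ½ ^ n ≤ ½ * (½ * δ)) →
               (∃ λ N → ∀ m n → N ℕ.≤ m → N ℕ.≤ n → ∣ (x m ⊔ 1ℚ) - (x n ⊔ 1ℚ) ∣ ≤ ½ * δ) → _
      choose (N₂ , small) (N₃ , h) = M , λ m n p q → euler-distance M (0≤log m (x m)) (0≤log n (x n))
        (subst (∣ euler M (log m (x m)) - euler M (log n (x n)) ∣ ≤_) (eq δ)
          (triangle (euler M (log m (x m))) (x m ⊔ 1ℚ) (euler M (log n (x n))) (near m p)
            (triangle (x m ⊔ 1ℚ) (x n ⊔ 1ℚ) (euler M (log n (x n))) (h m n (≤₃ p) (≤₃ q))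
              (subst (_≤ ½ * (½ * δ)) (∣p-q∣≡∣q-p∣ (euler M (log n (x n))) (x n ⊔ 1ℚ)) (near n q)))))
        where
        M : ℕ
        M = (N₁ ℕ.⊔ N₂) ℕ.⊔ (N₃ ℕ.⊔ N₀)
        ≤₁ : ∀ {n} → M ℕ.≤ n → N₁ ℕ.≤ n
        ≤₁ p = ⊔-≤ˡ N₁ N₂ (⊔-≤ˡ (N₁ ℕ.⊔ N₂) (N₃ ℕ.⊔ N₀) p)
        ≤₃ : ∀ {n} → M ℕ.≤ n → N₃ ℕ.≤ n
        ≤₃ p = ⊔-≤ˡ N₃ N₀ (⊔-≤ʳ (N₁ ℕ.⊔ N₂) (N₃ ℕ.⊔ N₀) p)
        N₂≤M : N₂ ℕ.≤ M
        N₂≤M = ⊔-≤ʳ N₁ N₂ (⊔-≤ˡ (N₁ ℕ.⊔ N₂) (N₃ ℕ.⊔ N₀) ℕP.≤-refl)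
        N₀≤M : N₀ ℕ.≤ M
        N₀≤M = ⊔-≤ʳ N₃ N₀ (⊔-≤ʳ (N₁ ℕ.⊔ N₂) (N₃ ℕ.⊔ N₀) ℕP.≤-refl)
        near : ∀ n → M ℕ.≤ n → ∣ euler M (log n (x n)) - (x n ⊔ 1ℚ) ∣ ≤ ½ * (½ * δ)
        near n p = ≤-trans (triangle (euler M (log n (x n))) (euler n (log n (x n))) (x n ⊔ 1ℚ)
            (subst (_≤ C * ½ ^ M) (∣p-q∣≡∣q-p∣ (euler n (log n (x n))) (euler M (log n (x n)))) (tail N₀≤M p (log≤b n (x n) h′)))
            (≤-trans (euler-log n (x n) (ℕP.≤-trans N₀≤M p) h′)
              (*-monoˡ-≤-nonNeg (K * b) {{nonNegative (*-nonneg (<⇒≤ 0<K) (<⇒≤ 0<b))}} (½^-anti p))))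
          (subst (_≤ ½ * (½ * δ)) (*-distribʳ-+ (½ ^ M) C (K * b)) (small M N₂≤M))
          where
          h′ : x n ⊔ 1ℚ ≤ b
          h′ = ≤-trans (p≤∣p∣ (x n ⊔ 1ℚ)) (hb n (≤₁ p))
        eq : ∀ δ → ½ * (½ * δ) + (½ * δ + ½ * (½ * δ)) ≡ δ
        eq = solve 1 (λ δ → con ½ :* (con ½ :* δ) :+ (con ½ :* δ :+ con ½ :* (con ½ :* δ)) := δ) refl

-- Order and multiplication of Cauchy reals

module Reals where

  open import Defs
  private
    module R = RationalLemmas
  open R using (+-nonneg; half-pos; half-sum; abs-≤⁻; p≤∣p∣; ∣p-q∣≡∣q-p∣; quotient; cauchy⇒bounded)
  open import Data.Nat.Base as ℕ using (ℕ; zero; suc)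
  import Data.Nat.Properties as ℕP
  open import Data.Rational.Base as ℚ using (ℚ; 0ℚ; 1ℚ; ½)
  import Data.Rational.Properties as ℚP
  open import Data.Rational.Solver using (module +-*-Solver)
  open +-*-Solver using (solve; _:+_; _:*_; _:-_; :-_; _:=_; con)
  open import Data.Product using (∃-syntax; Σ-syntax; _×_; _,_)
  open import Data.Sum.Base using (inj₁; inj₂)
  open import Relation.Binary.PropositionalEquality
  open Rationals using (≤-add)
  open EulerFacts

  Eventually : (ℕ → Set) → Set
  Eventually P = ∃[ N ] ∀ n → N ℕ.≤ n → P n

  always : ∀ {P : ℕ → Set} → (∀ n → P n) → Eventually P
  always h = 0 , λ n _ → h n

  ev-map : ∀ {P Q : ℕ → Set} → (∀ n → P n → Q n) → Eventually P → Eventually Q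
  ev-map f (N , h) = N , λ n p → f n (h n p)

  infixr 4 _⊓ᵉ_

  _⊓ᵉ_ : ∀ {P Q : ℕ → Set} → Eventually P → Eventually Q → Eventually (λ n → P n × Q n)
  (N , h) ⊓ᵉ (M , k) = N ℕ.⊔ M , λ n p → h n (ℕP.m⊔n≤o⇒m≤o N M p) , k n (ℕP.m⊔n≤o⇒n≤o N M p)

  slack : ∀ {p q δ} → 0ℚ ℚ.≤ δ → p ℚ.≤ q → p ℚ.≤ q ℚ.+ δ
  slack {δ = δ} 0≤δ h = ℚP.≤-trans h (≤-add δ 0≤δ refl)

  ev≤ : ∀ {x y} → Eventually (λ n → seq x n ℚ.≤ seq y n) → x ≤ y
  ev≤ h δ 0<δ = ev-map (λ n → slack (ℚP.<⇒≤ 0<δ)) h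

  ev≈ : ∀ {x y} → Eventually (λ n → seq x n ≡ seq y n) → x ≈ y
  ev≈ {x} {y} h δ 0<δ = ev-map (λ n e → subst (ℚ._≤ δ) (sym (cong ℚ.∣_∣ (trans (cong (ℚ._- seq y n) e) (ℚP.+-inverseʳ (seq y n))))) (ℚP.<⇒≤ 0<δ)) h

  ≤-refl : ∀ {x} → x ≤ x
  ≤-refl {x} = ev≤ {x} {x} (always λ n → ℚP.≤-refl)

  ≤-trans : ∀ {x y z} → x ≤ y → y ≤ z → x ≤ z
  ≤-trans {x} {y} {z} h k δ 0<δ = ev-map
    (λ n (p , q) → ℚP.≤-trans p (subst (seq y n ℚ.+ ½ ℚ.* δ ℚ.≤_)
      (trans (ℚP.+-assoc (seq z n) (½ ℚ.* δ) (½ ℚ.* δ)) (cong (λ t → seq z n ℚ.+ t) (half-sum δ)))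
      (ℚP.+-monoˡ-≤ (½ ℚ.* δ) q)))
    (h (½ ℚ.* δ) (half-pos 0<δ) ⊓ᵉ k (½ ℚ.* δ) (half-pos 0<δ))

  ≈-sym : ∀ {x y} → x ≈ y → y ≈ x
  ≈-sym {x} {y} h δ 0<δ = ev-map (λ n → subst (ℚ._≤ δ) (∣p-q∣≡∣q-p∣ (seq x n) (seq y n))) (h δ 0<δ)

  ≈-refl : ∀ {x} → x ≈ x
  ≈-refl {x} = ev≈ {x} {x} (always λ n → refl)

  ≈-trans : ∀ {x y z} → x ≈ y → y ≈ z → x ≈ z
  ≈-trans {x} {y} {z} h k δ 0<δ = ev-map
    (λ n (p , q) → subst (ℚ.∣ seq x n ℚ.- seq z n ∣ ℚ.≤_) (half-sum δ) (R.triangle (seq x n) (seq y n) (seq z n) p q))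
    (h (½ ℚ.* δ) (half-pos 0<δ) ⊓ᵉ k (½ ℚ.* δ) (half-pos 0<δ))

  ≈⇒≤ : ∀ {x y} → x ≈ y → x ≤ y
  ≈⇒≤ {x} {y} h δ 0<δ = ev-map (λ n → abs-≤⁻ (seq x n) (seq y n)) (h δ 0<δ)

  ≈⇒≥ : ∀ {x y} → x ≈ y → y ≤ x
  ≈⇒≥ {x} {y} h = ≈⇒≤ {y} {x} (≈-sym {x} {y} h)

  <⇒≤ : ∀ {x y} → x < y → x ≤ y
  <⇒≤ {x} {y} (δ , 0<δ , h) = ev≤ {x} {y} (ev-map (λ n → ℚP.≤-trans (≤-add δ (ℚP.<⇒≤ 0<δ) refl)) h)

  <-≤-trans : ∀ {x y z} → x < y → y ≤ z → x < z
  <-≤-trans {x} {y} {z} (δ , 0<δ , h) k = ½ ℚ.* δ , half-pos 0<δ , ev-map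
    (λ n (p , q) → ℚP.≤-trans (subst (ℚ._≤ seq y n ℚ.- ½ ℚ.* δ)
        (trans (solve 2 (λ x δ → x :+ δ :- con ½ :* δ := x :+ (δ :- con ½ :* δ)) refl (seq x n) δ)
          (cong (λ t → seq x n ℚ.+ t) (solve 1 (λ δ → δ :- con ½ :* δ := con ½ :* δ) refl δ)))
        (ℚP.+-monoˡ-≤ (ℚ.- (½ ℚ.* δ)) p))
      (subst (seq y n ℚ.- ½ ℚ.* δ ℚ.≤_) (solve 2 (λ z δ → z :+ δ :- δ := z) refl (seq z n) (½ ℚ.* δ))
        (ℚP.+-monoˡ-≤ (ℚ.- (½ ℚ.* δ)) q)))
    (h ⊓ᵉ k (½ ℚ.* δ) (half-pos 0<δ))

  fromℚ-mono : ∀ {p q} → p ℚ.≤ q → fromℚ p ≤ fromℚ q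
  fromℚ-mono {p} {q} h = ev≤ {fromℚ p} {fromℚ q} (always λ n → h)

  ⊓-pos : ∀ {p q} → 0ℚ ℚ.< p → 0ℚ ℚ.< q → 0ℚ ℚ.< p ℚ.⊓ q
  ⊓-pos {p} {q} 0<p 0<q with ℚP.≤-total p q
  ... | inj₁ h = subst (0ℚ ℚ.<_) (sym (ℚP.p≤q⇒p⊓q≡p h)) 0<p
  ... | inj₂ h = subst (0ℚ ℚ.<_) (sym (ℚP.p≥q⇒p⊓q≡q h)) 0<q

  bounded : ∀ x → ∃[ b ] (0ℚ ℚ.< b × Eventually (λ n → ℚ.∣ seq x n ∣ ℚ.≤ b))
  bounded x = let N , b , 0<b , h = cauchy⇒bounded {seq x} (cauchy x) in b , 0<b , N , h

  neg≤∣∣ : ∀ p → ℚ.- p ℚ.≤ ℚ.∣ p ∣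
  neg≤∣∣ p = subst (ℚ.- p ℚ.≤_) (ℚP.∣-p∣≡∣p∣ p) (p≤∣p∣ (ℚ.- p))

  private
    -- Inequalities of reals hold termwise only up to `κ`, and so do signs. Shifting `x` and `y′` by
    -- `κ` makes them nonnegative, so inequalities can be multiplied; all the errors are multiples
    -- of `κ`.
    product-bound : ∀ x x′ y y′ κ B → 0ℚ ℚ.≤ κ → κ ℚ.≤ 1ℚ →
      0ℚ ℚ.≤ x ℚ.+ κ → 0ℚ ℚ.≤ y′ ℚ.+ κ → x ℚ.≤ x′ ℚ.+ κ → y ℚ.≤ y′ ℚ.+ κ →
      ℚ.∣ x′ ∣ ℚ.≤ B → ℚ.∣ y ∣ ℚ.≤ B → ℚ.∣ y′ ∣ ℚ.≤ B →
      x ℚ.* y ℚ.≤ x′ ℚ.* y′ ℚ.+ (B ℚ.+ B ℚ.+ B ℚ.+ B ℚ.+ 1ℚ ℚ.+ 1ℚ) ℚ.* κ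
    product-bound x x′ y y′ κ B 0≤κ κ≤1 0≤X 0≤Y x≤ y≤ hx′ hy hy′ = ℚP.≤-trans
      (ℚP.≤-trans
        (ℚP.≤-reflexive (solve 3 (λ x y κ → x :* y := (x :+ κ) :* y :+ κ :* (:- y)) refl x y κ))
        (ℚP.+-mono-≤
          (ℚP.≤-trans (ℚP.*-monoˡ-≤-nonNeg (x ℚ.+ κ) {{ℚ.nonNegative 0≤X}} y≤)
            (ℚP.*-monoʳ-≤-nonNeg (y′ ℚ.+ κ) {{ℚ.nonNegative 0≤Y}} (ℚP.+-monoˡ-≤ κ x≤)))
          (κ* (ℚP.≤-trans (neg≤∣∣ y) hy))))
      (subst₂ ℚ._≤_
        (solve 4 (λ x′ y′ κ B → x′ :* y′ :+ (κ :* x′ :+ κ :* y′ :+ κ :* y′ :+ κ :* κ :+ κ :* κ :+ κ :* B)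
          := (x′ :+ κ :+ κ) :* (y′ :+ κ) :+ κ :* B) refl x′ y′ κ B)
        (solve 4 (λ x′ y′ κ B → x′ :* y′ :+ (κ :* B :+ κ :* B :+ κ :* B :+ κ :* con 1ℚ :+ κ :* con 1ℚ :+ κ :* B)
          := x′ :* y′ :+ (B :+ B :+ B :+ B :+ con 1ℚ :+ con 1ℚ) :* κ) refl x′ y′ κ B)
        (ℚP.+-monoʳ-≤ (x′ ℚ.* y′) (ℚP.+-monoˡ-≤ (κ ℚ.* B) (ℚP.+-mono-≤ (ℚP.+-mono-≤ (ℚP.+-mono-≤ (ℚP.+-mono-≤
          (κ* (ℚP.≤-trans (p≤∣p∣ x′) hx′)) (κ* (ℚP.≤-trans (p≤∣p∣ y′) hy′))) (κ* (ℚP.≤-trans (p≤∣p∣ y′) hy′))) (κ* κ≤1)) (κ* κ≤1)))))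
      where
      κ* : ∀ {a b} → a ℚ.≤ b → κ ℚ.* a ℚ.≤ κ ℚ.* b
      κ* = ℚP.*-monoˡ-≤-nonNeg κ {{ℚ.nonNegative 0≤κ}}

  *-mono-≤ : ∀ {x x′ y y′} → 0ℝ ≤ x → 0ℝ ≤ y′ → x ≤ x′ → y ≤ y′ → x * y ≤ x′ * y′
  *-mono-≤ {x} {x′} {y} {y′} 0≤x 0≤y′ x≤x′ y≤y′ δ 0<δ = from (bounded x′) (bounded y) (bounded y′)
    where
    from : ∃[ b ] (0ℚ ℚ.< b × Eventually (λ n → ℚ.∣ seq x′ n ∣ ℚ.≤ b)) → ∃[ b ] (0ℚ ℚ.< b × Eventually (λ n → ℚ.∣ seq y n ∣ ℚ.≤ b)) →
           ∃[ b ] (0ℚ ℚ.< b × Eventually (λ n → ℚ.∣ seq y′ n ∣ ℚ.≤ b)) → Eventually (λ n → seq (x * y) n ℚ.≤ seq (x′ * y′) n ℚ.+ δ)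
    from (b₁ , 0<b₁ , h₁) (b₂ , 0<b₂ , h₂) (b₃ , 0<b₃ , h₃) = choose (quotient 0<D 0<δ)
      where
      B D : ℚ
      B = b₁ ℚ.+ b₂ ℚ.+ b₃
      D = B ℚ.+ B ℚ.+ B ℚ.+ B ℚ.+ 1ℚ ℚ.+ 1ℚ
      0≤B : 0ℚ ℚ.≤ B
      0≤B = +-nonneg (+-nonneg (ℚP.<⇒≤ 0<b₁) (ℚP.<⇒≤ 0<b₂)) (ℚP.<⇒≤ 0<b₃)
      0<D : 0ℚ ℚ.< D
      0<D = subst (0ℚ ℚ.<_) (ℚP.+-comm 1ℚ (B ℚ.+ B ℚ.+ B ℚ.+ B ℚ.+ 1ℚ)) (R.+-pos R.0<1 (+-nonneg (+-nonneg (+-nonneg (+-nonneg 0≤B 0≤B) 0≤B) 0≤B) R.0≤1))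
      b₁≤B : b₁ ℚ.≤ B
      b₁≤B = ≤-add (b₂ ℚ.+ b₃) (+-nonneg (ℚP.<⇒≤ 0<b₂) (ℚP.<⇒≤ 0<b₃)) (sym (ℚP.+-assoc b₁ b₂ b₃))
      b₂≤B : b₂ ℚ.≤ B
      b₂≤B = ≤-add (b₁ ℚ.+ b₃) (+-nonneg (ℚP.<⇒≤ 0<b₁) (ℚP.<⇒≤ 0<b₃)) (solve 3 (λ a b c → b :+ (a :+ c) := a :+ b :+ c) refl b₁ b₂ b₃)
      b₃≤B : b₃ ℚ.≤ B
      b₃≤B = ≤-add (b₁ ℚ.+ b₂) (+-nonneg (ℚP.<⇒≤ 0<b₁) (ℚP.<⇒≤ 0<b₂)) (ℚP.+-comm b₃ (b₁ ℚ.+ b₂))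
      choose : Σ[ κ ∈ ℚ ] (0ℚ ℚ.< κ × D ℚ.* κ ≡ δ) → _
      choose (κ₀ , 0<κ₀ , Dκ₀) = ev-map
        (λ n (a , b , c , d , p , q , r) → ℚP.≤-trans
          (product-bound (seq x n) (seq x′ n) (seq y n) (seq y′ n) κ B (ℚP.<⇒≤ 0<κ) (ℚP.p⊓q≤q κ₀ 1ℚ) a b c d
            (ℚP.≤-trans p b₁≤B) (ℚP.≤-trans q b₂≤B) (ℚP.≤-trans r b₃≤B))
          (ℚP.+-monoʳ-≤ (seq (x′ * y′) n) (subst (D ℚ.* κ ℚ.≤_) Dκ₀
            (ℚP.*-monoˡ-≤-nonNeg D {{ℚ.nonNegative (ℚP.<⇒≤ 0<D)}} (ℚP.p⊓q≤p κ₀ 1ℚ)))))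
        (0≤x κ 0<κ ⊓ᵉ 0≤y′ κ 0<κ ⊓ᵉ x≤x′ κ 0<κ ⊓ᵉ y≤y′ κ 0<κ ⊓ᵉ h₁ ⊓ᵉ h₂ ⊓ᵉ h₃)
        where
        κ : ℚ
        κ = κ₀ ℚ.⊓ 1ℚ
        0<κ : 0ℚ ℚ.< κ
        0<κ = ⊓-pos 0<κ₀ R.0<1

  *-nonneg-ℝ : ∀ {x y} → 0ℝ ≤ x → 0ℝ ≤ y → 0ℝ ≤ x * y
  *-nonneg-ℝ {x} {y} 0≤x 0≤y = ≤-trans {0ℝ} {x * 0ℝ} {x * y}
    (ev≤ {0ℝ} {x * 0ℝ} (always λ n → ℚP.≤-reflexive (sym (ℚP.*-zeroʳ (seq x n)))))
    (*-mono-≤ {x} {x} {0ℝ} {y} 0≤x 0≤y (≤-refl {x}) 0≤y)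

  seq-^ : ∀ x k n → seq (x ^ k) n ≡ seq x n R.^ k
  seq-^ x zero    n = refl
  seq-^ x (suc k) n = cong (seq x n ℚ.*_) (seq-^ x k n)

  ^-nonneg-ℝ : ∀ {x} k → 0ℝ ≤ x → 0ℝ ≤ x ^ k
  ^-nonneg-ℝ zero        h = fromℚ-mono R.0≤1
  ^-nonneg-ℝ {x} (suc k) h = *-nonneg-ℝ {x} {x ^ k} h (^-nonneg-ℝ {x} k h)

  ^-mono-≤ : ∀ {x y} k → 0ℝ ≤ x → x ≤ y → x ^ k ≤ y ^ k
  ^-mono-≤         zero    h x≤y = ≤-refl {1ℝ}
  ^-mono-≤ {x} {y} (suc k) h x≤y = *-mono-≤ {x} {y} {x ^ k} {y ^ k} h
    (^-nonneg-ℝ {y} k (≤-trans {0ℝ} {x} {y} h x≤y)) x≤y (^-mono-≤ {x} {y} k h x≤y)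

-- Reciprocals, exponential and logarithm of reals

module Exponential where

  open import Defs
  private
    module R = RationalLemmas
  open R using (*-nonneg; +-nonneg; abs-≤; abs-≤⁻; p≤∣p∣; quotient; vanishes; 0≤fromℕ; module Euler; 2ℚ)
  open import Data.Nat.Base as ℕ using (ℕ; zero; suc)
  import Data.Nat.Properties as ℕP
  open import Data.Rational.Base as ℚ using (ℚ; 0ℚ; 1ℚ; ½)
  import Data.Rational.Properties as ℚP
  open import Data.Rational.Solver using (module +-*-Solver)
  open +-*-Solver using (solve; _:+_; _:*_; _:-_; :-_; _:=_; con)
  open import Data.Product using (Σ-syntax; _×_; _,_)
  open import Relation.Nullary.Decidable using (toWitness)
  open import Relation.Binary.PropositionalEquality
  open import Algebra.Bundles using (module CommutativeRing)
  import Algebra.Properties.CommutativeSemiring.Exp as CExp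
  open CExp (CommutativeRing.commutativeSemiring ℚP.+-*-commutativeRing) using (^-distrib-*)
  open Rationals using (≤-add)
  open Rationals using (fromℕ-*; fromℕ-mono)
  open Block using (4^; 4^≡; 4^-suc)
  open EulerFacts
  open Reals

  -- An exact equality of terms, stronger than `_≈_`: beyond the witness of 0 < x the cut in `recip`
  -- is inactive.
  inv-inverse : ∀ x (p : 0ℝ < x) → Eventually (λ n → seq x n ℚ.* seq (inv x p) n ≡ 1ℚ)
  inv-inverse x (δ , 0<δ , h) = ev-map (λ n δ≤ → trans
      (cong (ℚ._* R.recip δ 0<δ (seq x n)) (sym (ℚP.p≥q⇒p⊔q≡p (subst (ℚ._≤ seq x n) (ℚP.+-identityˡ δ) δ≤))))
      (R.recip-inverse δ 0<δ (seq x n)))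
    h

  0≤inv : ∀ x (p : 0ℝ < x) → 0ℝ ≤ inv x p
  0≤inv x p@(δ , 0<δ , _) = ev≤ {0ℝ} {inv x p} (always λ n → ℚP.<⇒≤ (R.recip-pos δ 0<δ (seq x n)))

  -- y⁻¹ = x y⁻¹ x⁻¹ ≤ y y⁻¹ x⁻¹ = x⁻¹
  inv-antimono : ∀ x y (p : 0ℝ < x) (q : 0ℝ < y) → x ≤ y → inv y q ≤ inv x p
  inv-antimono x y p q x≤y = ≤-trans {inv y q} {x * inv y q * inv x p} {inv x p}
    (ev≤ {inv y q} {x * inv y q * inv x p} (ev-map (λ n e → ℚP.≤-reflexive (sym (trans
        (solve 3 (λ x y z → x :* y :* z := x :* z :* y) refl (seq x n) (seq (inv y q) n) (seq (inv x p) n))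
        (trans (cong (ℚ._* seq (inv y q) n) e) (ℚP.*-identityˡ _))))) (inv-inverse x p)))
    (≤-trans {x * inv y q * inv x p} {y * inv y q * inv x p} {inv x p}
      (*-mono-≤ {x * inv y q} {y * inv y q} {inv x p} {inv x p}
        (*-nonneg-ℝ {x} {inv y q} (<⇒≤ {0ℝ} {x} p) (0≤inv y q)) (0≤inv x p)
        (*-mono-≤ {x} {y} {inv y q} {inv y q} (<⇒≤ {0ℝ} {x} p) (0≤inv y q) x≤y (≤-refl {inv y q}))
        (≤-refl {inv x p}))
      (ev≤ {y * inv y q * inv x p} {inv x p} (ev-map (λ n e → ℚP.≤-reflexive
        (trans (cong (ℚ._* seq (inv x p) n) e) (ℚP.*-identityˡ _))) (inv-inverse y q))))

  -- Stronger than `0ℝ ≤ x`, which allows slightly negative terms: the monotonicity of `euler n` is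
  -- proved for nonnegative terms.
  NonNeg : ℝ → Set
  NonNeg x = Eventually (λ n → 0ℚ ℚ.≤ seq x n)

  nonNeg⇒0≤ : ∀ {x} → NonNeg x → 0ℝ ≤ x
  nonNeg⇒0≤ {x} h = ev≤ {0ℝ} {x} h

  exp-mono : ∀ {x y} → NonNeg x → x ≤ y → exp x ≤ exp y
  exp-mono {x} {y} 0≤x x≤y δ 0<δ = let b , 0<b , hb = bounded y in from b (ℚP.<⇒≤ 0<b) hb
    where
    from : ∀ b → 0ℚ ℚ.≤ b → Eventually (λ n → ℚ.∣ seq y n ∣ ℚ.≤ b) → Eventually (λ n → seq (exp x) n ℚ.≤ seq (exp y) n ℚ.+ δ)
    from b 0≤b hb = choose (quotient 0<K 0<δ)
      where
      0≤b+1 : 0ℚ ℚ.≤ b ℚ.+ 1ℚ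
      0≤b+1 = +-nonneg 0≤b R.0≤1
      open Euler 0≤b+1 using (N₀; K; 0<K; lipschitz)
      choose : Σ[ κ ∈ ℚ ] (0ℚ ℚ.< κ × K ℚ.* κ ≡ δ) → Eventually (λ n → seq (exp x) n ℚ.≤ seq (exp y) n ℚ.+ δ)
      choose (κ₀ , 0<κ₀ , Kκ₀) = ev-map
        (λ n (0≤xn , xn≤ , yn≤b , N₀≤n) → let z = seq y n ℚ.+ κ in ℚP.≤-trans (euler-mono n 0≤xn xn≤)
          (ℚP.≤-trans (abs-≤⁻ (R.euler n z) (R.euler n (seq y n))
            (lipschitz n N₀≤n
              (ℚP.≤-trans (ℚP.∣p+q∣≤∣p∣+∣q∣ (seq y n) κ) (ℚP.+-mono-≤ yn≤b (subst (ℚ._≤ 1ℚ) (sym (ℚP.0≤p⇒∣p∣≡p (ℚP.<⇒≤ 0<κ))) (ℚP.p⊓q≤q κ₀ 1ℚ))))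
              (ℚP.≤-trans yn≤b (≤-add 1ℚ R.0≤1 refl))
              (ℚP.≤-reflexive (trans (cong ℚ.∣_∣ (solve 2 (λ y κ → y :+ κ :- y := κ) refl (seq y n) κ)) (ℚP.0≤p⇒∣p∣≡p (ℚP.<⇒≤ 0<κ))))))
            (ℚP.+-monoʳ-≤ (seq (exp y) n) (subst (K ℚ.* κ ℚ.≤_) Kκ₀ (ℚP.*-monoˡ-≤-nonNeg K {{ℚ.nonNegative (ℚP.<⇒≤ 0<K)}} (ℚP.p⊓q≤p κ₀ 1ℚ))))))
        (0≤x ⊓ᵉ x≤y κ 0<κ ⊓ᵉ hb ⊓ᵉ (N₀ , λ n p → p))
        where
        κ : ℚ
        κ = κ₀ ℚ.⊓ 1ℚ
        0<κ : 0ℚ ℚ.< κ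
        0<κ = ⊓-pos 0<κ₀ R.0<1

  exp-reflect : ∀ {x y} → NonNeg x → NonNeg y → exp x ≤ exp y → x ≤ y
  exp-reflect {x} {y} 0≤x 0≤y h δ 0<δ = ev-map (λ n (a , b , c) → euler-reflect n a b (ℚP.<⇒≤ 0<δ) c)
    (0≤x ⊓ᵉ 0≤y ⊓ᵉ h δ 0<δ)

  exp-+ : ∀ x y → exp (x + y) ≈ exp x * exp y
  exp-+ x y δ 0<δ = let b , 0<b , hb = bounded x; c , 0<c , hc = bounded y in from b c 0<b (ℚP.<⇒≤ 0<c) hb hc
    where
    from : ∀ b c → 0ℚ ℚ.< b → 0ℚ ℚ.≤ c → Eventually (λ n → ℚ.∣ seq x n ∣ ℚ.≤ b) → Eventually (λ n → ℚ.∣ seq y n ∣ ℚ.≤ c) → _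
    from b c 0<b 0≤c hb hc = choose (vanishes D 0≤D 0<δ)
      where
      B : ℚ
      B = b ℚ.+ c
      0≤B : 0ℚ ℚ.≤ B
      0≤B = +-nonneg (ℚP.<⇒≤ 0<b) 0≤c
      open Euler 0≤B using (N₀; K; 0<K)
      D : ℚ
      D = K ℚ.* K ℚ.* (B ℚ.* B)
      0≤D : 0ℚ ℚ.≤ D
      0≤D = *-nonneg (*-nonneg (ℚP.<⇒≤ 0<K) (ℚP.<⇒≤ 0<K)) (*-nonneg 0≤B 0≤B)
      choose : Eventually (λ n → D ℚ.* ½ R.^ n ℚ.≤ δ) → Eventually (λ n → ℚ.∣ seq (exp (x + y)) n ℚ.- seq (exp x * exp y) n ∣ ℚ.≤ δ)
      choose small = ev-map (λ n (p , q , r , s) → ℚP.≤-trans (euler-homo 0≤B n s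
          (ℚP.≤-trans q (≤-add c 0≤c refl)) (ℚP.≤-trans r (≤-add b (ℚP.<⇒≤ 0<b) (ℚP.+-comm c b)))) p)
        (small ⊓ᵉ hb ⊓ᵉ hc ⊓ᵉ (N₀ , λ n p → p))

  4ℚ : ℚ
  4ℚ = 2ℚ ℚ.+ 2ℚ

  -- The bound e ≤ 4 at finite stages, which lets 4 play the role of e in the estimates of
  -- logarithms.
  euler-1≤4 : ∀ n → 1 ℕ.≤ n → R.euler n 1ℚ ℚ.≤ 4ℚ
  euler-1≤4 (suc m) _ = subst (λ n → R.euler n 1ℚ ℚ.≤ 4ℚ) (ℕP.+-comm m 1)
    (R.euler-bound-at R.0≤1 1 (toWitness {a? = 1ℚ ℚ.* ½ R.^ 1 ℚP.≤? ½} _) m)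

  fromℕ-4^ : ∀ j → R.fromℕ (4^ j) ≡ 4ℚ R.^ j
  fromℕ-4^ zero    = cong R.fromℕ (4^≡ 0)
  fromℕ-4^ (suc j) = trans (cong R.fromℕ (4^-suc j)) (trans (fromℕ-* 4 (4^ j)) (cong (4ℚ ℚ.*_) (fromℕ-4^ j)))

  -- With h = 1/2^n, Bernoulli gives 1 + j h ≤ (1 + h)^j. Exchanging the exponents leaves the j-th
  -- power of (1 + h)^(2^n) ≤ 4.
  euler-fromℕ≤4^ : ∀ n j → 1 ℕ.≤ n → R.euler n (R.fromℕ j) ℚ.≤ R.fromℕ (4^ j)
  euler-fromℕ≤4^ n j 1≤n = ℚP.≤-trans
    (R.^-mono (2^ n) (+-nonneg R.0≤1 (*-nonneg (0≤fromℕ j) (0≤½^ n)))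
      (subst (λ p → p ℚ.+ R.fromℕ j ℚ.* ½ R.^ n ℚ.≤ (1ℚ ℚ.+ ½ R.^ n) R.^ j) (1^ j) (tangent 1ℚ (½ R.^ n) j ℚP.≤-refl (0≤½^ n))))
    (ℚP.≤-trans (ℚP.≤-reflexive (trans (R.^-assocʳ w j (2^ n)) (trans (cong (w R.^_) (ℕP.*-comm j (2^ n)))
        (trans (sym (R.^-assocʳ w (2^ n) j)) (cong (λ h → ((1ℚ ℚ.+ h) R.^ (2^ n)) R.^ j) (sym (ℚP.*-identityˡ (½ R.^ n))))))))
      (ℚP.≤-trans (R.^-mono j (R.^-nonneg (2^ n) (+-nonneg R.0≤1 (*-nonneg R.0≤1 (0≤½^ n)))) (euler-1≤4 n 1≤n))
        (ℚP.≤-reflexive (sym (fromℕ-4^ j)))))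
    where
    w : ℚ
    w = 1ℚ ℚ.+ ½ R.^ n
    1^ : ∀ j → 1ℚ R.^ j ≡ 1ℚ
    1^ zero    = refl
    1^ (suc j) = trans (ℚP.*-identityˡ _) (1^ j)

  exp-fromℕ≤4^ : ∀ j → exp (fromℚ (R.fromℕ j)) ≤ fromℚ (R.fromℕ (4^ j))
  exp-fromℕ≤4^ j = ev≤ {exp (fromℚ (R.fromℕ j))} {fromℚ (R.fromℕ (4^ j))} (1 , λ n 1≤n → euler-fromℕ≤4^ n j 1≤n)

  exp-square : ∀ {q} → 0ℚ ℚ.≤ q → fromℚ ((1ℚ ℚ.+ ½ ℚ.* q) ℚ.* (1ℚ ℚ.+ ½ ℚ.* q)) ≤ exp (fromℚ q)
  exp-square {q} 0≤q = ev≤ {fromℚ ((1ℚ ℚ.+ ½ ℚ.* q) ℚ.* (1ℚ ℚ.+ ½ ℚ.* q))} {exp (fromℚ q)}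
    (1 , λ { (suc n) _ → euler-square n 0≤q })

  -- (1 - h)(1 + 2h) ≥ 1 for h ≤ 1/2, and (1 + 2h)^(1/h) ≤ 16.
  1/16≤exp[-1] : fromℚ (½ R.^ 4) ≤ exp (- 1ℝ)
  1/16≤exp[-1] = ev≤ {fromℚ (½ R.^ 4)} {exp (- 1ℝ)} (2 , λ n 2≤n → bound n 2≤n)
    where
    bound : ∀ n → 2 ℕ.≤ n → ½ R.^ 4 ℚ.≤ R.euler n (ℚ.- 1ℚ)
    bound n 2≤n = ℚP.*-cancelˡ-≤-pos (2ℚ R.^ 4) (ℚP.≤-trans {1ℚ} 1≤ (ℚP.≤-trans (ℚP.≤-reflexive (^-distrib-* v w (2^ n)))
      (ℚP.*-monoʳ-≤-nonNeg (R.euler n (ℚ.- 1ℚ)) {{ℚ.nonNegative (R.^-nonneg (2^ n) 0≤w)}} v≤)))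
      where
      h v w : ℚ
      h = ½ R.^ n
      v = 1ℚ ℚ.+ 2ℚ ℚ.* h
      w = 1ℚ ℚ.+ ℚ.- 1ℚ ℚ.* h
      h≤½ : h ℚ.≤ ½
      h≤½ = R.½^-anti {1} (ℕP.≤-trans (ℕ.s≤s ℕ.z≤n) 2≤n)
      0≤w : 0ℚ ℚ.≤ w
      0≤w = subst (0ℚ ℚ.≤_) (solve 1 (λ h → con ½ :+ (con ½ :- h) := con 1ℚ :+ (:- con 1ℚ) :* h) refl h)
        (+-nonneg R.0≤½ (subst (ℚ._≤ ½ ℚ.- h) (ℚP.+-inverseʳ h) (ℚP.+-monoˡ-≤ (ℚ.- h) h≤½)))
      1≤vw : 1ℚ ℚ.≤ v ℚ.* w
      1≤vw = ≤-add (2ℚ ℚ.* h ℚ.* (½ ℚ.- h)) (*-nonneg (*-nonneg (toWitness {a? = 0ℚ ℚP.≤? 2ℚ} _) (0≤½^ n))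
          (subst (ℚ._≤ ½ ℚ.- h) (ℚP.+-inverseʳ h) (ℚP.+-monoˡ-≤ (ℚ.- h) h≤½)))
        (solve 1 (λ h → con 1ℚ :+ con 2ℚ :* h :* (con ½ :- h) := (con 1ℚ :+ con 2ℚ :* h) :* (con 1ℚ :+ (:- con 1ℚ) :* h)) refl h)
      1≤ : 1ℚ ℚ.≤ (v ℚ.* w) R.^ (2^ n)
      1≤ = R.1≤^ (2^ n) 1≤vw
      v≤ : v R.^ (2^ n) ℚ.≤ 2ℚ R.^ 4
      v≤ = subst (λ n → R.euler n 2ℚ ℚ.≤ 2ℚ R.^ 4) (ℕP.m∸n+n≡m 2≤n)
        (R.euler-bound-at (toWitness {a? = 0ℚ ℚP.≤? 2ℚ} _) 2 (toWitness {a? = 2ℚ ℚ.* ½ R.^ 2 ℚP.≤? ½} _) (n ℕ.∸ 2))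

  ln : ℝ → ℝ
  ln x = mkℝ (λ n → log n (seq x n)) (log-cauchy {seq x} (cauchy x))

  ln-nonNeg : ∀ x → NonNeg (ln x)
  ln-nonNeg x = always λ n → 0≤log n (seq x n)

  max : ℝ → ℚ → ℝ
  max x q = mkℝ (λ n → seq x n ℚ.⊔ q) (R.⊔-cauchy q {seq x} (cauchy x))

  max-absorbs : ∀ x q → fromℚ q ≤ x → max x q ≈ x
  max-absorbs x q h δ 0<δ = ev-map (λ n q≤ → abs-≤ {seq x n ℚ.⊔ q} {seq x n}
      (ℚP.⊔-lub (slack {seq x n} (ℚP.<⇒≤ 0<δ) ℚP.≤-refl) q≤)
      (slack (ℚP.<⇒≤ 0<δ) (ℚP.p≤p⊔q (seq x n) q)))
    (h δ 0<δ)

  exp-ln : ∀ x → fromℚ 1ℚ ≤ x → exp (ln x) ≈ x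
  exp-ln x 1≤x = ≈-trans {exp (ln x)} {max x 1ℚ} {x} exp-ln-max (max-absorbs x 1ℚ 1≤x)
    where
    exp-ln-max : exp (ln x) ≈ max x 1ℚ
    exp-ln-max δ 0<δ = let b , 0<b , hb = bounded (max x 1ℚ) in from b (ℚP.<⇒≤ 0<b) hb
      where
      from : ∀ b → 0ℚ ℚ.≤ b → Eventually (λ n → ℚ.∣ seq x n ℚ.⊔ 1ℚ ∣ ℚ.≤ b) →
             Eventually (λ n → ℚ.∣ seq (exp (ln x)) n ℚ.- (seq x n ℚ.⊔ 1ℚ) ∣ ℚ.≤ δ)
      from b 0≤b hb = ev-map
        (λ n (p , q , r) → ℚP.≤-trans (euler-log n (seq x n) q (ℚP.≤-trans (p≤∣p∣ (seq x n ℚ.⊔ 1ℚ)) p)) r)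
        (hb ⊓ᵉ (N₀ , λ n p → p) ⊓ᵉ vanishes (K ℚ.* b) (*-nonneg (ℚP.<⇒≤ 0<K) 0≤b) 0<δ)
        where
        open LogError 0≤b using (N₀; K; 0<K; euler-log)

  ln-mono : ∀ {x y} → fromℚ 1ℚ ≤ x → x ≤ y → ln x ≤ ln y
  ln-mono {x} {y} 1≤x x≤y = exp-reflect {ln x} {ln y} (ln-nonNeg x) (ln-nonNeg y)
    (≤-trans {exp (ln x)} {x} {exp (ln y)} (≈⇒≤ {exp (ln x)} {x} (exp-ln x 1≤x))
      (≤-trans {x} {y} {exp (ln y)} x≤y (≈⇒≥ {exp (ln y)} {y} (exp-ln y (≤-trans {fromℚ 1ℚ} {x} {y} 1≤x x≤y)))))

  ln-lower : ∀ {x} j → fromℚ (R.fromℕ (4^ j)) ≤ x → fromℚ (R.fromℕ j) ≤ ln x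
  ln-lower {x} j h = exp-reflect {fromℚ (R.fromℕ j)} {ln x} (always λ _ → 0≤fromℕ j) (ln-nonNeg x)
    (≤-trans {exp (fromℚ (R.fromℕ j))} {fromℚ (R.fromℕ (4^ j))} {exp (ln x)} (exp-fromℕ≤4^ j)
      (≤-trans {fromℚ (R.fromℕ (4^ j))} {x} {exp (ln x)} h (≈⇒≥ {exp (ln x)} {x} (exp-ln x
        (≤-trans {fromℚ 1ℚ} {fromℚ (R.fromℕ (4^ j))} {x} (fromℚ-mono (fromℕ-mono (ℕ.>-nonZero⁻¹ (4^ j)))) h)))))

-- The visibility function and its rate

module Rate where

  open import Defs
  private
    module R = RationalLemmas
  open R using (fromℕ; fromℕ-suc; *-nonneg; +-nonneg; abs-≤⁻; p≤∣p∣; quotient; 0≤fromℕ; 0≤½; 0≤1)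
  open import Data.Nat.Base as ℕ using (ℕ; zero; suc)
  import Data.Nat.Properties as ℕP
  open import Data.Rational.Base as ℚ using (ℚ; 0ℚ; 1ℚ; ½)
  import Data.Rational.Properties as ℚP
  open import Data.Rational.Solver using (module +-*-Solver)
  open +-*-Solver using (solve; _:+_; _:*_; _:-_; :-_; _:=_; con)
  open import Data.Product using (∃-syntax; Σ-syntax; _×_; _,_; proj₁; proj₂)
  open import Relation.Nullary using (yes; no; contradiction)
  open import Relation.Nullary.Decidable using (toWitness)
  open import Relation.Binary.PropositionalEquality
  open Rationals using (fromℕ-mono; fromℕ-cancel-≤; recipℕ; recipℕ-inverse; 0<recipℕ)
  open Block using (4^; 4^≡; 4^-suc; 4^-mono; 4^-nonZero; n<4^n; 0<4^)
  open Reals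
  open Exponential

  natural : ℕ → ℝ
  natural n = fromℚ (fromℕ n)

  natural-mono : ∀ {m n} → m ℕ.≤ n → natural m ≤ natural n
  natural-mono h = fromℚ-mono (fromℕ-mono h)

  bracket4^ : ∀ n → 1 ℕ.≤ n → ∃[ j ] (4^ j ℕ.≤ n × n ℕ.< 4^ (suc j))
  bracket4^ (suc zero)    _ = 0 , ℕP.≤-reflexive (4^≡ 0) , n<4^n 1
  bracket4^ (suc (suc n)) _ = let j , lo , hi = bracket4^ (suc n) (ℕ.s≤s ℕ.z≤n) in step j lo hi
    where
    step : ∀ j → 4^ j ℕ.≤ suc n → suc n ℕ.< 4^ (suc j) → ∃[ j ] (4^ j ℕ.≤ suc (suc n) × suc (suc n) ℕ.< 4^ (suc j))
    step j lo hi with suc (suc n) ℕP.<? 4^ (suc j)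
    ... | yes p = j , ℕP.m≤n⇒m≤1+n lo , p
    ... | no ¬p = suc j , ℕP.≮⇒≥ ¬p , ℕP.≤-<-trans hi (subst (4^ (suc j) ℕ.<_) (sym (4^-suc (suc j)))
      (ℕP.m<m+n (4^ (suc j)) (ℕP.<-≤-trans (0<4^ (suc j)) (ℕP.m≤m+n (4^ (suc j)) _))))

  4^-order : ∀ {m n} → 4^ m ℕ.< 4^ (suc n) → m ℕ.≤ n
  4^-order {m} {n} h with m ℕP.≤? n
  ... | yes p = p
  ... | no ¬p = contradiction h (ℕP.≤⇒≯ (4^-mono (ℕP.≰⇒> ¬p)))

  -- Whether x < 4^(j+1) cannot be decided, so `j` is found from one rational term `r` within 1 of
  -- `x`. The price is the exponent `2 + j` in the upper bound, and `suc b` in the hypothesis.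
  bracket-ℝ : ∀ x b → natural (4^ (suc b)) ≤ x → ∃[ j ] (b ℕ.≤ j × natural (4^ j) ≤ x × x ≤ natural (4^ (2 ℕ.+ j)))
  bracket-ℝ x b large = from (cauchy x 1ℚ R.0<1) (large 1ℚ R.0<1)
    where
    from : (∃[ N ] ∀ m n → N ℕ.≤ m → N ℕ.≤ n → ℚ.∣ seq x m ℚ.- seq x n ∣ ℚ.≤ 1ℚ) →
           Eventually (λ n → fromℕ (4^ (suc b)) ℚ.≤ seq x n ℚ.+ 1ℚ) →
           ∃[ j ] (b ℕ.≤ j × natural (4^ j) ≤ x × x ≤ natural (4^ (2 ℕ.+ j)))
    from (N₁ , close) (N₂ , h) = build (R.≤fromℕ r)
      where
      N : ℕ
      N = N₁ ℕ.⊔ N₂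
      r : ℚ
      r = seq x N
      r≥ : fromℕ (4^ (suc b)) ℚ.≤ r ℚ.+ 1ℚ
      r≥ = h N (ℕP.m≤n⊔m N₁ N₂)
      cancel : ∀ a → 1ℚ ℚ.+ a ℚ.- 1ℚ ≡ a
      cancel = solve 1 (λ a → con 1ℚ :+ a :- con 1ℚ := a) refl
      lower : ∀ a → fromℕ (suc a) ℚ.≤ r → natural a ≤ x
      lower a p = ev≤ {natural a} {x} (N₁ , λ n q → subst₂ ℚ._≤_ (cancel (fromℕ a)) (cancel (seq x n)) (ℚP.+-monoˡ-≤ (ℚ.- 1ℚ)
        (ℚP.≤-trans (subst (ℚ._≤ r) (fromℕ-suc a) p)
          (subst (r ℚ.≤_) (ℚP.+-comm (seq x n) 1ℚ) (abs-≤⁻ r (seq x n) (close N n (ℕP.m≤m⊔n N₁ N₂) q))))))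
      upper : ∀ a → r ℚ.≤ fromℕ a → x ≤ natural (suc a)
      upper a p = ev≤ {x} {natural (suc a)} (N₁ , λ n q → ℚP.≤-trans (abs-≤⁻ (seq x n) r (close n N q (ℕP.m≤m⊔n N₁ N₂)))
        (subst (r ℚ.+ 1ℚ ℚ.≤_) (trans (ℚP.+-comm (fromℕ a) 1ℚ) (sym (fromℕ-suc a))) (ℚP.+-monoˡ-≤ 1ℚ p)))
      -- The bounds c + 1 and c + 2 for `r` become c and c + 3 for `x`, absorbing the distance 1.
      least : ∀ a → r ℚ.≤ fromℕ a → 1ℚ ℚ.≤ r → ∃[ c ] (fromℕ (suc c) ℚ.≤ r × r ℚ.≤ fromℕ (suc (suc c)))
      least zero    p q = contradiction (ℚP.≤-trans q p) λ h → ℚP.<-irrefl refl (ℚP.<-≤-trans R.0<1 h)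
      least (suc a) p q with r ℚP.≤? fromℕ a
      ... | yes p′ = least a p′ q
      least (suc zero)    p q | no ¬p = 0 , q , ℚP.≤-trans p (fromℕ-mono (ℕ.s≤s ℕ.z≤n))
      least (suc (suc a)) p q | no ¬p = a , ℚP.<⇒≤ (ℚP.≰⇒> ¬p) , p
      4^b≥ : 4 ℕ.* 1 ℕ.≤ 4^ (suc b)
      4^b≥ = subst (4 ℕ.* 1 ℕ.≤_) (sym (4^-suc b)) (ℕP.*-monoʳ-≤ 4 (0<4^ b))
      1≤r : 1ℚ ℚ.≤ r
      1≤r = subst₂ ℚ._≤_ refl (cancel r) (ℚP.+-monoˡ-≤ (ℚ.- 1ℚ) (ℚP.≤-trans (fromℕ-mono {2} (ℕP.≤-trans (ℕ.s≤s (ℕ.s≤s ℕ.z≤n)) 4^b≥))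
        (subst (fromℕ (4^ (suc b)) ℚ.≤_) (ℚP.+-comm r 1ℚ) r≥)))
      build : (∃[ a ] r ℚ.≤ fromℕ a) → ∃[ j ] (b ℕ.≤ j × natural (4^ j) ≤ x × x ≤ natural (4^ (2 ℕ.+ j)))
      build (a , r≤a) = let c , lo , hi = least a r≤a 1≤r in locate c lo hi
        where
        locate : ∀ c → fromℕ (suc c) ℚ.≤ r → r ℚ.≤ fromℕ (suc (suc c)) → _
        locate c lo hi = let j , p , q = bracket4^ c 1≤c in
          j , 4^-order (ℕP.≤-<-trans 4^b≤c q) , ≤-trans {natural (4^ j)} {natural c} {x} (natural-mono p) (lower c lo) ,
          ≤-trans {x} {natural (3 ℕ.+ c)} {natural (4^ (2 ℕ.+ j))} (upper (2 ℕ.+ c) hi) (natural-mono (top j q))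
          where
          3+c≥ : 4^ (suc b) ℕ.≤ 3 ℕ.+ c
          3+c≥ = fromℕ-cancel-≤ (ℚP.≤-trans r≥ (subst (r ℚ.+ 1ℚ ℚ.≤_)
            (trans (ℚP.+-comm (fromℕ (2 ℕ.+ c)) 1ℚ) (sym (fromℕ-suc (2 ℕ.+ c)))) (ℚP.+-monoˡ-≤ 1ℚ hi)))
          4^b≤c : 4^ b ℕ.≤ c
          4^b≤c = ℕP.+-cancelˡ-≤ 3 _ _ (ℕP.≤-trans (ℕP.≤-trans (ℕP.+-monoˡ-≤ (4^ b) (ℕP.*-monoʳ-≤ 3 (0<4^ b)))
            (ℕP.≤-reflexive (trans (ℕP.+-comm (3 ℕ.* 4^ b) (4^ b)) (sym (4^-suc b))))) 3+c≥)
          1≤c : 1 ℕ.≤ c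
          1≤c = ℕP.≤-trans (0<4^ b) 4^b≤c
          top : ∀ j → c ℕ.< 4^ (suc j) → 3 ℕ.+ c ℕ.≤ 4^ (2 ℕ.+ j)
          top j q = ℕP.≤-trans (ℕP.+-monoʳ-≤ 3 (ℕP.<⇒≤ q)) (ℕP.≤-trans (ℕP.+-monoˡ-≤ (4^ (suc j)) (ℕP.*-monoʳ-≤ 3 (0<4^ (suc j))))
            (ℕP.≤-reflexive (trans (ℕP.+-comm (3 ℕ.* 4^ (suc j)) (4^ (suc j))) (sym (4^-suc (suc j))))))

  -- c = c x x⁻¹ ≤ c q x⁻¹ = x⁻¹.
  inv-lower : ∀ x (p : 0ℝ < x) {q c} → 0ℚ ℚ.≤ c → c ℚ.* q ≡ 1ℚ → x ≤ fromℚ q → fromℚ c ≤ inv x p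
  inv-lower x p {q} {c} 0≤c cq x≤q = ≤-trans {fromℚ c} {fromℚ c * (x * inv x p)} {inv x p}
    (ev≤ {fromℚ c} {fromℚ c * (x * inv x p)} (ev-map (λ n e → ℚP.≤-reflexive (sym (trans (cong (c ℚ.*_) e) (ℚP.*-identityʳ c)))) (inv-inverse x p)))
    (≤-trans {fromℚ c * (x * inv x p)} {fromℚ c * (fromℚ q * inv x p)} {inv x p}
      (*-mono-≤ {fromℚ c} {fromℚ c} {x * inv x p} {fromℚ q * inv x p} (fromℚ-mono 0≤c)
        (*-nonneg-ℝ {fromℚ q} {inv x p} (≤-trans {0ℝ} {x} {fromℚ q} (<⇒≤ {0ℝ} {x} p) x≤q) (0≤inv x p)) (≤-refl {fromℚ c})
        (*-mono-≤ {x} {fromℚ q} {inv x p} {inv x p} (<⇒≤ {0ℝ} {x} p) (0≤inv x p) x≤q (≤-refl {inv x p})))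
      (ev≤ {fromℚ c * (fromℚ q * inv x p)} {inv x p} (always λ n → ℚP.≤-reflexive (trans (sym (ℚP.*-assoc c q (seq (inv x p) n)))
        (trans (cong (ℚ._* seq (inv x p) n) cq) (ℚP.*-identityˡ _))))))

  -- q = q x x⁻¹ ≤ q x c = x.
  inv-upper : ∀ x (p : 0ℝ < x) {q c} → 0ℚ ℚ.≤ q → c ℚ.* q ≡ 1ℚ → inv x p ≤ fromℚ c → fromℚ q ≤ x
  inv-upper x p {q} {c} 0≤q cq inv≤c = ≤-trans {fromℚ q} {fromℚ q * (x * inv x p)} {x}
    (ev≤ {fromℚ q} {fromℚ q * (x * inv x p)} (ev-map (λ n e → ℚP.≤-reflexive (sym (trans (cong (q ℚ.*_) e) (ℚP.*-identityʳ q)))) (inv-inverse x p)))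
    (≤-trans {fromℚ q * (x * inv x p)} {fromℚ q * (x * fromℚ c)} {x}
      (*-mono-≤ {fromℚ q} {fromℚ q} {x * inv x p} {x * fromℚ c} (fromℚ-mono 0≤q)
        (*-nonneg-ℝ {x} {fromℚ c} (<⇒≤ {0ℝ} {x} p) (≤-trans {0ℝ} {inv x p} {fromℚ c} (0≤inv x p) inv≤c)) (≤-refl {fromℚ q})
        (*-mono-≤ {x} {x} {inv x p} {fromℚ c} (<⇒≤ {0ℝ} {x} p) (≤-trans {0ℝ} {inv x p} {fromℚ c} (0≤inv x p) inv≤c) (≤-refl {x}) inv≤c))
      (ev≤ {fromℚ q * (x * fromℚ c)} {x} (always λ n → ℚP.≤-reflexive (trans
        (solve 3 (λ q x c → q :* (x :* c) := (c :* q) :* x) refl q (seq x n) c)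
        (trans (cong (ℚ._* seq x n) cq) (ℚP.*-identityˡ _))))))

  -- For v ≥ 4^5 one has ln v ≥ 5 ≥ 4 and hence ln ln v ≥ 1, so all iterated logarithms are taken at
  -- arguments from 1 on. Moreover 1/1024 < 1/16 ≤ exp(-1), which makes 1/`E` an admissible ε₀.
  E : ℕ
  E = 4^ 5

  module Visibility (e : ℕ) (η : ℝ) (0<η : 0ℝ < η) (C : ℕ) (1≤C : 1 ℕ.≤ C) where

    δ₀ : ℚ
    δ₀ = proj₁ 0<η

    0≤δ₀ : 0ℚ ℚ.≤ δ₀
    0≤δ₀ = ℚP.<⇒≤ (proj₁ (proj₂ 0<η))

    δ₀≤η : Eventually (λ n → δ₀ ℚ.≤ seq η n)
    δ₀≤η = ev-map (λ n → subst (ℚ._≤ seq η n) (ℚP.+-identityˡ δ₀)) (proj₂ (proj₂ 0<η))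

    power : ℝ → ℝ
    power t = exp ((1ℝ + η) * t)

    rate : ℝ → ℝ
    rate v = v ^ suc e * ln v * power (ln (ln (ln v)))

    -- Bounding 1/ε from below makes the iterated logarithms defined for every ε < 1.
    base : 𝕀 → ℝ
    base (ε , 0<ε , _) = max (inv ε 0<ε) (fromℕ E)

    W : 𝕀 → ℝ
    W ε = natural C * rate (base ε)

    -- exp (η t) ≥ gain s for t ≥ s
    gain : ℕ → ℚ
    gain s = (1ℚ ℚ.+ ½ ℚ.* (δ₀ ℚ.* fromℕ s)) ℚ.* (1ℚ ℚ.+ ½ ℚ.* (δ₀ ℚ.* fromℕ s))

    0≤δ₀s : ∀ s → 0ℚ ℚ.≤ δ₀ ℚ.* fromℕ s
    0≤δ₀s s = *-nonneg 0≤δ₀ (0≤fromℕ s)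

    0≤gain : ∀ s → 0ℚ ℚ.≤ gain s
    0≤gain s = *-nonneg 0≤ 0≤
      where
      0≤ : 0ℚ ℚ.≤ 1ℚ ℚ.+ ½ ℚ.* (δ₀ ℚ.* fromℕ s)
      0≤ = +-nonneg 0≤1 (*-nonneg 0≤½ (0≤δ₀s s))

    -- m^(1+η) is m exp(η ln m); the first factor gives `k` and the second `gain s`.
    power-lower : ∀ {m} k s → 1 ℕ.≤ k → natural k ≤ m → natural s ≤ ln m → fromℚ (fromℕ k ℚ.* gain s) ≤ power (ln m)
    power-lower {m} k s 1≤k k≤m s≤t = ≤-trans {fromℚ (fromℕ k ℚ.* gain s)} {exp t * exp (η * t)} {power t}
      (≤-trans {fromℚ (fromℕ k ℚ.* gain s)} {natural k * fromℚ (gain s)} {exp t * exp (η * t)}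
        (ev≤ {fromℚ (fromℕ k ℚ.* gain s)} {natural k * fromℚ (gain s)} (always λ n → ℚP.≤-refl))
        (*-mono-≤ {natural k} {exp t} {fromℚ (gain s)} {exp (η * t)} (fromℚ-mono (0≤fromℕ k))
          (≤-trans {0ℝ} {fromℚ (gain s)} {exp (η * t)} (fromℚ-mono (0≤gain s)) gain≤)
          (≤-trans {natural k} {m} {exp t} k≤m (≈⇒≥ {exp t} {m} (exp-ln m (≤-trans {natural 1} {natural k} {m} (natural-mono 1≤k) k≤m)))) gain≤))
      (≤-trans {exp t * exp (η * t)} {exp (t + η * t)} {power t} (≈⇒≥ {exp (t + η * t)} {exp t * exp (η * t)} (exp-+ t (η * t)))
        (ev≤ {exp (t + η * t)} {power t} (always λ n → ℚP.≤-reflexive (cong (R.euler n)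
          (solve 2 (λ t η → t :+ η :* t := (con 1ℚ :+ η) :* t) refl (seq t n) (seq η n))))))
      where
      t : ℝ
      t = ln m
      gain≤ : fromℚ (gain s) ≤ exp (η * t)
      gain≤ = ≤-trans {fromℚ (gain s)} {exp (fromℚ (δ₀ ℚ.* fromℕ s))} {exp (η * t)} (exp-square (0≤δ₀s s))
        (exp-mono {fromℚ (δ₀ ℚ.* fromℕ s)} {η * t} (always λ _ → 0≤δ₀s s)
          (≤-trans {fromℚ (δ₀ ℚ.* fromℕ s)} {fromℚ δ₀ * natural s} {η * t}
            (ev≤ {fromℚ (δ₀ ℚ.* fromℕ s)} {fromℚ δ₀ * natural s} (always λ n → ℚP.≤-refl))
            (*-mono-≤ {fromℚ δ₀} {η} {natural s} {t} (fromℚ-mono 0≤δ₀) (nonNeg⇒0≤ {t} (ln-nonNeg m)) (ev≤ {fromℚ δ₀} {η} δ₀≤η) s≤t)))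

    -- Each logarithm removes one power of 4: v ≥ 4^j gives ln v ≥ j ≥ 4^k, then ln ln v ≥ k ≥ 4^s,
    -- then ln ln ln v ≥ s.
    rate-lower : ∀ {v} j k s → 1 ℕ.≤ k → natural (4^ j) ≤ v → 4^ k ℕ.≤ j → 4^ s ℕ.≤ k →
      fromℚ (fromℕ (4^ j) R.^ suc e ℚ.* fromℕ j ℚ.* (fromℕ k ℚ.* gain s)) ≤ rate v
    rate-lower {v} j k s 1≤k 4^j≤v 4^k≤j 4^s≤k = ≤-trans {fromℚ (x ℚ.* fromℕ j ℚ.* y)} {fromℚ x * natural j * fromℚ y} {rate v}
      (ev≤ {fromℚ (x ℚ.* fromℕ j ℚ.* y)} {fromℚ x * natural j * fromℚ y} (always λ n → ℚP.≤-refl))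
      (*-mono-≤ {fromℚ x * natural j} {v ^ suc e * ln v} {fromℚ y} {power (ln (ln (ln v)))}
        (*-nonneg-ℝ {fromℚ x} {natural j} 0≤x (fromℚ-mono (0≤fromℕ j)))
        (≤-trans {0ℝ} {fromℚ y} {power (ln (ln (ln v)))} (fromℚ-mono (*-nonneg (0≤fromℕ k) (0≤gain s))) y≤)
        (*-mono-≤ {fromℚ x} {v ^ suc e} {natural j} {ln v} 0≤x (nonNeg⇒0≤ {ln v} (ln-nonNeg v))
          (≤-trans {fromℚ x} {natural (4^ j) ^ suc e} {v ^ suc e}
            (ev≤ {fromℚ x} {natural (4^ j) ^ suc e} (always λ n → ℚP.≤-reflexive (sym (seq-^ (natural (4^ j)) (suc e) n))))
            (^-mono-≤ {natural (4^ j)} {v} (suc e) (fromℚ-mono (0≤fromℕ (4^ j))) 4^j≤v))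
          j≤l)
        y≤)
      where
      x y : ℚ
      x = fromℕ (4^ j) R.^ suc e
      y = fromℕ k ℚ.* gain s
      0≤x : 0ℝ ≤ fromℚ x
      0≤x = fromℚ-mono (R.^-nonneg (suc e) (0≤fromℕ (4^ j)))
      j≤l : natural j ≤ ln v
      j≤l = ln-lower {v} j 4^j≤v
      k≤m : natural k ≤ ln (ln v)
      k≤m = ln-lower {ln v} k (≤-trans {natural (4^ k)} {natural j} {ln v} (natural-mono 4^k≤j) j≤l)
      y≤ : fromℚ y ≤ power (ln (ln (ln v)))
      y≤ = power-lower {ln (ln v)} k s 1≤k k≤m (ln-lower {ln (ln v)} s (≤-trans {natural (4^ s)} {natural k} {ln (ln v)} (natural-mono 4^s≤k) k≤m))

    large⇒1≤ln² : ∀ {v} → natural E ≤ v → natural 1 ≤ ln (ln v)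
    large⇒1≤ln² {v} E≤v = ln-lower {ln v} 1 (≤-trans {natural (4^ 1)} {natural 5} {ln v}
      (natural-mono (ℕP.≤-trans (ℕP.≤-reflexive (trans (4^-suc 0) (cong (4 ℕ.*_) (4^≡ 0)))) (ℕP.n≤1+n 4)))
      (ln-lower {v} 5 E≤v))

    1≤ln : ∀ {v} → natural E ≤ v → natural 1 ≤ ln v
    1≤ln {v} E≤v = ≤-trans {natural 1} {natural 5} {ln v} (natural-mono (ℕ.s≤s ℕ.z≤n)) (ln-lower {v} 5 E≤v)

    1≤large : ∀ {v} → natural E ≤ v → natural 1 ≤ v
    1≤large {v} E≤v = ≤-trans {natural 1} {natural E} {v} (natural-mono (0<4^ 5)) E≤v

    0≤power : ∀ t → NonNeg t → 0ℝ ≤ power t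
    0≤power t 0≤t = ≤-trans {0ℝ} {natural 1} {power t} (fromℚ-mono 0≤1)
      (ev≤ {natural 1} {power t} (ev-map (λ n (δ₀≤ , 0≤tn) →
          ℚP.≤-trans (ℚP.≤-reflexive (sym (EulerFacts.euler-0 n)))
            (EulerFacts.euler-mono n ℚP.≤-refl (*-nonneg (+-nonneg 0≤1 (ℚP.≤-trans 0≤δ₀ δ₀≤)) 0≤tn)))
        (δ₀≤η ⊓ᵉ 0≤t)))

    power-mono : ∀ {t t′} → NonNeg t → t ≤ t′ → power t ≤ power t′
    power-mono {t} {t′} 0≤t t≤t′ = exp-mono {(1ℝ + η) * t} {(1ℝ + η) * t′}
      (ev-map (λ n (δ₀≤ , 0≤tn) → *-nonneg (+-nonneg 0≤1 (ℚP.≤-trans 0≤δ₀ δ₀≤)) 0≤tn) (δ₀≤η ⊓ᵉ 0≤t))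
      (*-mono-≤ {1ℝ + η} {1ℝ + η} {t} {t′} 0≤1+η (≤-trans {0ℝ} {t} {t′} (nonNeg⇒0≤ {t} 0≤t) t≤t′) (≤-refl {1ℝ + η}) t≤t′)
      where
      0≤1+η : 0ℝ ≤ 1ℝ + η
      0≤1+η = ev≤ {0ℝ} {1ℝ + η} (ev-map (λ n δ₀≤ → +-nonneg 0≤1 (ℚP.≤-trans 0≤δ₀ δ₀≤)) δ₀≤η)

    rate-mono : ∀ {v v′} → natural E ≤ v → v ≤ v′ → rate v ≤ rate v′
    rate-mono {v} {v′} E≤v v≤v′ = *-mono-≤ {v ^ suc e * ln v} {v′ ^ suc e * ln v′} {power t} {power t′}
      (*-nonneg-ℝ {v ^ suc e} {ln v} (^-nonneg-ℝ {v} (suc e) 0≤v) (nonNeg⇒0≤ {ln v} (ln-nonNeg v)))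
      (0≤power t′ (ln-nonNeg (ln (ln v′))))
      (*-mono-≤ {v ^ suc e} {v′ ^ suc e} {ln v} {ln v′} (^-nonneg-ℝ {v} (suc e) 0≤v) (nonNeg⇒0≤ {ln v′} (ln-nonNeg v′))
        (^-mono-≤ {v} {v′} (suc e) 0≤v v≤v′) l≤)
      (power-mono {t} {t′} (ln-nonNeg (ln (ln v))) (ln-mono {ln (ln v)} {ln (ln v′)} (large⇒1≤ln² {v} E≤v)
        (ln-mono {ln v} {ln v′} (1≤ln {v} E≤v) l≤)))
      where
      t t′ : ℝ
      t = ln (ln (ln v))
      t′ = ln (ln (ln v′))
      0≤v : 0ℝ ≤ v
      0≤v = ≤-trans {0ℝ} {natural 1} {v} (fromℚ-mono 0≤1) (1≤large {v} E≤v)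
      l≤ : ln v ≤ ln v′
      l≤ = ln-mono {v} {v′} (1≤large {v} E≤v) v≤v′

    -- Apart from one power of `v` all factors are at least 1; positivity and the limit +∞ of `W`
    -- both rest on this.
    ≤rate : ∀ {v} → natural E ≤ v → v ≤ rate v
    ≤rate {v} E≤v = ≤-trans {v} {v * natural 1 * natural 1 * natural 1} {rate v}
      (ev≤ {v} {v * natural 1 * natural 1 * natural 1} (always λ n → ℚP.≤-reflexive
        (solve 1 (λ v → v := v :* con 1ℚ :* con 1ℚ :* con 1ℚ) refl (seq v n))))
      (*-mono-≤ {v * natural 1 * natural 1} {v ^ suc e * ln v} {natural 1} {power (ln (ln (ln v)))}
        (*-nonneg-ℝ {v * natural 1} {natural 1} (*-nonneg-ℝ {v} {natural 1} 0≤v 0≤1ℝ) 0≤1ℝ)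
        (0≤power (ln (ln (ln v))) (ln-nonNeg (ln (ln v))))
        (*-mono-≤ {v * natural 1} {v ^ suc e} {natural 1} {ln v} (*-nonneg-ℝ {v} {natural 1} 0≤v 0≤1ℝ)
          (nonNeg⇒0≤ {ln v} (ln-nonNeg v))
          (*-mono-≤ {v} {v} {natural 1} {v ^ e} 0≤v (^-nonneg-ℝ {v} e 0≤v) (≤-refl {v}) 1≤v^e)
          (1≤ln {v} E≤v))
        (≤-trans {natural 1} {fromℚ (fromℕ 1 ℚ.* gain 0)} {power (ln (ln (ln v)))}
          (fromℚ-mono (ℚP.≤-reflexive (sym (trans (ℚP.*-identityˡ (gain 0)) (gain0 δ₀)))))
          (power-lower {ln (ln v)} 1 0 ℕP.≤-refl (large⇒1≤ln² {v} E≤v) (nonNeg⇒0≤ {ln (ln (ln v))} (ln-nonNeg (ln (ln v)))))))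
      where
      0≤1ℝ : 0ℝ ≤ natural 1
      0≤1ℝ = fromℚ-mono 0≤1
      0≤v : 0ℝ ≤ v
      0≤v = ≤-trans {0ℝ} {natural 1} {v} 0≤1ℝ (1≤large {v} E≤v)
      gain0 : ∀ δ → (1ℚ ℚ.+ ½ ℚ.* (δ ℚ.* 0ℚ)) ℚ.* (1ℚ ℚ.+ ½ ℚ.* (δ ℚ.* 0ℚ)) ≡ 1ℚ
      gain0 = solve 1 (λ δ → (con 1ℚ :+ con ½ :* (δ :* con 0ℚ)) :* (con 1ℚ :+ con ½ :* (δ :* con 0ℚ)) := con 1ℚ) refl
      1≤v^e : natural 1 ≤ v ^ e
      1≤v^e = ≤-trans {natural 1} {natural 1 ^ e} {v ^ e}
        (ev≤ {natural 1} {natural 1 ^ e} (always λ n → ℚP.≤-trans (R.1≤^ e ℚP.≤-refl) (ℚP.≤-reflexive (sym (seq-^ (natural 1) e n)))))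
        (^-mono-≤ {natural 1} {v} e 0≤1ℝ (1≤large {v} E≤v))

    E≤base : ∀ ε → natural E ≤ base ε
    E≤base (ε , 0<ε , ε<1) = ev≤ {natural E} {base (ε , 0<ε , ε<1)} (always λ n → ℚP.p≤q⊔p (seq (inv ε 0<ε) n) (fromℕ E))

    inv≤base : ∀ ε → inv (proj₁ ε) (proj₁ (proj₂ ε)) ≤ base ε
    inv≤base ε@(x , 0<x , _) = ev≤ {inv x 0<x} {base ε} (always λ n → ℚP.p≤p⊔q (seq (inv x 0<x) n) (fromℕ E))

    0≤C : 0ℝ ≤ natural C
    0≤C = fromℚ-mono (0≤fromℕ C)

    0≤large : ∀ {v} → natural E ≤ v → 0ℝ ≤ v
    0≤large {v} E≤v = ≤-trans {0ℝ} {natural 1} {v} (fromℚ-mono 0≤1) (1≤large {v} E≤v)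

    base≤W : ∀ ε → base ε ≤ W ε
    base≤W ε = ≤-trans {base ε} {natural 1 * base ε} {W ε}
      (ev≤ {base ε} {natural 1 * base ε} (always λ n → ℚP.≤-reflexive (sym (ℚP.*-identityˡ _))))
      (*-mono-≤ {natural 1} {natural C} {base ε} {rate (base ε)} (fromℚ-mono 0≤1)
        (≤-trans {0ℝ} {base ε} {rate (base ε)} (0≤large {base ε} (E≤base ε)) (≤rate {base ε} (E≤base ε)))
        (natural-mono 1≤C) (≤rate {base ε} (E≤base ε)))

    W-positive : PositiveValued W
    W-positive ε = <-≤-trans {0ℝ} {natural E} {W ε} (1ℚ , R.0<1 , always λ n → fromℕ-mono (0<4^ 5))
      (≤-trans {natural E} {base ε} {W ε} (E≤base ε) (base≤W ε))

    W-decreasing : Decreasing W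
    W-decreasing ε@(x , 0<x , _) ε′@(x′ , 0<x′ , _) x≤x′ =
      *-mono-≤ {natural C} {natural C} {rate (base ε′)} {rate (base ε)} 0≤C
        (≤-trans {0ℝ} {base ε} {rate (base ε)} (0≤large {base ε} (E≤base ε)) (≤rate {base ε} (E≤base ε))) (≤-refl {natural C})
        (rate-mono {base ε′} {base ε} (E≤base ε′)
          (λ δ 0<δ → ev-map (λ n h → R.⊔-mono-+ (fromℕ E) (seq (inv x′ 0<x′) n) (seq (inv x 0<x) n) (ℚP.<⇒≤ 0<δ) h)
            (inv-antimono x x′ 0<x 0<x′ x≤x′ δ 0<δ)))

    W-tendsTo+∞ : TendsTo+∞At0⁺ W
    W-tendsTo+∞ M = let b , 0<b , hb = bounded M in
      from b (ℚP.<⇒≤ 0<b) hb (quotient (subst (0ℚ ℚ.<_) (ℚP.+-comm 1ℚ b) (R.+-pos R.0<1 (ℚP.<⇒≤ 0<b))) R.0<1)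
      where
      from : ∀ b → 0ℚ ℚ.≤ b → Eventually (λ n → ℚ.∣ seq M n ∣ ℚ.≤ b) → Σ[ κ ∈ ℚ ] (0ℚ ℚ.< κ × (b ℚ.+ 1ℚ) ℚ.* κ ≡ 1ℚ) →
             ∃[ δ ] (0ℝ < δ × (∀ ε → proj₁ ε < δ → M < W ε))
      from b 0≤b hb (κ , 0<κ , bκ) = fromℚ κ ,
        (κ , 0<κ , always λ n → ℚP.≤-reflexive (ℚP.+-identityˡ κ)) , λ ε x<κ →
        <-≤-trans {M} {fromℚ (b ℚ.+ 1ℚ)} {W ε}
          (1ℚ , R.0<1 , ev-map (λ n h → ℚP.+-monoˡ-≤ 1ℚ (ℚP.≤-trans (p≤∣p∣ (seq M n)) h)) hb)
          (≤-trans {fromℚ (b ℚ.+ 1ℚ)} {inv (proj₁ ε) (proj₁ (proj₂ ε))} {W ε}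
            (inv-lower (proj₁ ε) (proj₁ (proj₂ ε)) (+-nonneg 0≤b 0≤1) bκ (<⇒≤ {proj₁ ε} {fromℚ κ} x<κ))
            (≤-trans {inv (proj₁ ε) (proj₁ (proj₂ ε))} {base ε} {W ε} (inv≤base ε) (base≤W ε)))

    -- For ε ≤ 1/`E` the cut in `base` is inactive, so `W ε` is `C` times the rate itself.
    W-bigO : IsBigORate (2 ℕ.+ e) η W
    W-bigO = natural C , fromℚ (recipℕ E) ,
      (1ℚ , R.0<1 , always λ n → fromℕ-mono 1≤C) ,
      (recipℕ E , 0<recipℕ E , always λ n → ℚP.≤-reflexive (ℚP.+-identityˡ (recipℕ E))) ,
      <-≤-trans {fromℚ (recipℕ E)} {fromℚ (½ R.^ 4)} {exp (- 1ℝ)} small 1/16≤exp[-1] ,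
      bound
      where
      recipE : recipℕ E ≡ recipℕ 1024
      recipE = lemma (4^≡ 5)
        where
        lemma : ∀ {m n} .{{_ : ℕ.NonZero m}} .{{_ : ℕ.NonZero n}} → m ≡ n → recipℕ m ≡ recipℕ n
        lemma refl = refl
      small : fromℚ (recipℕ E) < fromℚ (½ R.^ 4)
      small = recipℕ 1024 , 0<recipℕ 1024 , always λ n → subst (λ q → q ℚ.+ recipℕ 1024 ℚ.≤ ½ R.^ 4) (sym recipE)
        (toWitness {a? = recipℕ 1024 ℚ.+ recipℕ 1024 ℚP.≤? ½ R.^ 4} _)
      bound : ∀ ε → proj₁ ε ≤ fromℚ (recipℕ E) → ∃[ r ] (IsRate (2 ℕ.+ e) η ε r × W ε ≤ natural C * r)
      bound ε@(x , 0<x , _) x≤ = r , (ln v , ln (ln v) , power (ln (ln (ln v))) ,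
          ≈-trans {exp (ln v)} {v} {i} (exp-ln v (1≤large {v} E≤v)) v≈i ,
          exp-ln (ln v) (1≤ln {v} E≤v) ,
          (ln (ln (ln v)) , exp-ln (ln (ln v)) (large⇒1≤ln² {v} E≤v) , ≈-refl {power (ln (ln (ln v)))}) ,
          ≈-refl {r}) ,
        *-mono-≤ {natural C} {natural C} {rate v} {r} 0≤C (*-nonneg-ℝ {i ^ suc e * ln v} {power (ln (ln (ln v)))}
            (*-nonneg-ℝ {i ^ suc e} {ln v} (^-nonneg-ℝ {i} (suc e) (0≤inv x 0<x)) 0≤l) 0≤y) (≤-refl {natural C})
          (*-mono-≤ {v ^ suc e * ln v} {i ^ suc e * ln v} {power (ln (ln (ln v)))} {power (ln (ln (ln v)))}
            (*-nonneg-ℝ {v ^ suc e} {ln v} (^-nonneg-ℝ {v} (suc e) (0≤large {v} E≤v)) 0≤l) 0≤y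
            (*-mono-≤ {v ^ suc e} {i ^ suc e} {ln v} {ln v} (^-nonneg-ℝ {v} (suc e) (0≤large {v} E≤v)) 0≤l
              (^-mono-≤ {v} {i} (suc e) (0≤large {v} E≤v) (≈⇒≤ {v} {i} v≈i)) (≤-refl {ln v}))
            (≤-refl {power (ln (ln (ln v)))}))
        where
        v i r : ℝ
        v = base ε
        i = inv x 0<x
        r = i ^ suc e * ln v * power (ln (ln (ln v)))
        E≤v : natural E ≤ v
        E≤v = E≤base ε
        v≈i : v ≈ i
        v≈i = max-absorbs i (fromℕ E) (inv-lower x 0<x {recipℕ E} {fromℕ E} (0≤fromℕ E) (recipℕ-inverse E) x≤)
        0≤l : 0ℝ ≤ ln v
        0≤l = nonNeg⇒0≤ {ln v} (ln-nonNeg v)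
        0≤y : 0ℝ ≤ power (ln (ln (ln v)))
        0≤y = 0≤power (ln (ln (ln v))) (ln-nonNeg (ln (ln v)))

-- Euclidean norm against coordinates

module Norms where

  open import Defs
  private
    module R = RationalLemmas
  open R using (fromℕ; fromℕ-suc; *-nonneg; +-nonneg; half-pos; half-sum; p≤∣p∣; 0≤fromℕ; 0≤1; root; root-bounds; vanishes)
  open import Data.Nat.Base as ℕ using (ℕ; zero; suc)
  open import Data.Fin.Base using (Fin; zero; suc)
  open import Data.Fin.Properties using (any?)
  open import Data.Rational.Base as ℚ using (ℚ; 0ℚ; 1ℚ; ½)
  import Data.Rational.Properties as ℚP
  open import Data.Rational.Solver using (module +-*-Solver)
  open +-*-Solver using (solve; _:+_; _:*_; _:-_; :-_; _:=_; con)
  open import Data.Product using (∃-syntax; _,_; proj₁; proj₂)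
  open import Data.Sum.Base using (inj₁; inj₂)
  open import Function.Base using (_∘_)
  open import Relation.Nullary using (yes; no; contradiction)
  open import Relation.Nullary.Decidable using (decidable-stable)
  open import Relation.Binary.PropositionalEquality
  open Rationals using (≤-add)
  open Rationals using (fromℕ-mono)
  open EulerFacts using (0≤½^)
  open Reals

  -- The factor `1ℚ` is left over from unfolding `_^ 2`, so that the terms of a squared norm have
  -- exactly this form.
  sumSquares : ∀ {d} → (Fin d → ℚ) → ℚ
  sumSquares {zero}  c = 0ℚ
  sumSquares {suc d} c = c zero ℚ.* (c zero ℚ.* 1ℚ) ℚ.+ sumSquares (c ∘ suc)

  seq-sumSquares : ∀ {d} (p : Point d) n → seq (sum (λ i → p i ^ 2)) n ≡ sumSquares (λ i → seq (p i) n)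
  seq-sumSquares {zero}  p n = refl
  seq-sumSquares {suc d} p n = cong (λ t → seq (p zero) n ℚ.* (seq (p zero) n ℚ.* 1ℚ) ℚ.+ t) (seq-sumSquares (p ∘ suc) n)

  abs-square : ∀ c → ℚ.∣ c ∣ ℚ.* ℚ.∣ c ∣ ≡ c ℚ.* (c ℚ.* 1ℚ)
  abs-square c = trans (sym (ℚP.∣p*q∣≡∣p∣*∣q∣ c c)) (trans (ℚP.0≤p⇒∣p∣≡p 0≤cc) (cong (c ℚ.*_) (sym (ℚP.*-identityʳ c))))
    where
    0≤cc : 0ℚ ℚ.≤ c ℚ.* c
    0≤cc with ℚP.∣p∣≡p∨∣p∣≡-p c
    ... | inj₁ e = *-nonneg (ℚP.∣p∣≡p⇒0≤p e) (ℚP.∣p∣≡p⇒0≤p e)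
    ... | inj₂ e = subst (0ℚ ℚ.≤_) (solve 1 (λ c → (:- c) :* (:- c) := c :* c) refl c) (*-nonneg 0≤-c 0≤-c)
      where
      0≤-c : 0ℚ ℚ.≤ ℚ.- c
      0≤-c = subst (0ℚ ℚ.≤_) e (ℚP.0≤∣p∣ c)

  0≤square : ∀ c → 0ℚ ℚ.≤ c ℚ.* (c ℚ.* 1ℚ)
  0≤square c = subst (0ℚ ℚ.≤_) (abs-square c) (*-nonneg (ℚP.0≤∣p∣ c) (ℚP.0≤∣p∣ c))

  0≤sumSquares : ∀ {d} (c : Fin d → ℚ) → 0ℚ ℚ.≤ sumSquares c
  0≤sumSquares {zero}  c = ℚP.≤-refl
  0≤sumSquares {suc d} c = +-nonneg (0≤square (c zero)) (0≤sumSquares (c ∘ suc))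

  square≤sumSquares : ∀ {d} (c : Fin d → ℚ) i → ℚ.∣ c i ∣ ℚ.* ℚ.∣ c i ∣ ℚ.≤ sumSquares c
  square≤sumSquares c zero    = ≤-add (sumSquares (c ∘ suc)) (0≤sumSquares (c ∘ suc)) (cong (ℚ._+ sumSquares (c ∘ suc)) (abs-square (c zero)))
  square≤sumSquares c (suc i) = ℚP.≤-trans (square≤sumSquares (c ∘ suc) i)
    (≤-add _ (0≤square (c zero)) (ℚP.+-comm (sumSquares (c ∘ suc)) _))

  sumSquares≤ : ∀ {d} (c : Fin d → ℚ) ρ → (∀ i → ℚ.∣ c i ∣ ℚ.≤ ρ) → sumSquares c ℚ.≤ fromℕ d ℚ.* (ρ ℚ.* ρ)
  sumSquares≤ {zero}  c ρ h = ℚP.≤-reflexive (sym (ℚP.*-zeroˡ (ρ ℚ.* ρ)))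
  sumSquares≤ {suc d} c ρ h = subst (sumSquares c ℚ.≤_)
    (trans (solve 2 (λ r n → r :+ n :* r := (con 1ℚ :+ n) :* r) refl (ρ ℚ.* ρ) (fromℕ d)) (cong (ℚ._* (ρ ℚ.* ρ)) (sym (fromℕ-suc d))))
    (ℚP.+-mono-≤ (subst (ℚ._≤ ρ ℚ.* ρ) (abs-square (c zero)) (R.*-mono (ℚP.0≤∣p∣ (c zero)) 0≤ρ (h zero) (h zero)))
      (sumSquares≤ (c ∘ suc) ρ (h ∘ suc)))
    where
    0≤ρ : 0ℚ ℚ.≤ ρ
    0≤ρ = ℚP.≤-trans (ℚP.0≤∣p∣ (c zero)) (h zero)

  square-cancel-≤ : ∀ {s t} → 0ℚ ℚ.≤ t → s ℚ.* s ℚ.≤ t ℚ.* t → s ℚ.≤ t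
  square-cancel-≤ {s} {t} 0≤t h with s ℚP.≤? t
  ... | yes p = p
  ... | no ¬p = contradiction (ℚP.<-≤-trans (ℚP.≤-<-trans (ℚP.*-monoˡ-≤-nonNeg t {{ℚ.nonNegative 0≤t}} (ℚP.<⇒≤ t<s))
      (ℚP.*-monoˡ-<-pos s {{ℚ.positive (ℚP.≤-<-trans 0≤t t<s)}} t<s)) h) (ℚP.<-irrefl refl)
    where
    t<s : t ℚ.< s
    t<s = ℚP.≰⇒> ¬p

  module _ {d : ℕ} (p : Point d) where

    squares : ℕ → ℚ
    squares n = sumSquares (λ i → seq (p i) n)

    norm-bounds : ∀ n → R.RootBounds (squares n) ((1ℚ ℚ.+ squares n) ℚ.* ½ R.^ n) (seq ∥ p ∥ n)
    norm-bounds n = subst (λ q → R.RootBounds q ((1ℚ ℚ.+ q) ℚ.* ½ R.^ n) (root n (seq (sum (λ i → p i ^ 2)) n ℚ.⊔ 0ℚ))) q≡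
      (root-bounds n _ (ℚP.p≤q⊔p (seq (sum (λ i → p i ^ 2)) n) 0ℚ))
      where
      q≡ : seq (sum (λ i → p i ^ 2)) n ℚ.⊔ 0ℚ ≡ squares n
      q≡ = trans (cong (ℚ._⊔ 0ℚ) (seq-sumSquares p n)) (ℚP.p≥q⇒p⊔q≡p (0≤sumSquares (λ i → seq (p i) n)))

    -- The digitwise square root lags behind by at most (1 + `squares n`) / 2^n, which vanishes
    -- because the sum of squares is bounded.
    coordinate≤norm : ∀ δ → 0ℚ ℚ.< δ → Eventually (λ n → ∀ i → ℚ.∣ seq (p i) n ∣ ℚ.≤ seq ∥ p ∥ n ℚ.+ δ)
    coordinate≤norm δ 0<δ = let b , 0<b , hb = bounded (sum (λ i → p i ^ 2)) in
      ev-map (λ n (hb , small) i → ℚP.≤-trans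
          (square-cancel-≤ (+-nonneg (proj₁ (norm-bounds n)) (0≤w n)) (ℚP.≤-trans (square≤sumSquares (λ i → seq (p i) n) i) (proj₂ (proj₂ (norm-bounds n)))))
          (ℚP.+-monoʳ-≤ (seq ∥ p ∥ n) (ℚP.≤-trans
            (ℚP.*-monoʳ-≤-nonNeg (½ R.^ n) {{ℚ.nonNegative (0≤½^ n)}} (ℚP.+-monoʳ-≤ 1ℚ
              (ℚP.≤-trans (ℚP.≤-reflexive (sym (seq-sumSquares p n))) (ℚP.≤-trans (p≤∣p∣ _) hb)))) small)))
        (hb ⊓ᵉ vanishes (1ℚ ℚ.+ b) (+-nonneg 0≤1 (ℚP.<⇒≤ 0<b)) 0<δ)
      where
      0≤w : ∀ n → 0ℚ ℚ.≤ (1ℚ ℚ.+ squares n) ℚ.* ½ R.^ n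
      0≤w n = *-nonneg (+-nonneg 0≤1 (0≤sumSquares (λ i → seq (p i) n))) (0≤½^ n)

    -- The factor d in place of √d keeps the bound rational.
    norm≤ : 1 ℕ.≤ d → ∀ {ρ} n → 0ℚ ℚ.≤ ρ → (∀ i → ℚ.∣ seq (p i) n ∣ ℚ.≤ ρ) → seq ∥ p ∥ n ℚ.≤ fromℕ d ℚ.* ρ
    norm≤ 1≤d {ρ} n 0≤ρ h = square-cancel-≤ (*-nonneg (0≤fromℕ d) 0≤ρ)
      (ℚP.≤-trans (proj₁ (proj₂ (norm-bounds n))) (ℚP.≤-trans (sumSquares≤ (λ i → seq (p i) n) ρ h)
        (ℚP.≤-trans (ℚP.≤-reflexive (solve 2 (λ d r → d :* (r :* r) := con 1ℚ :* (d :* (r :* r))) refl (fromℕ d) ρ))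
          (ℚP.≤-trans (ℚP.*-monoʳ-≤-nonNeg (fromℕ d ℚ.* (ρ ℚ.* ρ)) {{ℚ.nonNegative (*-nonneg (0≤fromℕ d) (*-nonneg 0≤ρ 0≤ρ))}} (fromℕ-mono 1≤d))
            (ℚP.≤-reflexive (solve 2 (λ d r → d :* (d :* (r :* r)) := (d :* r) :* (d :* r)) refl (fromℕ d) ρ))))))

    -- If all coordinates were below ρ, `norm≤` would bound the norm by d ρ; the second d ρ in the
    -- hypothesis absorbs the tolerance of `_≤_`. The axis may vary with `n`, as rational terms are
    -- compared and not reals.
    large-coordinate : 1 ℕ.≤ d → ∀ {ρ} → 0ℚ ℚ.< ρ → fromℚ (fromℕ d ℚ.* ρ ℚ.+ fromℕ d ℚ.* ρ) ≤ ∥ p ∥ →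
      Eventually (λ n → ∃[ i ] ρ ℚ.≤ ℚ.∣ seq (p i) n ∣)
    large-coordinate 1≤d {ρ} 0<ρ h = ev-map find (h (½ ℚ.* D) (half-pos 0<D))
      where
      D : ℚ
      D = fromℕ d ℚ.* ρ
      0<D : 0ℚ ℚ.< D
      0<D = R.*-pos (ℚP.<-≤-trans R.0<1 (fromℕ-mono 1≤d)) 0<ρ
      ½D<D : ½ ℚ.* D ℚ.< D
      ½D<D = subst₂ ℚ._<_ (ℚP.+-identityʳ (½ ℚ.* D)) (half-sum D) (ℚP.+-monoʳ-< (½ ℚ.* D) (half-pos 0<D))
      find : ∀ n → D ℚ.+ D ℚ.≤ seq ∥ p ∥ n ℚ.+ ½ ℚ.* D → ∃[ i ] ρ ℚ.≤ ℚ.∣ seq (p i) n ∣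
      find n long = decidable-stable (any? (λ i → ρ ℚP.≤? ℚ.∣ seq (p i) n ∣)) λ ¬found →
        ℚP.<-irrefl refl (ℚP.<-≤-trans (ℚP.+-monoʳ-< D ½D<D)
          (ℚP.≤-trans long (ℚP.+-monoˡ-≤ (½ ℚ.* D)
            (norm≤ 1≤d n (ℚP.<⇒≤ 0<ρ) (λ i → ℚP.<⇒≤ (ℚP.≰⇒> (λ r → ¬found (i , r))))))))

-- The forest: density, visibility and assembly

module Construction where

  open import Defs
  private
    module R = RationalLemmas
  open R using (fromℕ; fromℕ-suc; *-nonneg; +-nonneg; half-pos; half-sum; abs-≤⁻; ∣p-q∣≡∣q-p∣; quotient; 0≤fromℕ; 0≤1)
  open import Algebra.Bundles using (module CommutativeRing)
  import Algebra.Properties.CommutativeSemiring.Exp as CExp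
  open import Level using (0ℓ)
  open import Data.Nat.Base as ℕ using (ℕ; zero; suc)
  import Data.Nat.Properties as ℕP
  import Data.Nat.Solver as ℕS
  open import Data.Integer.Base as ℤ using (ℤ; +_)
  open import Data.Fin.Base using (Fin; zero; suc)
  open import Data.Rational.Base as ℚ using (ℚ; 0ℚ; 1ℚ; ½)
  import Data.Rational.Properties as ℚP
  open import Data.Rational.Solver using (module +-*-Solver)
  open +-*-Solver using (solve; _:+_; _:*_; _:-_; :-_; _:=_; con)
  open import Data.Vec.Base as Vec using (Vec)
  open import Data.Vec.Properties using (lookup∘tabulate)
  open import Data.Vec.Functional.Properties using (insertAt-lookup; insertAt-punchIn)
  open import Data.Product using (∃-syntax; Σ-syntax; _×_; _,_; proj₁; proj₂)
  open import Function.Definitions using (Injective)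
  open import Function.Base using (_∘_)
  open import Relation.Nullary using (yes; no)
  open import Relation.Nullary.Decidable using (toWitness)
  open import Relation.Unary using (Pred; _∈_; _∩_)
  open import Relation.Binary.Definitions using (_Respects_)
  open import Relation.Binary.PropositionalEquality hiding (J)
  open Rationals using (≤-add)
  open Lines using (module Hitting)
  open Rationals using (fromℕ-*; fromℕ-mono; fromℕ-cancel-≤; recipℕ; recipℕ-inverse; 0<recipℕ)
  open Block using (4^; 4^≡; 4^-suc; 4^-+; 4^-^; 4^-nonZero; n<4^n; 0<4^; module Parameters; blocks)
  open Segments using (along; axis-or-punchIn; module Planes)
  open Density using (spacing; 0<spacing; module Codes)
  open Reals
  open Norms
  open Rate
  open CExp (CommutativeRing.commutativeSemiring ℚP.+-*-commutativeRing) using (^-distrib-*)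

  fromℕ-^ : ∀ m k → fromℕ (m ℕ.^ k) ≡ fromℕ m R.^ k
  fromℕ-^ m zero    = refl
  fromℕ-^ m (suc k) = trans (fromℕ-* m (m ℕ.^ k)) (cong (fromℕ m ℚ.*_) (fromℕ-^ m k))

  ceiling : ∀ r → 0ℚ ℚ.≤ r → ∃[ U ] (r ℚ.≤ fromℕ U × fromℕ U ℚ.≤ r ℚ.+ 1ℚ)
  ceiling r 0≤r = let a , r≤a = R.≤fromℕ r in least a r≤a
    where
    least : ∀ a → r ℚ.≤ fromℕ a → ∃[ U ] (r ℚ.≤ fromℕ U × fromℕ U ℚ.≤ r ℚ.+ 1ℚ)
    least zero    r≤0 = 0 , r≤0 , +-nonneg 0≤r 0≤1
    least (suc a) r≤  with r ℚP.≤? fromℕ a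
    ... | yes r≤a = least a r≤a
    ... | no  r≰a = suc a , r≤ , subst (ℚ._≤ r ℚ.+ 1ℚ) (trans (ℚP.+-comm (fromℕ a) 1ℚ) (sym (fromℕ-suc a)))
      (ℚP.+-monoˡ-≤ 1ℚ (ℚP.<⇒≤ (ℚP.≰⇒> r≰a)))

  ev-∀ : ∀ {d} {P : Fin d → ℕ → Set} → (∀ i → Eventually (P i)) → Eventually (λ n → ∀ i → P i n)
  ev-∀ {zero}  h = always λ n ()
  ev-∀ {suc d} h = ev-map (λ { n (p , q) zero → p ; n (p , q) (suc i) → q i }) (h zero ⊓ᵉ ev-∀ (h ∘ suc))

  witness : ∀ {P : ℕ → Set} → Eventually P → ∃[ n ] P n
  witness (N , h) = N , h N ℕP.≤-refl

  ∣∣-triangle : ∀ p q {δ} → ℚ.∣ p ℚ.- q ∣ ℚ.≤ δ → ℚ.∣ q ∣ ℚ.≤ ℚ.∣ p ∣ ℚ.+ δ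
  ∣∣-triangle p q {δ} h = subst (λ t → ℚ.∣ t ∣ ℚ.≤ ℚ.∣ p ∣ ℚ.+ δ) (solve 2 (λ p q → p :- (p :- q) := q) refl p q)
    (ℚP.≤-trans (ℚP.∣p-q∣≤∣p∣+∣q∣ p (p ℚ.- q)) (ℚP.+-monoʳ-≤ ℚ.∣ p ∣ h))

  module Forest (e c₂ c : ℕ) (θ : ∀ k → ℕ → Parameters.Letter (suc e) c₂ (k ℕ.+ c) (4^ (suc k))) where

    open Codes (suc e) c₂ c θ

    d : ℕ
    d = suc (suc e)

    F : Pred (Point d) 0ℓ
    F p = Σ[ γ ∈ Code ] (Valid γ × (∀ l → p l ≈ fromℚ (decode γ l)))

    F-respects : F Respects _≋_
    F-respects {p} {q} p≋q (γ , valid , h) = γ , valid , λ l →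
      ≈-trans {q l} {p l} {fromℚ (decode γ l)} (≈-sym {p l} {q l} (p≋q l)) (h l)

    -- Four approximations meet in `ball-bound`: of T by a rational, of the norm by T, of a
    -- coordinate by the norm and of the point by its code. Together they cost ½.
    eighth : ℚ
    eighth = ½ ℚ.* (½ ℚ.* ½)

    0<eighth : 0ℚ ℚ.< eighth
    0<eighth = toWitness {a? = 0ℚ ℚP.<? eighth} _

    ball-bound : ∀ T τ → Eventually (λ n → seq T n ℚ.≤ τ ℚ.+ eighth) → ∀ p (p∈F : F p) → ∥ p ∥ ≤ T →
                 ∀ l → ℚ.∣ decode (proj₁ p∈F) l ∣ ℚ.≤ τ ℚ.+ ½
    ball-bound T τ T≤ p (γ , _ , h) p∈T l = 
      let n , T≤τ , c≤ , ∥p∥≤ , p≈ = witness (T≤ ⊓ᵉ coordinate≤norm p eighth 0<eighth ⊓ᵉ p∈T eighth 0<eighth ⊓ᵉ h l eighth 0<eighth)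
      in ℚP.≤-trans (∣∣-triangle (seq (p l) n) (decode γ l) p≈)
        (ℚP.≤-trans (ℚP.+-monoˡ-≤ eighth (ℚP.≤-trans (c≤ l) (ℚP.+-monoˡ-≤ eighth (ℚP.≤-trans ∥p∥≤ (ℚP.+-monoˡ-≤ eighth T≤τ)))))
          (ℚP.≤-reflexive (solve 1 (λ τ → τ :+ con eighth :+ con eighth :+ con eighth :+ con eighth := τ :+ con ½) refl τ)))

    -- The box size satisfies U ≤ T + 1/8 + 3/2. A forest point in the ball forces T ≥ 3/8 by
    -- `1≤decode`, and then U ≤ 6 T.
    densityConstant : ℝ
    densityConstant = natural density * natural 6 ^ d

    F-density : FiniteDensity F
    F-density = densityConstant ,
      (1ℚ , R.0<1 , always λ n → subst (1ℚ ℚ.≤_) (cong (fromℕ density ℚ.*_) (sym (seq-^ (natural 6) d n)))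
        (R.*-mono 0≤1 (ℚP.≤-trans 0≤1 (R.1≤^ d 1≤6)) (fromℕ-mono 1≤density) (R.1≤^ d 1≤6))) ,
      bound
      where
      1≤6 : 1ℚ ℚ.≤ fromℕ 6
      1≤6 = fromℕ-mono {1} {6} (ℕ.s≤s ℕ.z≤n)
      1≤density : 1 ℕ.≤ density
      1≤density = ℕP.*-mono-≤ {1} {12 ℕ.* suc (suc e)} (ℕ.s≤s ℕ.z≤n) (ℕP.m^n>0 4 (suc e))
      bound : ∀ T → 0ℝ < T → CardinalityAtMost (Ball T ∩ F) (densityConstant * T ^ d)
      -- Without a point in the ball `T` has no lower bound, hence the separate case.
      bound T 0<T zero    p inj p∈ = *-nonneg-ℝ {densityConstant} {T ^ d}
        (*-nonneg-ℝ {natural density} {natural 6 ^ d} (fromℚ-mono (0≤fromℕ density)) (^-nonneg-ℝ {natural 6} d (fromℚ-mono (0≤fromℕ 6))))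
        (^-nonneg-ℝ {T} d (<⇒≤ {0ℝ} {T} 0<T))
      bound T 0<T K@(suc _) p inj p∈ = from (cauchy T eighth 0<eighth)
        where
        γ : Fin K → Code
        γ i = proj₁ (proj₂ (p∈ i))
        γ-injective : Injective _≡_ _≡_ γ
        γ-injective {i} {j} eq = inj λ l → ≈-trans {p i l} {fromℚ (decode (γ i) l)} {p j l} (proj₂ (proj₂ (proj₂ (p∈ i))) l)
          (subst (λ g → fromℚ (decode g l) ≈ p j l) (sym eq) (≈-sym {p j l} {fromℚ (decode (γ j) l)} (proj₂ (proj₂ (proj₂ (p∈ j))) l)))
        from : (∃[ N ] ∀ m n → N ℕ.≤ m → N ℕ.≤ n → ℚ.∣ seq T m ℚ.- seq T n ∣ ℚ.≤ eighth) → natural K ≤ densityConstant * T ^ d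
        from (N , close) = finish (ceiling (τ ℚ.+ ½) (ℚP.≤-trans 0≤1 1≤τ+½))
          where
          τ : ℚ
          τ = seq T N
          T≤τ : Eventually (λ n → seq T n ℚ.≤ τ ℚ.+ eighth)
          T≤τ = N , λ n N≤n → abs-≤⁻ (seq T n) τ (close n N N≤n ℕP.≤-refl)
          τ≤T : Eventually (λ n → τ ℚ.≤ seq T n ℚ.+ eighth)
          τ≤T = N , λ n N≤n → abs-≤⁻ τ (seq T n) (close N n ℕP.≤-refl N≤n)
          decode≤ : ∀ i l → ℚ.∣ decode (γ i) l ∣ ℚ.≤ τ ℚ.+ ½
          decode≤ i = ball-bound T τ T≤τ (p i) (proj₂ (p∈ i)) (proj₁ (p∈ i))
          1≤τ+½ : 1ℚ ℚ.≤ τ ℚ.+ ½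
          1≤τ+½ = let l , h = 1≤decode (γ zero) in ℚP.≤-trans h (decode≤ zero l)
          finish : ∃[ U ] (τ ℚ.+ ½ ℚ.≤ fromℕ U × fromℕ U ℚ.≤ τ ℚ.+ ½ ℚ.+ 1ℚ) → natural K ≤ densityConstant * T ^ d
          finish (U , lo , hi) = ≤-trans {natural K} {natural density * natural U ^ d} {densityConstant * T ^ d}
            (≤-trans {natural K} {natural (density ℕ.* U ℕ.^ d)} {natural density * natural U ^ d}
              (natural-mono (point-count U 0<U γ γ-injective (λ i → proj₁ (proj₂ (proj₂ (p∈ i)))) (λ i l → ℚP.≤-trans (decode≤ i l) lo)))
              (ev≤ {natural (density ℕ.* U ℕ.^ d)} {natural density * natural U ^ d} (always λ n → ℚP.≤-reflexive
                (trans (fromℕ-* density (U ℕ.^ d)) (cong (fromℕ density ℚ.*_) (trans (fromℕ-^ U d) (sym (seq-^ (natural U) d n))))))))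
            (≤-trans {natural density * natural U ^ d} {natural density * (natural 6 * T) ^ d} {densityConstant * T ^ d}
              (*-mono-≤ {natural density} {natural density} {natural U ^ d} {(natural 6 * T) ^ d} (fromℚ-mono (0≤fromℕ density))
                (^-nonneg-ℝ {natural 6 * T} d (≤-trans {0ℝ} {natural U} {natural 6 * T} (fromℚ-mono (0≤fromℕ U)) U≤6T))
                (≤-refl {natural density})
                (^-mono-≤ {natural U} {natural 6 * T} d (fromℚ-mono (0≤fromℕ U)) U≤6T))
              (ev≤ {natural density * (natural 6 * T) ^ d} {densityConstant * T ^ d} (always λ n → ℚP.≤-reflexive (trans
                (cong (fromℕ density ℚ.*_) (trans (seq-^ (natural 6 * T) d n) (trans (^-distrib-* (fromℕ 6) (seq T n) d)
                  (cong₂ ℚ._*_ (sym (seq-^ (natural 6) d n)) (sym (seq-^ T d n))))))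
                (sym (ℚP.*-assoc (fromℕ density) (seq (natural 6 ^ d) n) (seq (T ^ d) n)))))))
            where
            0<U : 0 ℕ.< U
            0<U = fromℕ-cancel-≤ (ℚP.≤-trans 1≤τ+½ lo)
            ⅜ : ℚ
            ⅜ = eighth ℚ.+ eighth ℚ.+ eighth
            U≤6T : natural U ≤ natural 6 * T
            U≤6T = ev≤ {natural U} {natural 6 * T} (ev-map (λ n τ≤ → ℚP.≤-trans hi (ℚP.≤-trans
                (ℚP.+-monoˡ-≤ 1ℚ (ℚP.+-monoˡ-≤ ½ τ≤))
                (ℚP.≤-trans (≤-add (fromℕ 5 ℚ.* (seq T n ℚ.- ⅜) ℚ.+ (eighth ℚ.+ eighth)) (+-nonneg (*-nonneg (0≤fromℕ 5) (⅜≤ n τ≤)) (+-nonneg (ℚP.<⇒≤ 0<eighth) (ℚP.<⇒≤ 0<eighth))) refl)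
                  (ℚP.≤-reflexive (solve 1 (λ t → t :+ con eighth :+ con ½ :+ con 1ℚ :+ (con (fromℕ 5) :* (t :- con ⅜) :+ (con eighth :+ con eighth))
                    := con (fromℕ 6) :* t) refl (seq T n)))))) τ≤T)
              where
              ⅜≤ : ∀ n → τ ℚ.≤ seq T n ℚ.+ eighth → 0ℚ ℚ.≤ seq T n ℚ.- ⅜
              ⅜≤ n τ≤ = subst₂ ℚ._≤_ refl (solve 1 (λ t → t :+ con eighth :+ con ½ :- con 1ℚ := t :- con ⅜) refl (seq T n))
                (ℚP.+-monoˡ-≤ (ℚ.- 1ℚ) (ℚP.≤-trans 1≤τ+½ (ℚP.+-monoˡ-≤ ½ τ≤)))

    module Sight (η : ℝ) (0<η : 0ℝ < η) (fine : 4 ℕ.* d ℕ.* 4^ 2 ℕ.≤ 4^ c₂)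
      (hits : ∀ k → Parameters.Hits (suc e) c₂ (k ℕ.+ c) (4^ (suc k)) (θ k)) where

      δ : ℚ
      δ = proj₁ 0<η

      0<δ : 0ℚ ℚ.< δ
      0<δ = proj₁ (proj₂ 0<η)

      reciprocal-bound : ∃[ m ] 1ℚ ℚ.≤ δ ℚ.* fromℕ (suc m)
      reciprocal-bound = let κ , 0<κ , δκ = quotient 0<δ R.0<1; m , κ≤m = R.≤fromℕ κ in
        m , subst (ℚ._≤ δ ℚ.* fromℕ (suc m)) δκ (ℚP.*-monoˡ-≤-nonNeg δ {{ℚ.nonNegative (ℚP.<⇒≤ 0<δ)}}
          (ℚP.≤-trans κ≤m (fromℕ-mono (ℕP.n≤1+n m))))

      -- The 8 d is what `long` needs: twice d for `large-coordinate`, two spans for the segment,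
      -- and hyperplanes twice the spacing apart. The power of 4 is the constant part of the window
      -- length, and 4 m₀² comes from `spacing≤gain`.
      m₀ A C : ℕ
      m₀ = suc (proj₁ reciprocal-bound)
      A = 8 ℕ.* d ℕ.* 4^ (c₂ ℕ.* suc e ℕ.+ c)
      C = A ℕ.* (4 ℕ.* (m₀ ℕ.* m₀))

      1≤C : 1 ℕ.≤ C
      1≤C = ℕP.*-mono-≤ {1} {A} (ℕP.*-mono-≤ {1} {8 ℕ.* d} (ℕ.s≤s ℕ.z≤n) (0<4^ (c₂ ℕ.* suc e ℕ.+ c)))
        (ℕP.*-mono-≤ {1} {4} {1} {m₀ ℕ.* m₀} (ℕ.s≤s ℕ.z≤n) (ℕ.s≤s ℕ.z≤n))

      open Visibility e η 0<η C 1≤C public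

      -- From δ m₀ ≥ 1 follows s + 2 ≤ 2 m₀ (1 + δ s / 2), and the square of the bracket is
      -- `gain s`. The quadratic growth of exp(η s) thus pays for the factor (s+1)(s+2) of the
      -- spacing, however small η is.
      spacing≤gain : ∀ k s → 4^ s ℕ.≤ k → fromℕ (spacing s) ℚ.≤ fromℕ (4 ℕ.* (m₀ ℕ.* m₀)) ℚ.* (fromℕ k ℚ.* gain s)
      spacing≤gain k s 4^s≤k = ℚP.≤-trans (fromℕ-mono (ℕP.*-mono-≤ 4^s≤k (ℕP.*-monoˡ-≤ (2 ℕ.+ s) (ℕP.n≤1+n (suc s)))))
        (ℚP.≤-trans (ℚP.≤-reflexive (trans (fromℕ-* k ((2 ℕ.+ s) ℕ.* (2 ℕ.+ s))) (cong (fromℕ k ℚ.*_) (fromℕ-* (2 ℕ.+ s) (2 ℕ.+ s)))))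
          (ℚP.≤-trans (ℚP.*-monoˡ-≤-nonNeg (fromℕ k) {{ℚ.nonNegative (0≤fromℕ k)}} (R.*-mono (0≤fromℕ (2 ℕ.+ s)) (ℚP.≤-trans (0≤fromℕ (2 ℕ.+ s)) s+2≤) s+2≤ s+2≤))
            (ℚP.≤-reflexive (trans
              (solve 3 (λ m k u → k :* (con 2ℚ :* m :* u :* (con 2ℚ :* m :* u)) := con (fromℕ 4) :* (m :* m) :* (k :* (u :* u))) refl m k′ u)
              (cong (ℚ._* (k′ ℚ.* gain s)) (sym (trans (fromℕ-* 4 (m₀ ℕ.* m₀)) (cong (fromℕ 4 ℚ.*_) (fromℕ-* m₀ m₀)))))))))
        where
        2ℚ m k′ u : ℚ
        2ℚ = fromℕ 2
        m = fromℕ m₀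
        k′ = fromℕ k
        u = 1ℚ ℚ.+ ½ ℚ.* (δ ℚ.* fromℕ s)
        s+2≤ : fromℕ (2 ℕ.+ s) ℚ.≤ 2ℚ ℚ.* m ℚ.* u
        s+2≤ = subst₂ ℚ._≤_ (trans (cong (fromℕ 2 ℚ.+_) (ℚP.*-identityʳ (fromℕ s))) (sym (R.fromℕ-+ 2 s)))
          (solve 3 (λ m δ s → con 2ℚ :* m :+ s :* (δ :* m) := con 2ℚ :* m :* (con 1ℚ :+ con ½ :* (δ :* s))) refl m δ (fromℕ s))
          (ℚP.+-mono-≤ (subst (ℚ._≤ 2ℚ ℚ.* m) (ℚP.*-identityʳ 2ℚ) (ℚP.*-monoˡ-≤-nonNeg 2ℚ (fromℕ-mono {1} {m₀} (ℕ.s≤s ℕ.z≤n))))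
            (ℚP.*-monoˡ-≤-nonNeg (fromℕ s) {{ℚ.nonNegative (0≤fromℕ s)}} (proj₂ reciprocal-bound)))

      module Scale (ε : 𝕀) (j k s : ℕ) (1≤k : 1 ℕ.≤ k) (4^k≤j : 4^ k ℕ.≤ j) (j<4^ : j ℕ.< 4^ (suc k))
        (4^s≤k : 4^ s ℕ.≤ k) (k<4^ : k ℕ.< 4^ (suc s))
        (4^j≤base : natural (4^ j) ≤ base ε) (base≤4^ : base ε ≤ natural (4^ (2 ℕ.+ j))) where

        x : ℝ
        x = proj₁ ε

        0<x : 0ℝ < x
        0<x = proj₁ (proj₂ ε)

        open Parameters (suc e) c₂ (k ℕ.+ c) (4^ (suc k)) using (N; cells)
        open Hitting (suc e) c₂ (k ℕ.+ c) (4^ (suc k)) (θ k) using (radius; coordinate)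
        open Planes (suc e) c₂ (k ℕ.+ c) (4^ (suc k)) (θ k) (spacing s) using (forestPoint; height; Hit; segment-hit; 0<S) renaming (S to span)

        g m L ρ X : ℚ
        g = fromℕ (spacing s)
        m = fromℕ (N j)
        L = span (hits k) (0<spacing s) j<4^ ℚ.+ span (hits k) (0<spacing s) j<4^
        ρ = radius j
        X = recipℕ (4^ (2 ℕ.+ j))

        0≤ρ : 0ℚ ℚ.≤ ρ
        0≤ρ = ℚP.<⇒≤ (0<recipℕ (4^ (j ℕ.+ c₂)))

        0<L : 0ℚ ℚ.< L
        0<L = R.+-pos (0<S (hits k) (0<spacing s) j<4^) (ℚP.<⇒≤ (0<S (hits k) (0<spacing s) j<4^))

        -- The factors are a constant, the power ε^(-(d-1)) up to a constant, and 4^k ≤ j, which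
        -- becomes the logarithm.
        N≡ : N j ≡ 4^ (c₂ ℕ.* suc e ℕ.+ c) ℕ.* (4^ j ℕ.^ suc e ℕ.* 4^ k)
        N≡ = trans (cong 4^ (ℕS.+-*-Solver.solve 5 (λ j c₂ e k c → (j ⊕ c₂) ⊗ e ⊕ (k ⊕ c) ⊜ c₂ ⊗ e ⊕ c ⊕ (j ⊗ e ⊕ k)) refl j c₂ (suc e) k c))
          (trans (4^-+ (c₂ ℕ.* suc e ℕ.+ c) (j ℕ.* suc e ℕ.+ k))
            (cong (4^ (c₂ ℕ.* suc e ℕ.+ c) ℕ.*_) (trans (4^-+ (j ℕ.* suc e) k) (cong (ℕ._* 4^ k) (sym (4^-^ j (suc e)))))))
          where
          open ℕS.+-*-Solver using () renaming (_:+_ to _⊕_; _:*_ to _⊗_; _:=_ to _⊜_)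

        long : fromℚ (fromℕ d ℚ.* L ℚ.+ fromℕ d ℚ.* L) ≤ W ε
        long = ≤-trans {fromℚ (fromℕ d ℚ.* L ℚ.+ fromℕ d ℚ.* L)} {natural C * fromℚ r} {W ε}
          (ev≤ {fromℚ (fromℕ d ℚ.* L ℚ.+ fromℕ d ℚ.* L)} {natural C * fromℚ r} (always λ n → bound))
          (*-mono-≤ {natural C} {natural C} {fromℚ r} {rate (base ε)} 0≤C
            (≤-trans {0ℝ} {base ε} {rate (base ε)} (0≤large {base ε} (E≤base ε)) (≤rate {base ε} (E≤base ε))) (≤-refl {natural C})
            (rate-lower {base ε} j k s 1≤k 4^j≤base 4^k≤j 4^s≤k))
          where
          z y r a : ℚ
          z = fromℕ (4^ j) R.^ suc e
          y = fromℕ k ℚ.* gain s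
          r = z ℚ.* fromℕ j ℚ.* y
          a = fromℕ (4^ (c₂ ℕ.* suc e ℕ.+ c))
          0≤z : 0ℚ ℚ.≤ z
          0≤z = R.^-nonneg (suc e) (0≤fromℕ (4^ j))
          m≡ : m ≡ a ℚ.* (z ℚ.* fromℕ (4^ k))
          m≡ = trans (cong fromℕ N≡) (trans (fromℕ-* (4^ (c₂ ℕ.* suc e ℕ.+ c)) (4^ j ℕ.^ suc e ℕ.* 4^ k))
            (cong (a ℚ.*_) (trans (fromℕ-* (4^ j ℕ.^ suc e) (4^ k)) (cong (ℚ._* fromℕ (4^ k)) (fromℕ-^ (4^ j) (suc e))))))
          C≡ : fromℕ C ≡ fromℕ 8 ℚ.* fromℕ d ℚ.* a ℚ.* fromℕ (4 ℕ.* (m₀ ℕ.* m₀))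
          C≡ = trans (fromℕ-* A (4 ℕ.* (m₀ ℕ.* m₀))) (cong (ℚ._* fromℕ (4 ℕ.* (m₀ ℕ.* m₀)))
            (trans (fromℕ-* (8 ℕ.* d) (4^ (c₂ ℕ.* suc e ℕ.+ c))) (cong (ℚ._* a) (fromℕ-* 8 d))))
          0≤8da : 0ℚ ℚ.≤ fromℕ 8 ℚ.* fromℕ d ℚ.* a
          0≤8da = *-nonneg (*-nonneg (0≤fromℕ 8) (0≤fromℕ d)) (0≤fromℕ _)
          bound : fromℕ d ℚ.* L ℚ.+ fromℕ d ℚ.* L ℚ.≤ fromℕ C ℚ.* r
          bound = ℚP.≤-trans
            (ℚP.≤-reflexive (trans (cong (λ m → fromℕ d ℚ.* ((g ℚ.+ g) ℚ.* m ℚ.+ (g ℚ.+ g) ℚ.* m) ℚ.+ fromℕ d ℚ.* ((g ℚ.+ g) ℚ.* m ℚ.+ (g ℚ.+ g) ℚ.* m)) m≡)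
              (solve 5 (λ d g a z p → d :* ((g :+ g) :* (a :* (z :* p)) :+ (g :+ g) :* (a :* (z :* p))) :+ d :* ((g :+ g) :* (a :* (z :* p)) :+ (g :+ g) :* (a :* (z :* p)))
                := con (fromℕ 8) :* d :* a :* (z :* p :* g)) refl (fromℕ d) g a z (fromℕ (4^ k)))))
            (ℚP.≤-trans (ℚP.*-monoˡ-≤-nonNeg (fromℕ 8 ℚ.* fromℕ d ℚ.* a) {{ℚ.nonNegative 0≤8da}}
                (R.*-mono (*-nonneg 0≤z (0≤fromℕ (4^ k))) (ℚP.≤-trans (0≤fromℕ (spacing s)) (spacing≤gain k s 4^s≤k))
                  (ℚP.*-monoˡ-≤-nonNeg z {{ℚ.nonNegative 0≤z}} (fromℕ-mono 4^k≤j)) (spacing≤gain k s 4^s≤k)))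
              (ℚP.≤-reflexive (trans
                (solve 6 (λ d a z p q y → con (fromℕ 8) :* d :* a :* (z :* p :* (q :* y)) := con (fromℕ 8) :* d :* a :* q :* (z :* p :* y))
                  refl (fromℕ d) a z (fromℕ j) (fromℕ (4 ℕ.* (m₀ ℕ.* m₀))) y)
                (cong (ℚ._* r) (sym C≡)))))

        -- One ρ is the error of the hit and the other that of replacing real end points by rational
        -- ones. As `X` ≤ ε, half of `X` stays in reserve for the strict inequality in
        -- `DistanceTo_From_AtMost_`.
        precise : fromℕ d ℚ.* (ρ ℚ.+ ρ) ℚ.≤ ½ ℚ.* X
        precise = ℚP.≤-trans (ℚP.≤-reflexive (solve 2 (λ d r → d :* (r :+ r) := con ½ :* (con (fromℕ 4) :* d :* r)) refl (fromℕ d) ρ))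
          (ℚP.*-monoˡ-≤-nonNeg ½ 4dρ≤X)
          where
          p f : ℚ
          p = fromℕ (4^ (2 ℕ.+ j))
          f = fromℕ (4^ (j ℕ.+ c₂))
          4dp≤f : fromℕ 4 ℚ.* fromℕ d ℚ.* p ℚ.≤ f
          4dp≤f = subst (ℚ._≤ f) (trans (fromℕ-* (4 ℕ.* d) (4^ (2 ℕ.+ j))) (cong (ℚ._* p) (fromℕ-* 4 d)))
            (fromℕ-mono (subst₂ ℕ._≤_ (trans (ℕP.*-assoc (4 ℕ.* d) (4^ 2) (4^ j)) (cong (4 ℕ.* d ℕ.*_) (sym (4^-+ 2 j))))
              (trans (ℕP.*-comm (4^ c₂) (4^ j)) (sym (4^-+ j c₂))) (ℕP.*-monoˡ-≤ (4^ j) fine)))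
          4dρ≤X : fromℕ 4 ℚ.* fromℕ d ℚ.* ρ ℚ.≤ X
          4dρ≤X = subst₂ ℚ._≤_
            (trans (solve 4 (λ d p x r → con (fromℕ 4) :* d :* p :* (x :* r) := con (fromℕ 4) :* d :* r :* (p :* x)) refl (fromℕ d) p X ρ)
              (trans (cong (fromℕ 4 ℚ.* fromℕ d ℚ.* ρ ℚ.*_) (recipℕ-inverse (4^ (2 ℕ.+ j)))) (ℚP.*-identityʳ _)))
            (trans (solve 3 (λ f x r → f :* (x :* r) := x :* (f :* r)) refl f X ρ)
              (trans (cong (X ℚ.*_) (recipℕ-inverse (4^ (j ℕ.+ c₂)))) (ℚP.*-identityʳ X)))
            (ℚP.*-monoʳ-≤-nonNeg (X ℚ.* ρ) {{ℚ.nonNegative (*-nonneg (ℚP.<⇒≤ (0<recipℕ (4^ (2 ℕ.+ j)))) 0≤ρ)}} 4dp≤f)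

        X≤x : fromℚ X ≤ x
        X≤x = inv-upper x 0<x {X} {fromℕ (4^ (2 ℕ.+ j))} (ℚP.<⇒≤ (0<recipℕ (4^ (2 ℕ.+ j)))) (recipℕ-inverse (4^ (2 ℕ.+ j)))
          (≤-trans {inv x 0<x} {base ε} {natural (4^ (2 ℕ.+ j))} (inv≤base ε) base≤4^)

        forestPoint-cong : ∀ i n {z z′ : Fin (suc e) → ℤ} → (∀ l → z l ≡ z′ l) → ∀ l → forestPoint i n z l ≡ forestPoint i n z′ l
        forestPoint-cong i n {z} {z′} h = axis-or-punchIn i (λ l → forestPoint i n z l ≡ forestPoint i n z′ l)
          (trans (insertAt-lookup (λ l → coordinate n (z l) l) i (height n)) (sym (insertAt-lookup (λ l → coordinate n (z′ l) l) i (height n))))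
          (λ l → trans (insertAt-punchIn (λ l → coordinate n (z l) l) i (height n) l)
            (trans (cong (λ z → coordinate n z l) (h l)) (sym (insertAt-punchIn (λ l → coordinate n (z′ l) l) i (height n) l))))

        along-close : ∀ {t} → 0ℚ ℚ.≤ t → t ℚ.≤ 1ℚ → ∀ (a b a′ b′ : Fin d → ℚ) l → ℚ.∣ a l ℚ.- a′ l ∣ ℚ.≤ ρ → ℚ.∣ b l ℚ.- b′ l ∣ ℚ.≤ ρ →
          ℚ.∣ along a b t l ℚ.- along a′ b′ t l ∣ ℚ.≤ ρ
        along-close {t} 0≤t t≤1 a b a′ b′ l ha hb = subst₂ ℚ._≤_
          (cong ℚ.∣_∣ (solve 5 (λ t a b a′ b′ → (con 1ℚ :- t) :* (a :- a′) :+ t :* (b :- b′)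
            := ((con 1ℚ :- t) :* a :+ t :* b) :- ((con 1ℚ :- t) :* a′ :+ t :* b′)) refl t (a l) (b l) (a′ l) (b′ l)))
          (solve 2 (λ t r → (con 1ℚ :- t) :* r :+ t :* r := r) refl t ρ)
          (ℚP.≤-trans (ℚP.∣p+q∣≤∣p∣+∣q∣ ((1ℚ ℚ.- t) ℚ.* (a l ℚ.- a′ l)) (t ℚ.* (b l ℚ.- b′ l)))
            (ℚP.+-mono-≤ (scaled 0≤1-t ha) (scaled 0≤t hb)))
          where
          0≤1-t : 0ℚ ℚ.≤ 1ℚ ℚ.- t
          0≤1-t = subst (ℚ._≤ 1ℚ ℚ.- t) (ℚP.+-inverseʳ t) (ℚP.+-monoˡ-≤ (ℚ.- t) t≤1)
          scaled : ∀ {t u r} → 0ℚ ℚ.≤ t → ℚ.∣ u ∣ ℚ.≤ r → ℚ.∣ t ℚ.* u ∣ ℚ.≤ t ℚ.* r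
          scaled {t} {u} {r} 0≤t h = subst (ℚ._≤ t ℚ.* r) (trans (cong (ℚ._* ℚ.∣ u ∣) (sym (ℚP.0≤p⇒∣p∣≡p 0≤t))) (sym (ℚP.∣p*q∣≡∣p∣*∣q∣ t u)))
            (ℚP.*-monoˡ-≤-nonNeg t {{ℚ.nonNegative 0≤t}} h)

        -- Beyond such an index no coordinate moves by more than ρ, so the terms there are rational
        -- stand-ins for the end points, to which `segment-hit` applies.
        Stable : ℝ → ℕ → Set
        Stable a N = ∀ m n → N ℕ.≤ m → N ℕ.≤ n → ℚ.∣ seq a m ℚ.- seq a n ∣ ℚ.≤ ρ

        stable : ∀ a → Eventually (Stable a)
        stable a = let N , h = cauchy a ρ (0<recipℕ (4^ (j ℕ.+ c₂))) in
          N , λ n N≤n m m′ p q → h m m′ (ℕP.≤-trans N≤n p) (ℕP.≤-trans N≤n q)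

        module _ (a b : Point d) where

          Sighted : Set
          Sighted = ∃[ p ] (p ∈ F × DistanceTo Segment a b From p AtMost x)

          Approximate : ℕ → Set
          Approximate n = (∀ l → Stable (a l) n) × (∀ l → Stable (b l) n) × (∃[ i ] L ℚ.≤ ℚ.∣ seq (a i) n ℚ.- seq (b i) n ∣)

          approximations : dist a b ≈ W ε → Eventually Approximate
          approximations dist≈W = ev-∀ (λ l → stable (a l)) ⊓ᵉ ev-∀ (λ l → stable (b l)) ⊓ᵉ
            large-coordinate (λ l → a l - b l) (ℕ.s≤s ℕ.z≤n) {L} 0<L
              (≤-trans {fromℚ (fromℕ d ℚ.* L ℚ.+ fromℕ d ℚ.* L)} {W ε} {dist a b} long (≈⇒≥ {dist a b} {W ε} dist≈W))

          module _ (n : ℕ) (stable-a : ∀ l → Stable (a l) n) (stable-b : ∀ l → Stable (b l) n) where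

            a′ b′ : Fin d → ℚ
            a′ l = seq (a l) n
            b′ l = seq (b l) n

            module _ {t : ℚ} (0≤t : 0ℚ ℚ.≤ t) (t≤1 : t ℚ.≤ 1ℚ) (q : Fin d → ℚ) (near : ∀ l → ℚ.∣ q l ℚ.- along a′ b′ t l ∣ ℚ.≤ ρ) where

              y : Point d
              y l = (1ℝ - fromℚ t) * a l + fromℚ t * b l

              q̂ : Point d
              q̂ l = fromℚ (q l)

              close : ∀ m → n ℕ.≤ m → ∀ l → ℚ.∣ q l ℚ.- seq (y l) m ∣ ℚ.≤ ρ ℚ.+ ρ
              close m n≤m l = R.triangle (q l) (along a′ b′ t l) (seq (y l) m) (near l)
                (along-close 0≤t t≤1 a′ b′ (λ l → seq (a l) m) (λ l → seq (b l) m) l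
                  (stable-a l n m ℕP.≤-refl n≤m) (stable-b l n m ℕP.≤-refl n≤m))

              dist≤ : ∀ m → n ℕ.≤ m → seq (dist q̂ y) m ℚ.≤ ½ ℚ.* X
              dist≤ m n≤m = ℚP.≤-trans (norm≤ (λ l → q̂ l - y l) (ℕ.s≤s ℕ.z≤n) m (+-nonneg 0≤ρ 0≤ρ) (close m n≤m)) precise

              dist< : ∀ δ′ → 0ℝ < δ′ → dist q̂ y < x + δ′
              dist< δ′ (κ , 0<κ , κ≤δ′) = ½ ℚ.* X , half-pos (0<recipℕ (4^ (2 ℕ.+ j))) ,
                ev-map {λ m → seq (dist q̂ y) m ℚ.≤ ½ ℚ.* X × X ℚ.≤ seq x m ℚ.+ κ × 0ℚ ℚ.+ κ ℚ.≤ seq δ′ m}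
                  (λ m (h , X≤ , κ≤) → ℚP.≤-trans (ℚP.+-monoˡ-≤ (½ ℚ.* X) h)
                    (ℚP.≤-trans (ℚP.≤-reflexive (half-sum X)) (ℚP.≤-trans X≤
                      (ℚP.+-monoʳ-≤ (seq x m) (subst (ℚ._≤ seq δ′ m) (ℚP.+-identityˡ κ) κ≤)))))
                  ((n , dist≤) ⊓ᵉ X≤x κ 0<κ ⊓ᵉ κ≤δ′)

              near-segment : DistanceTo Segment a b From q̂ AtMost x
              near-segment δ′ 0<δ′ = y , (fromℚ t , fromℚ-mono 0≤t , fromℚ-mono t≤1 , λ l → ≈-refl {y l}) , dist< δ′ 0<δ′

            code : Fin d → ℤ → (Fin (suc e) → ℤ) → Code
            code i h z = s , (k , i) , (h , Vec.tabulate z)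

            decode-code : ∀ i h z l → forestPoint i h z l ≡ decode (code i h z) l
            decode-code i h z = forestPoint-cong i h (λ l → sym (lookup∘tabulate z l))

            fromHit : ∀ i → Hit (hits k) (0<spacing s) j<4^ a′ b′ i → Sighted
            fromHit i (h , z , t , 0≤t , t≤1 , near) = q̂ 0≤t t≤1 q near-q , (code i h z , k<4^ , λ l → ≈-refl {fromℚ (q l)}) ,
              near-segment 0≤t t≤1 q near-q
              where
              q : Fin d → ℚ
              q = decode (code i h z)
              near-q : ∀ l → ℚ.∣ q l ℚ.- along a′ b′ t l ∣ ℚ.≤ ρ
              near-q l = subst (λ p → ℚ.∣ p ℚ.- along a′ b′ t l ∣ ℚ.≤ ρ) (decode-code i h z l) (near l)

          sees : dist a b ≈ W ε → Sighted
          sees dist≈W = from (witness {Approximate} (approximations dist≈W))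
            where
            from : ∃[ n ] Approximate n → Sighted
            from (n , stable-a , stable-b , i , wide) = fromHit n stable-a stable-b i
              (segment-hit (hits k) (0<spacing s) j<4^ (λ l → seq (a l) n) (λ l → seq (b l) n) i
                (subst (L ℚ.≤_) (∣p-q∣≡∣q-p∣ (seq (a i) n) (seq (b i) n)) wide))

      F-visible : Visible F W
      -- As `E` = 4^(4+1), the scale satisfies j ≥ 4; hence k ≥ 1, and a layer `s` with 4^s ≤ k
      -- exists.
      F-visible ε a b dist≈W = fromScale (bracket-ℝ (base ε) 4 (E≤base ε))
        where
        fromScale : (∃[ j ] (4 ℕ.≤ j × natural (4^ j) ≤ base ε × base ε ≤ natural (4^ (2 ℕ.+ j)))) →
          ∃[ p ] (p ∈ F × DistanceTo Segment a b From p AtMost proj₁ ε)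
        fromScale (j , 4≤j , 4^j≤ , ≤4^) = fromBlock (bracket4^ j (ℕP.≤-trans (ℕ.s≤s ℕ.z≤n) 4≤j))
          where
          fromBlock : (∃[ k ] (4^ k ℕ.≤ j × j ℕ.< 4^ (suc k))) → ∃[ p ] (p ∈ F × DistanceTo Segment a b From p AtMost proj₁ ε)
          fromBlock (k , 4^k≤j , j<4^) = fromLayer (bracket4^ k 1≤k)
            where
            1≤k : 1 ℕ.≤ k
            1≤k = 4^-order (ℕP.≤-<-trans (ℕP.≤-trans (ℕP.≤-reflexive (trans (4^-suc 0) (cong (4 ℕ.*_) (4^≡ 0)))) 4≤j) j<4^)
            fromLayer : (∃[ s ] (4^ s ℕ.≤ k × k ℕ.< 4^ (suc s))) → ∃[ p ] (p ∈ F × DistanceTo Segment a b From p AtMost proj₁ ε)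
            fromLayer (s , 4^s≤k , k<4^) = Scale.sees ε j k s 1≤k 4^k≤j j<4^ 4^s≤k k<4^ 4^j≤ ≤4^ a b dist≈W

      dense-forest : Σ[ F ∈ Pred (Point d) 0ℓ ] Σ[ W ∈ (𝕀 → ℝ) ] (IsDenseForest F W × IsBigORate d η W)
      dense-forest = F , W , ((λ {p} {q} → F-respects {p} {q}) , F-density , W-positive , W-decreasing , W-tendsTo+∞ , F-visible) , W-bigO

  denseForest : ∀ e (η : ℝ) → 0ℝ < η →
    Σ[ F ∈ Pred (Point (2 ℕ.+ e)) 0ℓ ] Σ[ W ∈ (𝕀 → ℝ) ] (IsDenseForest F W × IsBigORate (2 ℕ.+ e) η W)
  denseForest e η 0<η = from (blocks (suc e) c₂)
    where
    d c₂ : ℕ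
    d = 2 ℕ.+ e
    -- 4 d 4² = d 4³, and d ≤ 4^d.
    c₂ = d ℕ.+ 3
    fine : 4 ℕ.* d ℕ.* 4^ 2 ℕ.≤ 4^ c₂
    fine = ℕP.≤-trans (ℕP.≤-reflexive (trans (cong (ℕ._* 4^ 2) (ℕP.*-comm 4 d)) (ℕP.*-assoc d 4 (4^ 2))))
      (ℕP.≤-trans (ℕP.*-mono-≤ (ℕP.<⇒≤ (n<4^n d)) (ℕP.≤-reflexive (sym (4^-suc 2))))
        (ℕP.≤-reflexive (sym (4^-+ d 3))))
    from : (∃[ c ] ∀ k → ∃[ θ ] Parameters.Hits (suc e) c₂ (k ℕ.+ c) (4^ (suc k)) θ) →
      Σ[ F ∈ Pred (Point d) 0ℓ ] Σ[ W ∈ (𝕀 → ℝ) ] (IsDenseForest F W × IsBigORate d η W)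
    from (c , good) = Forest.Sight.dense-forest e c₂ c (λ k → proj₁ (good k)) η 0<η fine (λ k → proj₂ (good k))

open import Defs
open import Level using (0ℓ)
open import Data.Nat.Base as ℕ using (ℕ)
open import Data.Product using (_×_; Σ-syntax)
open import Relation.Unary using (Pred)

corollary1p0p1 : ∀ (d : ℕ) → 2 ℕ.≤ d → ∀ (η : ℝ) → 0ℝ < η →
    Σ[ F ∈ Pred (Point d) 0ℓ ] Σ[ W ∈ (𝕀 → ℝ) ] (IsDenseForest F W × IsBigORate d η W)
corollary1p0p1 (ℕ.suc (ℕ.suc e)) (ℕ.s≤s (ℕ.s≤s ℕ.z≤n)) = Construction.denseForest e
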